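{- Let $q$ be a prime power with $q\equiv 1\pmod{20}$. Fix a primitive root $\alpha$ of $\mathbb{F}_q$, and set $\beta=\alpha^{(q-1)/5}$. The following statements are equivalent. (i) $(q,5)$ gives a $3$-design. (ii) $(q,10)$ gives a $3$-design. (iii) $\chi(1+\beta)=-1$. (iv) There exists $\theta\in \mathbb{F}_q^\times$ such that $\chi(\theta)=-1$ and $\theta^2-4\theta-1=0$. (v) $5\not\in \langle \alpha^4\rangle$. Moreover, if $q=p$ is a prime number, then each of the following conditions is equivalent to each of the conditions (i)–(v): (vi) There exists no $(x,y)\in \mathbb{Z}^2$ such that $p=x^2+20y^2$. (vii) There exists no $(x,y)\in \mathbb{Z}^2$ such that $p=x^2+100y^2$.
   Context: $\mathrm{PSL}(2,q)$ acts on the projective line $\mathrm{PG}(1,q)=\mathbb{F}_q\cup\{\infty\}$ by linear fractional transformations $z\mapsto (az+b)/(cz+d)$. For $q\equiv 1\pmod 4$ and a divisor $k$ of $q-1$, with $\alpha$ a primitive root of $\mathbb{F}_q$ and $B=\langle \alpha^{(q-1)/k}\rangle$ the multiplicative subgroup of order $k$, one says that $(q,k)$ gives a $3$-design if the $\mathrm{PSL}(2,q)$-orbit of $B$ is the set of blocks of a $3$-$(q+1,k,\lambda)$ design for some positive integer $\lambda$. $\chi\colon\mathbb{F}_q^\times\to\{\pm1\}$ is the quadratic residue character ($\chi(a)=1$ iff $a$ is a nonzero square in $\mathbb{F}_q$). -}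

module Defs where

open import Level using (0ℓ)
open import Data.Nat as ℕ using (ℕ; zero; suc; _∸_; _<_; NonZero)
open import Data.Nat.DivMod using (_/_)
open import Data.Integer as ℤ using (ℤ; +_)
open import Data.Maybe using (Maybe; just; nothing)
open import Data.Product using (Σ; ∃; ∃-syntax; _×_; _,_)
open import Data.List using (List; length)
open import Data.List.Membership.Propositional using (_∈_)
open import Data.List.Relation.Unary.Unique.Propositional using (Unique)
open import Data.List.Relation.Unary.All using (All)
open import Data.List.Relation.Unary.Any using (Any)
open import Data.List.Relation.Unary.AllPairs using (AllPairs)
open import Relation.Nullary using (¬_; yes; no)
open import Relation.Binary.PropositionalEquality using (_≡_)
open import Relation.Binary.Definitions using (DecidableEquality)
open import Algebra.Structures using (IsCommutativeRing)
open import Function.Bundles using (_⇔_)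

-- A finite field with exactly q elements (equality is propositional).
-- Any finite field has prime-power order, so "q a prime power and F_q"
-- is rendered as "q : ℕ and F : FiniteField q".

record FiniteField (q : ℕ) : Set₁ where
  infixl 6 _+_
  infixl 7 _*_
  field
    Carrier    : Set
    _≟_        : DecidableEquality Carrier
    0# 1#      : Carrier
    _+_ _*_    : Carrier → Carrier → Carrier
    -_         : Carrier → Carrier
    _⁻¹        : Carrier → Carrier
    isCommutativeRing : IsCommutativeRing _≡_ _+_ _*_ -_ 0# 1#
    0≢1        : ¬ (0# ≡ 1#)
    inverseʳ   : ∀ x → ¬ (x ≡ 0#) → x * (x ⁻¹) ≡ 1#
    elements   : List Carrier
    complete   : ∀ x → x ∈ elements
    unique     : Unique elements
    size       : length elements ≡ q

module _ {q : ℕ} (F : FiniteField q) where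
  open FiniteField F

  infixr 8 _^_
  _^_ : Carrier → ℕ → Carrier
  x ^ zero  = 1#
  x ^ suc n = x * (x ^ n)

  fromℕ : ℕ → Carrier
  fromℕ zero    = 0#
  fromℕ (suc n) = 1# + fromℕ n

  IsPrimitiveRoot : Carrier → Set
  IsPrimitiveRoot α = ¬ (α ≡ 0#) × (∀ x → ¬ (x ≡ 0#) → ∃[ k ] α ^ k ≡ x)

  χ≡-1 : Carrier → Set
  χ≡-1 x = ¬ (x ≡ 0#) × ¬ (∃[ y ] y * y ≡ x)

  _∈⟨_⟩ : Carrier → Carrier → Set
  x ∈⟨ γ ⟩ = ∃[ k ] γ ^ k ≡ x

  -- Projective line PG(1,q) = F_q ∪ {∞}, with ∞ = nothing.
  Point : Set
  Point = Maybe Carrier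

  -- elements of SL(2,q); PSL(2,q) acts through SL(2,q) (±I act trivially),
  -- so the PSL(2,q)-orbit equals the SL(2,q)-orbit.
  record SL2 : Set where
    constructor mat
    field
      a b c d : Carrier
      det     : a * d + - (b * c) ≡ 1#

  act : SL2 → Point → Point
  act (mat a b c d _) nothing with c ≟ 0#
  ... | yes _ = nothing
  ... | no  _ = just (a * (c ⁻¹))
  act (mat a b c d _) (just z) with (c * z + d) ≟ 0#
  ... | yes _ = nothing
  ... | no  _ = just ((a * z + b) * ((c * z + d) ⁻¹))

  -- membership of p in the block g(B), B = ⟨γ⟩ = {γ^i | i < k} (γ of order k)
  InBlock : Carrier → ℕ → SL2 → Point → Set
  InBlock γ k g p = ∃[ i ] (i < k × act g (just (γ ^ i)) ≡ p)

  SameBlock : Carrier → ℕ → SL2 → SL2 → Set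
  SameBlock γ k g h = ∀ p → InBlock γ k g p ⇔ InBlock γ k h p

  ContainsTriple : Carrier → ℕ → Point → Point → Point → SL2 → Set
  ContainsTriple γ k x y z g = InBlock γ k g x × InBlock γ k g y × InBlock γ k g z

  NumBlocksThrough : Carrier → ℕ → Point → Point → Point → ℕ → Set
  NumBlocksThrough γ k x y z lam =
    ∃[ gs ] ( length gs ≡ lam
            × All (ContainsTriple γ k x y z) gs
            × AllPairs (λ g h → ¬ SameBlock γ k g h) gs
            × (∀ g → ContainsTriple γ k x y z g → Any (SameBlock γ k g) gs) )

  OrbitIs3Design : Carrier → ℕ → Set
  OrbitIs3Design γ k =
    ∃[ lam ] ( 0 < lam
           × (∀ x y z → ¬ x ≡ y → ¬ x ≡ z → ¬ y ≡ z → NumBlocksThrough γ k x y z lam) )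

  Gives3Design : Carrier → (k : ℕ) → .{{NonZero k}} → Set
  Gives3Design α k = OrbitIs3Design (α ^ ((q ∸ 1) / k)) k

RepBy : ℕ → ℕ → Set
RepBy n p = ∃[ x ] ∃[ y ] (+ p ≡ x ℤ.* x ℤ.+ (+ n) ℤ.* (y ℤ.* y))

module Submission where

-- Every condition is compared with χ(√5) = -1, where √5 = s = 1 + 2(β + β⁻¹).
--
-- Designs. SL(2, q) has two orbits on triples of distinct points, separated by the quadratic
-- character τ of the product of the three brackets, and an element carrying one ordered triple
-- to another is unique up to sign. Counting the g whose block g B contains T in two ways gives
-- λ(T) · |Stab B| = 2 · #{ordered triples t of B with τ(t) = τ(T)}. So the orbit of B is a
-- 3-design iff B has equally many triples of both types, and as τ(γⁱ, γʲ, γˡ) depends only on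
-- the numbers χ(1 - γⁿ), this is a finite computation in terms of χ(1 + β), χ(1 - β) and χ(2).
--
-- Golden ratio. The roots 2 ± √5 have product -1, 2 + √5 = (1 + β + β⁻¹)³ and
-- 1 + β + β⁻¹ = -β²(1 + β), while √5 (2 + √5) = 5 + 2√5 is a square because of tan²(2π/5) = 5 + 2√5.
--
-- Primes. Thue's lemma gives p = x² + 20y² or p = 4x² + 5y², and p = a² + 4b². Taking square roots
-- of -1 and -5 from these equations expresses χ(√5) through χ(x)χ(y), respectively through
-- χ(b)χ(a + 4b), which quadratic reciprocity for the Jacobi symbol evaluates modulo 5.

open import Defs
open import Algebra.Bundles using (CommutativeRing; RawRing)
import Algebra.Properties.Ring as RingProperties
import Algebra.Solver.Ring as RingSolver
open import Algebra.Solver.Ring.AlmostCommutativeRing using (fromCommutativeRing; _-Raw-AlmostCommutative⟶_)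
open import Algebra.Structures using (IsCommutativeMonoid)
open import Axiom.UniquenessOfIdentityProofs using (module Decidable⇒UIP)
open import Data.Empty using (⊥-elim)
open import Data.Fin as Fin using (Fin; toℕ; remQuot)
import Data.Fin.Properties as Finₚ
open import Data.Integer as ℤ using (ℤ; -[1+_]; ∣_∣; sign; _◃_)
import Data.Integer.Properties as ℤₚ
import Data.Integer.Tactic.RingSolver as ℤSolver
open import Data.List using (List; []; _∷_; _++_; length; map; lookup; foldr; upTo; applyDownFrom; concat; filter; deduplicate; cartesianProduct)
open import Data.List.Membership.Propositional using (_∈_; lose; find)
open import Data.List.Membership.Propositional.Properties using (∈-∃++; ∈-++⁺ˡ; ∈-++⁺ʳ; ∈-++⁻; ∈-map⁻; ∈-map⁺; ∈-upTo⁺; ∈-applyDownFrom⁺; ∈-applyDownFrom⁻; ∈-concat⁺′; ∈-concat⁻′; ∈-filter⁺; ∈-filter⁻; ∈-deduplicate⁺; ∈-cartesianProduct⁺; ∈-cartesianProduct⁻; ∈-upTo⁻)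
open import Data.List.Properties using (length-++-sucʳ; length-map; length-upTo; length-++)
open import Data.List.Relation.Binary.Permutation.Propositional using (_↭_; ↭-sym; ↭-trans; prep; ↭-refl; ↭⇒↭ₛ)
open import Data.List.Relation.Binary.Permutation.Propositional.Properties using (shift; map⁺)
open import Data.List.Relation.Binary.Permutation.Setoid.Properties using (foldr-commMonoid)
open import Data.List.Relation.Unary.All as All using ([]; _∷_; All)
import Data.List.Relation.Unary.All.Properties as Allₚ
open import Data.List.Relation.Unary.AllPairs as AllPairs using ([]; _∷_; AllPairs)
import Data.List.Relation.Unary.AllPairs.Properties as AllPairsₚ
open import Data.List.Relation.Unary.Any as Any using (here; there; Any)
import Data.List.Relation.Unary.Any.Properties as Anyₚ
import Data.List.Relation.Unary.Unique.DecPropositional.Properties as UniqueDecₚ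
open import Data.List.Relation.Unary.Unique.Propositional using (Unique)
import Data.List.Relation.Unary.Unique.Propositional.Properties as Uniqueₚ
open import Data.Maybe using (just; nothing)
open import Data.Maybe.Properties using (≡-dec; just-injective)
open import Data.Nat as ℕ using (ℕ; zero; suc; _≤_; z≤n; s≤s; _<_; _%_; _/_; _∸_; _≤?_; z<s; ∣_-_∣)
open import Data.Nat.Coprimality as Coprime using (Coprime; coprime-divisor; coprime-Bézout; prime⇒coprime)
open import Data.Nat.DivMod using (m≡m%n+[m/n]*n; m%n<n; m%n≤n; %-distribˡ-*; m<n*o⇒m/o<n; m/n*n≤m; /-mono-≤; m*n/n≡m; m∣n⇒o%n%m≡o%m; [m+kn]%n≡m%n)
open import Data.Nat.Divisibility using (_∣_; divides; ∣⇒≤; ∣n⇒∣m*n; m%n≡0⇒n∣m; n∣m⇒m%n≡0; ∣m∣n⇒∣m+n; ∣-trans; ∣m⇒∣m*n; ∣1⇒≡1)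
open import Data.Nat.GCD using (module Bézout)
open import Data.Nat.Primality using (Prime; prime?; prime⇒irreducible)
import Data.Nat.Properties as ℕₚ
open import Data.Nat.Tactic.RingSolver using (solve-∀)
open import Data.Product using (∃-syntax; _×_; _,_; proj₁; proj₂)
open import Data.Sign as Sign using (Sign)
import Data.Sign.Properties as Signₚ
open import Data.Sum using (inj₁; inj₂; _⊎_; [_,_]′; map₂)
open import Data.Unit using (⊤; tt)
open import Function.Bundles using (_⇔_; mk⇔; Equivalence)
import Function.Properties.Equivalence as ⇔
open import Relation.Binary.Definitions using (tri<; tri≈; tri>)
open import Relation.Binary.PropositionalEquality hiding ([_])
open import Relation.Nullary using (¬_; Dec; yes; no)
open import Relation.Nullary.Decidable using (dec⇒maybe; map′; from-yes; True; toWitness; ¬?; _→-dec_; _×-dec_; _⊎-dec_)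

-- χ(√5) is in effect the biquadratic character of 5, and no congruence on q settles it: x² + 20y²
-- and 4x² + 5y² lie in one genus, and both represent primes q ≡ 1 (mod 20), for instance 101 and
-- 41. Biquadratic reciprocity is avoided because a representation of q supplies explicit field
-- elements whose characters are quadratic symbols of integers. Those integers need not be prime, so
-- reciprocity must hold for composite odd moduli; a Jacobi symbol defined by Gauss's lemma delivers
-- this without any factorization. In every reciprocity step one of the two moduli is q or 5, both 1
-- modulo 4, so no sign appears. Likewise -1 is a square in the field, so χ ignores signs. Hence the
-- type τ does not depend on the order of a triple, and both roots of θ² - 4θ - 1 have the same
-- character.

private variable
  A B : Set

-- Lists without repetition

∈-++-swap : ∀ {x y : A} us {vs} → x ∈ us ++ y ∷ vs → ¬ x ≡ y → x ∈ us ++ vs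
∈-++-swap us x∈ x≢y with ∈-++⁻ us x∈
... | inj₁ x∈us = ∈-++⁺ˡ x∈us
... | inj₂ (here x≡y) = ⊥-elim (x≢y x≡y)
... | inj₂ (there x∈vs) = ∈-++⁺ʳ us x∈vs

-- The head of `xs` occurs in `ys`; deleting that occurrence keeps the inclusion because `xs` has no
-- repetition, and the length bound leaves nothing over at the end.
unique-⊆⇒↭ : ∀ {xs ys : List A} → Unique xs → (∀ {x} → x ∈ xs → x ∈ ys) →
  length ys ≤ length xs → xs ↭ ys
unique-⊆⇒↭ {xs = []} {[]} _ _ _ = ↭-refl
unique-⊆⇒↭ {xs = x ∷ xs} (x∉ ∷ u) sub len with ∈-∃++ (sub (here refl))
... | us , vs , refl = ↭-trans (prep x (unique-⊆⇒↭ u sub′ len′)) (↭-sym (shift x us vs))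
  where
  sub′ : ∀ {z} → z ∈ xs → z ∈ us ++ vs
  sub′ z∈ = ∈-++-swap us (sub (there z∈)) (λ z≡x → All.lookup x∉ z∈ (sym z≡x))
  len′ : length (us ++ vs) ≤ length xs
  len′ = ℕ.s≤s⁻¹ (subst (_≤ suc (length xs)) (length-++-sucʳ us x vs) len)

unique-⊆⇒length≤ : ∀ {xs ys : List A} → Unique xs → (∀ {x} → x ∈ xs → x ∈ ys) → length xs ≤ length ys
unique-⊆⇒length≤ {xs = []} _ _ = z≤n
unique-⊆⇒length≤ {xs = x ∷ xs} (x∉ ∷ u) sub with ∈-∃++ (sub (here refl))
... | us , vs , refl = subst (suc (length xs) ≤_) (sym (length-++-sucʳ us x vs)) (s≤s (unique-⊆⇒length≤ u (λ z∈ → ∈-++-swap us (sub (there z∈)) (λ z≡x → All.lookup x∉ z∈ (sym z≡x)))))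

unique-map : ∀ (f : A → B) {xs} → (∀ {x y} → x ∈ xs → y ∈ xs → f x ≡ f y → x ≡ y) → Unique xs → Unique (map f xs)
unique-map f inj [] = []
unique-map f {x ∷ xs} inj (x∉ ∷ u) =
  All.tabulate (λ z∈ fx≡z → let y , y∈ , z≡fy = ∈-map⁻ f z∈ in
    All.lookup x∉ y∈ (inj (here refl) (there y∈) (trans fx≡z z≡fy)))
  ∷ unique-map f (λ p q → inj (there p) (there q)) u

-- Lets a sum or product be reindexed by an injective self-map. It is applied to translation by 1 on
-- the field and to the absolute residues of bj in Gauss's lemma.
inj⇒map-↭ : ∀ (f : A → A) {xs} → Unique xs → (∀ {x y} → x ∈ xs → y ∈ xs → f x ≡ f y → x ≡ y) →
  (∀ {x} → x ∈ xs → f x ∈ xs) → map f xs ↭ xs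
inj⇒map-↭ f {xs} u inj sub = unique-⊆⇒↭ (unique-map f inj u)
  (λ z∈ → let x , x∈ , e = ∈-map⁻ f z∈ in subst (_∈ xs) (sym e) (sub x∈))
  (ℕₚ.≤-reflexive (sym (length-map f xs)))

-- Arithmetic in a finite field

module Field {q : ℕ} (F : FiniteField q) where
  open FiniteField F public

  R : CommutativeRing _ _
  R = record { isCommutativeRing = isCommutativeRing }

  open CommutativeRing R public using
    (+-comm; +-assoc; *-comm; *-assoc; +-identityˡ; +-identityʳ; *-identityˡ; *-identityʳ
    ; zeroˡ; zeroʳ; distribˡ; distribʳ; -‿inverseˡ; -‿inverseʳ; *-commutativeMonoid; *-isCommutativeMonoid; +-isCommutativeMonoid)
  open RingProperties (CommutativeRing.ring R) public using
    (-‿distribˡ-*; -‿distribʳ-*; -0#≈0#; -‿involutive; -‿+-comm)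

  [_] : ℕ → Carrier
  [ n ] = fromℕ F n

  []-+ : ∀ m n → [ m ℕ.+ n ] ≡ [ m ] + [ n ]
  []-+ zero n = sym (+-identityˡ _)
  []-+ (suc m) n = trans (cong (1# +_) ([]-+ m n)) (sym (+-assoc _ _ _))

  []-* : ∀ m n → [ m ℕ.* n ] ≡ [ m ] * [ n ]
  []-* zero n = sym (zeroˡ _)
  []-* (suc m) n = trans ([]-+ n (m ℕ.* n))
    (trans (cong₂ _+_ (sym (*-identityˡ _)) ([]-* m n)) (sym (distribʳ _ _ _)))

  -- The ring homomorphism from the integers. It gives the ring solver integer coefficients, whose
  -- equality is decidable whatever the characteristic.
  ⟦_⟧ : ℤ → Carrier
  ⟦ ℤ.+ n ⟧ = [ n ]
  ⟦ -[1+ n ] ⟧ = - [ suc n ]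

  private
    cancel-1 : ∀ x y → x + - y ≡ (1# + x) + - (1# + y)
    cancel-1 x y = sym (begin
      (1# + x) + - (1# + y)     ≡⟨ cong₂ _+_ (+-comm 1# x) (sym (-‿+-comm 1# y)) ⟩
      (x + 1#) + (- 1# + - y)   ≡⟨ +-assoc x 1# _ ⟩
      x + (1# + (- 1# + - y))   ≡⟨ cong (x +_) (sym (+-assoc 1# _ _)) ⟩
      x + ((1# + - 1#) + - y)   ≡⟨ cong (λ t → x + (t + - y)) (-‿inverseʳ 1#) ⟩
      x + (0# + - y)            ≡⟨ cong (x +_) (+-identityˡ _) ⟩
      x + - y ∎)
      where open ≡-Reasoning

  ⟦⊖⟧ : ∀ m n → ⟦ m ℤ.⊖ n ⟧ ≡ [ m ] + - [ n ]
  ⟦⊖⟧ zero zero = sym (-‿inverseʳ 0#)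
  ⟦⊖⟧ zero (suc n) = sym (+-identityˡ _)
  ⟦⊖⟧ (suc m) zero = sym (trans (cong ([ suc m ] +_) -0#≈0#) (+-identityʳ _))
  ⟦⊖⟧ (suc m) (suc n) = trans (cong ⟦_⟧ (ℤₚ.[1+m]⊖[1+n]≡m⊖n m n))
    (trans (⟦⊖⟧ m n) (cancel-1 _ _))

  ⟦⟧-neg : ∀ x → ⟦ ℤ.- x ⟧ ≡ - ⟦ x ⟧
  ⟦⟧-neg (ℤ.+ zero) = sym -0#≈0#
  ⟦⟧-neg (ℤ.+ suc n) = refl
  ⟦⟧-neg -[1+ n ] = sym (-‿involutive _)

  ⟦⟧-+ : ∀ x y → ⟦ x ℤ.+ y ⟧ ≡ ⟦ x ⟧ + ⟦ y ⟧
  ⟦⟧-+ (ℤ.+ m) (ℤ.+ n) = []-+ m n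
  ⟦⟧-+ (ℤ.+ m) -[1+ n ] = ⟦⊖⟧ m (suc n)
  ⟦⟧-+ -[1+ m ] (ℤ.+ n) = trans (⟦⊖⟧ n (suc m)) (+-comm _ _)
  ⟦⟧-+ -[1+ m ] -[1+ n ] = trans (cong (λ t → - [ suc t ]) (sym (ℕₚ.+-suc m n)))
    (trans (cong -_ ([]-+ (suc m) (suc n))) (sym (-‿+-comm _ _)))

  private
    ⟦⟧-*⁺ : ∀ m y → ⟦ ℤ.+ m ℤ.* y ⟧ ≡ [ m ] * ⟦ y ⟧
    ⟦⟧-*⁺ m (ℤ.+ n) = trans (cong ⟦_⟧ (sym (ℤₚ.pos-* m n))) ([]-* m n)
    ⟦⟧-*⁺ m -[1+ n ] = begin
      ⟦ ℤ.+ m ℤ.* (ℤ.- ℤ.+ suc n) ⟧   ≡⟨ cong ⟦_⟧ (sym (ℤₚ.neg-distribʳ-* (ℤ.+ m) (ℤ.+ suc n))) ⟩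
      ⟦ ℤ.- (ℤ.+ m ℤ.* ℤ.+ suc n) ⟧   ≡⟨ ⟦⟧-neg (ℤ.+ m ℤ.* ℤ.+ suc n) ⟩
      - ⟦ ℤ.+ m ℤ.* ℤ.+ suc n ⟧       ≡⟨ cong -_ (⟦⟧-*⁺ m (ℤ.+ suc n)) ⟩
      - ([ m ] * [ suc n ])       ≡⟨ -‿distribʳ-* _ _ ⟩
      [ m ] * - [ suc n ] ∎
      where open ≡-Reasoning

  ⟦⟧-* : ∀ x y → ⟦ x ℤ.* y ⟧ ≡ ⟦ x ⟧ * ⟦ y ⟧
  ⟦⟧-* (ℤ.+ m) y = ⟦⟧-*⁺ m y
  ⟦⟧-* -[1+ m ] y = begin
    ⟦ (ℤ.- ℤ.+ suc m) ℤ.* y ⟧  ≡⟨ cong ⟦_⟧ (sym (ℤₚ.neg-distribˡ-* (ℤ.+ suc m) y)) ⟩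
    ⟦ ℤ.- (ℤ.+ suc m ℤ.* y) ⟧  ≡⟨ ⟦⟧-neg (ℤ.+ suc m ℤ.* y) ⟩
    - ⟦ ℤ.+ suc m ℤ.* y ⟧      ≡⟨ cong -_ (⟦⟧-*⁺ (suc m) y) ⟩
    - ([ suc m ] * ⟦ y ⟧)    ≡⟨ -‿distribˡ-* _ _ ⟩
    - [ suc m ] * ⟦ y ⟧ ∎
    where open ≡-Reasoning

  -- Agrees with ⟦_⟧, but sends 1 to 1# on the nose, so that solver constants match goals.
  ⟦_⟧′ : ℤ → Carrier
  ⟦ ℤ.+ 1 ⟧′ = 1#
  ⟦ x ⟧′ = ⟦ x ⟧

  private
    ′≡ : ∀ x → ⟦ x ⟧′ ≡ ⟦ x ⟧
    ′≡ (ℤ.+ zero) = refl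
    ′≡ (ℤ.+ suc zero) = sym (+-identityʳ 1#)
    ′≡ (ℤ.+ suc (suc n)) = refl
    ′≡ -[1+ n ] = refl

    ℤ-raw : RawRing _ _
    ℤ-raw = record { Carrier = ℤ ; _≈_ = _≡_ ; _+_ = ℤ._+_ ; _*_ = ℤ._*_ ; -_ = ℤ.-_ ; 0# = ℤ.+ 0 ; 1# = ℤ.+ 1 }

    morphism : ℤ-raw -Raw-AlmostCommutative⟶ fromCommutativeRing R
    morphism = record
      { ⟦_⟧ = ⟦_⟧′
      ; +-homo = λ x y → trans (′≡ (x ℤ.+ y)) (trans (⟦⟧-+ x y) (sym (cong₂ _+_ (′≡ x) (′≡ y))))
      ; *-homo = λ x y → trans (′≡ (x ℤ.* y)) (trans (⟦⟧-* x y) (sym (cong₂ _*_ (′≡ x) (′≡ y))))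
      ; -‿homo = λ x → trans (′≡ (ℤ.- x)) (trans (⟦⟧-neg x) (sym (cong -_ (′≡ x))))
      ; 0-homo = refl
      ; 1-homo = refl
      }

  open RingSolver ℤ-raw (fromCommutativeRing R) morphism
    (λ x y → Data.Maybe.map (cong ⟦_⟧′) (dec⇒maybe (x ℤₚ.≟ y))) public
    using (solve; _:=_; _:+_; _:*_; :-_; _:-_; con; Polynomial)

  κ : ∀ {n} → ℕ → Polynomial n
  κ n = con (ℤ.+ n)

  module _ where
    open ≡-Reasoning

    *-cancelˡ : ∀ {a x y} → ¬ a ≡ 0# → a * x ≡ a * y → x ≡ y
    *-cancelˡ {a} {x} {y} a≢0 e = begin
      x               ≡⟨ lem x ⟩
      a ⁻¹ * (a * x)  ≡⟨ cong (a ⁻¹ *_) e ⟩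
      a ⁻¹ * (a * y)  ≡⟨ sym (lem y) ⟩
      y ∎
      where
      lem : ∀ z → z ≡ a ⁻¹ * (a * z)
      lem z = begin
        z                ≡⟨ sym (*-identityˡ z) ⟩
        1# * z           ≡⟨ cong (_* z) (sym (trans (*-comm _ _) (inverseʳ a a≢0))) ⟩
        (a ⁻¹ * a) * z   ≡⟨ *-assoc _ _ _ ⟩
        a ⁻¹ * (a * z) ∎

  x*y≡0 : ∀ {x y} → x * y ≡ 0# → (x ≡ 0#) ⊎ (y ≡ 0#)
  x*y≡0 {x} {y} e with x ≟ 0#
  ... | yes p = inj₁ p
  ... | no x≢0 = inj₂ (*-cancelˡ x≢0 (trans e (sym (zeroʳ x))))

  *-≢0 : ∀ {x y} → ¬ x ≡ 0# → ¬ y ≡ 0# → ¬ x * y ≡ 0#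
  *-≢0 x≢0 y≢0 e with x*y≡0 e
  ... | inj₁ p = x≢0 p
  ... | inj₂ p = y≢0 p

  *≢0⇒ˡ : ∀ {x y} → ¬ x * y ≡ 0# → ¬ x ≡ 0#
  *≢0⇒ˡ {y = y} h refl = h (zeroˡ y)

  *≢0⇒ʳ : ∀ {x y} → ¬ x * y ≡ 0# → ¬ y ≡ 0#
  *≢0⇒ʳ {x} h refl = h (zeroʳ x)

  1≢0 : ¬ 1# ≡ 0#
  1≢0 e = 0≢1 (sym e)

  neg-≢0 : ∀ {x} → ¬ x ≡ 0# → ¬ - x ≡ 0#
  neg-≢0 x≢0 e = x≢0 (trans (sym (-‿involutive _)) (trans (cong -_ e) -0#≈0#))

  x-y≡0⇒x≡y : ∀ {x y} → x + - y ≡ 0# → x ≡ y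
  x-y≡0⇒x≡y {x} {y} e = trans (solve 2 (λ x y → x := (x :- y) :+ y) refl x y) (trans (cong (_+ y) e) (+-identityˡ y))

  x≡y⇒x-y≡0 : ∀ {x y} → x ≡ y → x + - y ≡ 0#
  x≡y⇒x-y≡0 {x} refl = -‿inverseʳ x

  x²≡y² : ∀ {x y} → x * x ≡ y * y → (x ≡ y) ⊎ (x ≡ - y)
  x²≡y² {x} {y} e with x*y≡0 {x + - y} {x + y} (trans
      (solve 2 (λ x y → (x :- y) :* (x :+ y) := x :* x :- y :* y) refl x y) (x≡y⇒x-y≡0 e))
  ... | inj₁ p = inj₁ (x-y≡0⇒x≡y p)
  ... | inj₂ p = inj₂ (x-y≡0⇒x≡y (trans (cong (x +_) (-‿involutive y)) p))

  infixr 8 _↑_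
  _↑_ : Carrier → ℕ → Carrier
  _↑_ = _^_ F

  ↑-+ : ∀ x m n → x ↑ (m ℕ.+ n) ≡ x ↑ m * x ↑ n
  ↑-+ x zero n = sym (*-identityˡ _)
  ↑-+ x (suc m) n = trans (cong (x *_) (↑-+ x m n)) (sym (*-assoc _ _ _))

  ↑-* : ∀ x m n → x ↑ (m ℕ.* n) ≡ (x ↑ n) ↑ m
  ↑-* x zero n = refl
  ↑-* x (suc m) n = trans (↑-+ x n (m ℕ.* n)) (cong (x ↑ n *_) (↑-* x m n))

  1↑ : ∀ n → 1# ↑ n ≡ 1#
  1↑ zero = refl
  1↑ (suc n) = trans (*-identityˡ _) (1↑ n)

  *-↑ : ∀ x y n → (x * y) ↑ n ≡ x ↑ n * y ↑ n
  *-↑ x y zero = sym (*-identityˡ 1#)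
  *-↑ x y (suc n) = trans (cong (x * y *_) (*-↑ x y n))
    (solve 4 (λ x y a b → x :* y :* (a :* b) := x :* a :* (y :* b)) refl x y (x ↑ n) (y ↑ n))

  ↑-≢0 : ∀ {x} n → ¬ x ≡ 0# → ¬ x ↑ n ≡ 0#
  ↑-≢0 zero x≢0 = 1≢0
  ↑-≢0 (suc n) x≢0 = *-≢0 x≢0 (↑-≢0 n x≢0)

  pigeonhole : ∀ {n} → q < n → (f : Fin n → Carrier) → ∃[ i ] ∃[ j ] (i Fin.< j × f i ≡ f j)
  pigeonhole {n} q<n f with Finₚ.pigeonhole (subst (_< n) (sym size) q<n) (λ i → Any.index (complete (f i)))
  ... | i , j , i<j , e = i , j , i<j ,
    trans (Anyₚ.lookup-index (complete (f i)))
      (trans (cong (lookup elements) e) (sym (Anyₚ.lookup-index (complete (f j)))))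

-- Primitive roots, Euler's criterion and the quadratic character

ε : ℕ → Sign
ε zero = Sign.+
ε (suc n) = Sign.opposite (ε n)

opposite-* : ∀ s t → Sign.opposite s Sign.* t ≡ Sign.opposite (s Sign.* t)
opposite-* Sign.+ t = refl
opposite-* Sign.- Sign.+ = refl
opposite-* Sign.- Sign.- = refl

ε-+ : ∀ m n → ε (m ℕ.+ n) ≡ ε m Sign.* ε n
ε-+ zero n = refl
ε-+ (suc m) n = trans (cong Sign.opposite (ε-+ m n)) (sym (opposite-* (ε m) (ε n)))

ε-double : ∀ n → ε (n ℕ.+ n) ≡ Sign.+
ε-double n = trans (ε-+ n n) (Signₚ.s*s≡+ (ε n))

ε≡+⇒double : ∀ n → ε n ≡ Sign.+ → ∃[ j ] n ≡ j ℕ.+ j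
ε≡-⇒double : ∀ n → ε n ≡ Sign.- → ∃[ j ] n ≡ suc (j ℕ.+ j)
ε≡+⇒double zero _ = 0 , refl
ε≡+⇒double (suc n) e with ε n in eq
... | Sign.- = let j , p = ε≡-⇒double n eq in suc j , cong suc (trans p (sym (ℕₚ.+-suc j j)))
ε≡-⇒double (suc n) e with ε n in eq
... | Sign.+ = let j , p = ε≡+⇒double n eq in j , cong suc p

-- With q = 20m + 1, the power α ↑ (m c) has order 20 / c for each divisor c of 20; i, β and the
-- generators of both blocks have this shape.
module Root {q : ℕ} (F : FiniteField q) (m : ℕ) (q≡ : q ≡ suc (m ℕ.* 20))
            (α : FiniteField.Carrier F) (prim : IsPrimitiveRoot F α) where
  open Field F public

  α≢0 : ¬ α ≡ 0#
  α≢0 = proj₁ prim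

  log : ∀ {x} → ¬ x ≡ 0# → ∃[ k ] α ↑ k ≡ x
  log {x} = proj₂ prim x

  Σ : List Carrier → Carrier
  Σ = foldr _+_ 0#

  -- Translation by 1 permutes the field, so the sum of all elements equals itself plus q times 1.
  [q]≡0 : [ q ] ≡ 0#
  [q]≡0 = trans (solve 2 (λ a b → a := (a :+ b) :- b) refl [ q ] (Σ elements))
    (x≡y⇒x-y≡0 (trans (cong (λ t → [ t ] + Σ elements) (sym size)) (trans (sym (shifted elements))
      (foldr-commMonoid (setoid Carrier) +-isCommutativeMonoid
        (↭⇒↭ₛ (inj⇒map-↭ (1# +_) unique (λ _ _ → +1-injective) (λ _ → complete _)))))))
    where
    shifted : ∀ xs → Σ (map (1# +_) xs) ≡ [ length xs ] + Σ xs
    shifted [] = sym (+-identityˡ 0#)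
    shifted (x ∷ xs) = trans (cong (1# + x +_) (shifted xs))
      (solve 4 (λ o x a b → o :+ x :+ (a :+ b) := o :+ a :+ (x :+ b)) refl 1# x [ length xs ] (Σ xs))
    +1-injective : ∀ {x y} → 1# + x ≡ 1# + y → x ≡ y
    +1-injective {x} {y} e = trans (solve 2 (λ o x → x := (o :+ x) :- o) refl 1# x)
      (trans (cong (_+ - 1#) e) (solve 2 (λ o x → (o :+ x) :- o := x) refl 1# y))

  [20]-unit : 1# + [ m ℕ.* 20 ] ≡ 0#
  [20]-unit = trans (cong [_] (sym q≡)) [q]≡0

  private
    -- In the field 20m = -1, so each divisor of 20 is a unit.
    factor≢0 : ∀ d e → d ℕ.* e ≡ 20 → ¬ [ d ] ≡ 0#
    factor≢0 d e de≡20 d≡0 = 1≢0 (begin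
      1#                        ≡⟨ sym (+-identityʳ 1#) ⟩
      1# + 0#                   ≡⟨ cong (1# +_) (sym vanish) ⟩
      1# + [ m ℕ.* 20 ]         ≡⟨ [20]-unit ⟩
      0# ∎)
      where
      open ≡-Reasoning
      vanish : [ m ℕ.* 20 ] ≡ 0#
      vanish = begin
        [ m ℕ.* 20 ]            ≡⟨ cong (λ t → [ m ℕ.* t ]) (sym de≡20) ⟩
        [ m ℕ.* (d ℕ.* e) ]     ≡⟨ []-* m (d ℕ.* e) ⟩
        [ m ] * [ d ℕ.* e ]     ≡⟨ cong ([ m ] *_) (trans ([]-* d e) (trans (cong (_* [ e ]) d≡0) (zeroˡ _))) ⟩
        [ m ] * 0#              ≡⟨ zeroʳ _ ⟩
        0# ∎

  2≢0 : ¬ [ 2 ] ≡ 0#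
  2≢0 = factor≢0 2 10 refl

  5≢0 : ¬ [ 5 ] ≡ 0#
  5≢0 = factor≢0 5 4 refl

  1≢-1 : ¬ 1# ≡ - 1#
  1≢-1 e = 2≢0 (trans (solve 0 (κ 2 := κ 1 :- (:- κ 1)) refl) (x≡y⇒x-y≡0 e))

  m>0 : 0 < m
  m>0 = ℕₚ.≰⇒> λ m≤0 → few (ℕₚ.n≤0⇒n≡0 m≤0)
    where
    few : ¬ m ≡ 0
    few eq with unique-⊆⇒length≤ {xs = 0# ∷ 1# ∷ []} {elements} ((0≢1 ∷ []) ∷ [] ∷ []) (λ _ → complete _)
    ... | le with subst (2 ≤_) (trans size (trans q≡ (cong (λ t → suc (t ℕ.* 20)) eq))) le
    ...   | s≤s ()

  ↑-cancel : ∀ a n → α ↑ a ≡ α ↑ (a ℕ.+ n) → α ↑ n ≡ 1#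
  ↑-cancel a n e = sym (*-cancelˡ (↑-≢0 a α≢0) (trans (*-identityʳ _) (trans e (↑-+ α a n))))

  -- If α ↑ n = 1, every nonzero element is among the n powers with exponent below n, so q ≤ n + 1.
  α-order-minimal : ∀ n → 0 < n → α ↑ n ≡ 1# → m ℕ.* 20 ≤ n
  α-order-minimal n@(suc _) _ e = ℕ.s≤s⁻¹ (subst₂ _≤_ (trans size q≡)
    (cong suc (trans (length-map (α ↑_) (upTo n)) (length-upTo n)))
    (unique-⊆⇒length≤ {ys = 0# ∷ map (α ↑_) (upTo n)} unique (λ {x} _ → listed x)))
    where
    listed : ∀ x → x ∈ 0# ∷ map (α ↑_) (upTo n)
    listed x with x ≟ 0#
    ... | yes x≡0 = here x≡0
    ... | no x≢0 with log x≢0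
    ...   | k , refl = there (subst (_∈ map (α ↑_) (upTo n)) (sym reduce) (∈-map⁺ (α ↑_) (∈-upTo⁺ (m%n<n k n))))
      where
      reduce : α ↑ k ≡ α ↑ (k % n)
      reduce = begin
        α ↑ k                                ≡⟨ cong (α ↑_) (m≡m%n+[m/n]*n k n) ⟩
        α ↑ (k % n ℕ.+ k / n ℕ.* n)          ≡⟨ ↑-+ α (k % n) _ ⟩
        α ↑ (k % n) * α ↑ (k / n ℕ.* n)      ≡⟨ cong (α ↑ (k % n) *_) (trans (↑-* α (k / n) n) (trans (cong (_↑ (k / n)) e) (1↑ (k / n)))) ⟩
        α ↑ (k % n) * 1#                     ≡⟨ *-identityʳ _ ⟩
        α ↑ (k % n) ∎
        where open ≡-Reasoning

  -- The q + 1 values 0, α⁰, ..., α^(q - 1) collide. The collision is between two powers, whose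
  -- exponents differ by some n ≤ q - 1 with α ↑ n = 1, and `α-order-minimal` forces n = 20m.
  α↑20m≡1 : α ↑ (m ℕ.* 20) ≡ 1#
  α↑20m≡1 with pigeonhole ℕₚ.≤-refl f
    where
    f : Fin (suc q) → Carrier
    f Fin.zero = 0#
    f (Fin.suc i) = α ↑ toℕ i
  ... | Fin.zero , Fin.suc j , _ , e = ⊥-elim (↑-≢0 (toℕ j) α≢0 (sym e))
  ... | Fin.suc i , Fin.suc j , s≤s i<j , e = subst (λ t → α ↑ t ≡ 1#) n≡ α↑n
    where
    n = toℕ j ∸ toℕ i
    i+n : toℕ j ≡ toℕ i ℕ.+ n
    i+n = sym (ℕₚ.m+[n∸m]≡n (ℕₚ.<⇒≤ i<j))
    α↑n : α ↑ n ≡ 1#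
    α↑n = ↑-cancel (toℕ i) n (trans e (cong (α ↑_) i+n))
    n≡ : n ≡ m ℕ.* 20
    n≡ = ℕₚ.≤-antisym
      (ℕₚ.≤-trans (ℕₚ.m∸n≤m (toℕ j) (toℕ i)) (ℕ.s≤s⁻¹ (subst (toℕ j <_) q≡ (Finₚ.toℕ<n j))))
      (α-order-minimal n (ℕₚ.m<n⇒0<n∸m i<j) α↑n)

  α↑-≢1 : ∀ k .{{_ : ℕ.NonZero k}} → k < 20 → ¬ α ↑ (m ℕ.* k) ≡ 1#
  α↑-≢1 k@(suc k′) k<20 e = ℕₚ.<⇒≱ (ℕₚ.*-monoʳ-< m {{ℕ.>-nonZero m>0}} k<20) (α-order-minimal (m ℕ.* k) (ℕₚ.*-mono-≤ m>0 (s≤s (z≤n {k′}))) e)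

  α↑10m≡-1 : α ↑ (m ℕ.* 10) ≡ - 1#
  α↑10m≡-1 = [ (λ e → ⊥-elim (α↑-≢1 10 10<20 e)) , (λ e → e) ]′ (x²≡y² squares)
    where
    10<20 : 10 < 20
    10<20 = ℕₚ.m≤m+n 11 9
    squares : α ↑ (m ℕ.* 10) * α ↑ (m ℕ.* 10) ≡ 1# * 1#
    squares = begin
      α ↑ (m ℕ.* 10) * α ↑ (m ℕ.* 10)   ≡⟨ sym (↑-+ α (m ℕ.* 10) (m ℕ.* 10)) ⟩
      α ↑ (m ℕ.* 10 ℕ.+ m ℕ.* 10)       ≡⟨ cong (α ↑_) (sym (ℕₚ.*-distribˡ-+ m 10 10)) ⟩
      α ↑ (m ℕ.* 20)                    ≡⟨ α↑20m≡1 ⟩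
      1#                                ≡⟨ sym (*-identityˡ 1#) ⟩
      1# * 1# ∎
      where open ≡-Reasoning

  ι : Sign → Carrier
  ι Sign.+ = 1#
  ι Sign.- = - 1#

  ι-opposite : ∀ s → ι (Sign.opposite s) ≡ - 1# * ι s
  ι-opposite Sign.+ = sym (*-identityʳ _)
  ι-opposite Sign.- = solve 0 (κ 1 := (:- κ 1) :* (:- κ 1)) refl

  ι-injective : ∀ {s t} → ι s ≡ ι t → s ≡ t
  ι-injective {Sign.+} {Sign.+} _ = refl
  ι-injective {Sign.-} {Sign.-} _ = refl
  ι-injective {Sign.+} {Sign.-} e = ⊥-elim (1≢-1 e)
  ι-injective {Sign.-} {Sign.+} e = ⊥-elim (1≢-1 (sym e))

  -1↑ : ∀ n → (- 1#) ↑ n ≡ ι (ε n)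
  -1↑ zero = refl
  -1↑ (suc n) = trans (cong (- 1# *_) (-1↑ n)) (sym (ι-opposite (ε n)))

  euler-α : ∀ k → (α ↑ k) ↑ (m ℕ.* 10) ≡ ι (ε k)
  euler-α k = begin
    (α ↑ k) ↑ (m ℕ.* 10)   ≡⟨ sym (↑-* α (m ℕ.* 10) k) ⟩
    α ↑ (m ℕ.* 10 ℕ.* k)   ≡⟨ cong (α ↑_) (ℕₚ.*-comm (m ℕ.* 10) k) ⟩
    α ↑ (k ℕ.* (m ℕ.* 10)) ≡⟨ ↑-* α k (m ℕ.* 10) ⟩
    (α ↑ (m ℕ.* 10)) ↑ k   ≡⟨ cong (_↑ k) α↑10m≡-1 ⟩
    (- 1#) ↑ k             ≡⟨ -1↑ k ⟩
    ι (ε k) ∎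
    where open ≡-Reasoning

  Sq : Carrier → Set
  Sq x = ∃[ y ] y * y ≡ x

  Sq? : ∀ x → Dec (Sq x)
  Sq? x = map′ Any.satisfied (λ (y , e) → lose (complete y) e) (Any.any? (λ y → (y * y) ≟ x) elements)

  -- At 0 this returns + because 0 is a square, hence the nonzero hypotheses in the multiplicative
  -- laws.
  χ : Carrier → Sign
  χ x with Sq? x
  ... | yes _ = Sign.+
  ... | no _ = Sign.-

  Sq⇒χ : ∀ {x} → Sq x → χ x ≡ Sign.+
  Sq⇒χ {x} s with Sq? x
  ... | yes _ = refl
  ... | no ¬s = ⊥-elim (¬s s)

  χ⇒Sq : ∀ {x} → χ x ≡ Sign.+ → Sq x
  χ⇒Sq {x} e with Sq? x
  ... | yes s = s

  ¬Sq⇒χ : ∀ {x} → ¬ Sq x → χ x ≡ Sign.-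
  ¬Sq⇒χ {x} ¬s with Sq? x
  ... | yes s = ⊥-elim (¬s s)
  ... | no _ = refl

  χ⇒¬Sq : ∀ {x} → χ x ≡ Sign.- → ¬ Sq x
  χ⇒¬Sq {x} e with Sq? x
  ... | no ¬s = ¬s

  -- For odd k, a square root α ↑ j of α ↑ k would contradict `euler-α`: raising to the power 10m
  -- returns the parity of the exponent, which is even for 2j and odd for k.
  χ-α : ∀ k → χ (α ↑ k) ≡ ε k
  χ-α k with ε k in eq
  ... | Sign.+ = let j , e = ε≡+⇒double k eq in
    Sq⇒χ (α ↑ j , trans (sym (↑-+ α j j)) (cong (α ↑_) (sym e)))
  ... | Sign.- = ¬Sq⇒χ λ { (y , e) → nonsquare y e }
    where
    nonsquare : ∀ y → ¬ y * y ≡ α ↑ k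
    nonsquare y e with log (*≢0⇒ˡ {y} {y} (subst (λ t → ¬ t ≡ 0#) (sym e) (↑-≢0 k α≢0)))
    ... | j , refl = case-sign (trans (sym (ε-double j)) (trans (ι-injective (begin
      ι (ε (j ℕ.+ j))                ≡⟨ sym (euler-α (j ℕ.+ j)) ⟩
      (α ↑ (j ℕ.+ j)) ↑ (m ℕ.* 10)   ≡⟨ cong (_↑ (m ℕ.* 10)) (trans (↑-+ α j j) e) ⟩
      (α ↑ k) ↑ (m ℕ.* 10)           ≡⟨ euler-α k ⟩
      ι (ε k) ∎)) eq))
      where
      open ≡-Reasoning
      case-sign : ¬ Sign.+ ≡ Sign.-
      case-sign ()

  euler : ∀ {x} → ¬ x ≡ 0# → x ↑ (m ℕ.* 10) ≡ ι (χ x)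
  euler x≢0 with log x≢0
  ... | k , refl = trans (euler-α k) (cong ι (sym (χ-α k)))

  χ-* : ∀ {x y} → ¬ x ≡ 0# → ¬ y ≡ 0# → χ (x * y) ≡ χ x Sign.* χ y
  χ-* x≢0 y≢0 with log x≢0 | log y≢0
  ... | k , refl | l , refl = begin
    χ (α ↑ k * α ↑ l)        ≡⟨ cong χ (sym (↑-+ α k l)) ⟩
    χ (α ↑ (k ℕ.+ l))        ≡⟨ χ-α (k ℕ.+ l) ⟩
    ε (k ℕ.+ l)              ≡⟨ ε-+ k l ⟩
    ε k Sign.* ε l           ≡⟨ sym (cong₂ Sign._*_ (χ-α k) (χ-α l)) ⟩
    χ (α ↑ k) Sign.* χ (α ↑ l) ∎
    where open ≡-Reasoning

  χ-sq* : ∀ {x y} → ¬ x ≡ 0# → ¬ y ≡ 0# → χ (x * x * y) ≡ χ y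
  χ-sq* {x} {y} x≢0 y≢0 = trans (χ-* (*-≢0 x≢0 x≢0) y≢0) (cong (Sign._* χ y) (Sq⇒χ (x , refl)))

  𝕚 : Carrier
  𝕚 = α ↑ (m ℕ.* 5)

  𝕚² : 𝕚 * 𝕚 ≡ - 1#
  𝕚² = trans (sym (↑-+ α (m ℕ.* 5) (m ℕ.* 5))) (trans (cong (α ↑_) (sym (ℕₚ.*-distribˡ-+ m 5 5))) α↑10m≡-1)

  𝕚≢0 : ¬ 𝕚 ≡ 0#
  𝕚≢0 = ↑-≢0 (m ℕ.* 5) α≢0

  -1≢0 : ¬ - 1# ≡ 0#
  -1≢0 = neg-≢0 1≢0

  χ-neg : ∀ {x} → ¬ x ≡ 0# → χ (- x) ≡ χ x
  χ-neg {x} x≢0 = trans (cong χ (trans (solve 1 (λ x → :- x := (:- κ 1) :* x) refl x) (cong (_* x) (sym 𝕚²)))) (χ-sq* 𝕚≢0 x≢0)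

  -- (1 + i)² = 2i whenever i² = -1, so 2i is a square.
  χ[2]≡χ𝕚 : χ [ 2 ] ≡ χ 𝕚
  χ[2]≡χ𝕚 = Signₚ.*-cancelʳ-≡ (χ 𝕚) (χ [ 2 ]) (χ 𝕚) (trans (trans (sym (χ-* 2≢0 𝕚≢0)) (Sq⇒χ (1# + 𝕚 , (begin
      (1# + 𝕚) * (1# + 𝕚)          ≡⟨ solve 1 (λ i → (κ 1 :+ i) :* (κ 1 :+ i) := κ 1 :+ i :* i :+ κ 2 :* i) refl 𝕚 ⟩
      1# + 𝕚 * 𝕚 + [ 2 ] * 𝕚       ≡⟨ cong (λ t → 1# + t + [ 2 ] * 𝕚) 𝕚² ⟩
      1# + - 1# + [ 2 ] * 𝕚        ≡⟨ cong (_+ [ 2 ] * 𝕚) (-‿inverseʳ 1#) ⟩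
      0# + [ 2 ] * 𝕚               ≡⟨ +-identityˡ _ ⟩
      [ 2 ] * 𝕚 ∎)))) (sym (Signₚ.s*s≡+ (χ 𝕚))))
    where open ≡-Reasoning

-- The golden ratio and conditions (iii), (iv), (v)

module Golden {q : ℕ} (F : FiniteField q) (m : ℕ) (q≡ : q ≡ suc (m ℕ.* 20))
            (α : FiniteField.Carrier F) (prim : IsPrimitiveRoot F α) where
  open Root F m q≡ α prim public

  χ≡-1⇔ : ∀ {x} → ¬ x ≡ 0# → χ≡-1 F x ⇔ (χ x ≡ Sign.-)
  χ≡-1⇔ x≢0 = mk⇔ (λ (_ , ns) → ¬Sq⇒χ ns) (λ e → x≢0 , χ⇒¬Sq e)

  -- `β⁻¹` is spelled β⁴ so that relations stay polynomial and within reach of the ring solver. `η`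
  -- is a Gaussian period of the fifth roots of unity, and η(1 + η) = 1.
  β β⁻¹ η s : Carrier
  β = α ↑ (m ℕ.* 4)
  β⁻¹ = β * β * β * β
  η = β + β⁻¹
  s = 1# + [ 2 ] * η

  β≢0 : ¬ β ≡ 0#
  β≢0 = ↑-≢0 (m ℕ.* 4) α≢0

  ββ⁻¹ : β * β⁻¹ ≡ 1#
  ββ⁻¹ = begin
    β * (β * β * β * β)    ≡⟨ solve 1 (λ b → b :* (b :* b :* b :* b) := b :* (b :* (b :* (b :* (b :* κ 1))))) refl β ⟩
    β ↑ 5                  ≡⟨ sym (↑-* α 5 (m ℕ.* 4)) ⟩
    α ↑ (5 ℕ.* (m ℕ.* 4))  ≡⟨ cong (α ↑_) (trans (ℕₚ.*-comm 5 (m ℕ.* 4)) (ℕₚ.*-assoc m 4 5)) ⟩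
    α ↑ (m ℕ.* 20)         ≡⟨ α↑20m≡1 ⟩
    1# ∎
    where open ≡-Reasoning

  β³≡ : β * β * β ≡ β⁻¹ * β⁻¹
  β³≡ = begin
    β * β * β                 ≡⟨ sym (*-identityʳ _) ⟩
    β * β * β * 1#            ≡⟨ cong (β * β * β *_) (sym ββ⁻¹) ⟩
    β * β * β * (β * β⁻¹)     ≡⟨ sym (*-assoc (β * β * β) β β⁻¹) ⟩
    β⁻¹ * β⁻¹ ∎
    where open ≡-Reasoning

  -- The fifth cyclotomic polynomial at β, with β³ written as β⁻². Its product with β - 1 is β⁵ - 1
  -- = 0, and β ≠ 1.
  Φ₅ : β * β + β + 1# + β⁻¹ + β⁻¹ * β⁻¹ ≡ 0#
  Φ₅ = [ (λ e → ⊥-elim (α↑-≢1 4 (ℕₚ.m≤m+n 5 15) (x-y≡0⇒x≡y e))) , (λ e → e) ]′ (x*y≡0 (begin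
    (β + - 1#) * (β * β + β + 1# + β⁻¹ + β⁻¹ * β⁻¹)
      ≡⟨ cong (λ t → (β + - 1#) * (β * β + β + 1# + β⁻¹ + t)) (sym β³≡) ⟩
    (β + - 1#) * (β * β + β + 1# + β⁻¹ + β * β * β)
      ≡⟨ solve 1 (λ b → (b :- κ 1) :* (b :* b :+ b :+ κ 1 :+ b :* b :* b :* b :+ b :* b :* b) := b :* (b :* b :* b :* b) :- κ 1) refl β ⟩
    β * β⁻¹ + - 1#            ≡⟨ x≡y⇒x-y≡0 ββ⁻¹ ⟩
    0# ∎))
    where open ≡-Reasoning

  η²+η : η * η + η ≡ 1#
  η²+η = begin
    η * η + η
      ≡⟨ solve 2 (λ b c → (b :+ c) :* (b :+ c) :+ (b :+ c) := (b :* b :+ b :+ κ 1 :+ c :+ c :* c) :+ κ 2 :* (b :* c) :- κ 1) refl β β⁻¹ ⟩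
    (β * β + β + 1# + β⁻¹ + β⁻¹ * β⁻¹) + [ 2 ] * (β * β⁻¹) + - 1#
      ≡⟨ cong₂ (λ t u → t + [ 2 ] * u + - 1#) Φ₅ ββ⁻¹ ⟩
    0# + [ 2 ] * 1# + - 1#    ≡⟨ solve 0 (κ 0 :+ κ 2 :* κ 1 :- κ 1 := κ 1) refl ⟩
    1# ∎
    where open ≡-Reasoning

  s² : s * s ≡ [ 5 ]
  s² = begin
    s * s
      ≡⟨ solve 1 (λ η → (κ 1 :+ κ 2 :* η) :* (κ 1 :+ κ 2 :* η) := κ 1 :+ κ 4 :* (η :* η :+ η)) refl η ⟩
    1# + [ 4 ] * (η * η + η)  ≡⟨ cong (λ t → 1# + [ 4 ] * t) η²+η ⟩
    1# + [ 4 ] * 1#           ≡⟨ solve 0 (κ 1 :+ κ 4 :* κ 1 := κ 5) refl ⟩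
    [ 5 ] ∎
    where open ≡-Reasoning

  s≢0 : ¬ s ≡ 0#
  s≢0 e = 5≢0 (trans (sym s²) (trans (cong (_* s) e) (zeroˡ s)))

  θ θ′ : Carrier
  θ = [ 2 ] + s
  θ′ = [ 2 ] + - s

  θθ′ : θ * θ′ ≡ - 1#
  θθ′ = begin
    θ * θ′              ≡⟨ solve 1 (λ s → (κ 2 :+ s) :* (κ 2 :- s) := κ 4 :- s :* s) refl s ⟩
    [ 4 ] + - (s * s)   ≡⟨ cong (λ t → [ 4 ] + - t) s² ⟩
    [ 4 ] + - [ 5 ]     ≡⟨ solve 0 (κ 4 :- κ 5 := :- κ 1) refl ⟩
    - 1# ∎
    where open ≡-Reasoning

  θθ′≢0 : ¬ θ * θ′ ≡ 0#
  θθ′≢0 e = -1≢0 (trans (sym θθ′) e)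

  θ≢0 : ¬ θ ≡ 0#
  θ≢0 = *≢0⇒ˡ θθ′≢0

  θ′≢0 : ¬ θ′ ≡ 0#
  θ′≢0 = *≢0⇒ʳ θθ′≢0

  χ*≡+ : ∀ {x y} → ¬ x ≡ 0# → ¬ y ≡ 0# → χ (x * y) ≡ Sign.+ → χ x ≡ χ y
  χ*≡+ {x} {y} x≢0 y≢0 e = Signₚ.*-cancelʳ-≡ (χ y) (χ x) (χ y) (trans (sym (χ-* x≢0 y≢0)) (trans e (sym (Signₚ.s*s≡+ (χ y)))))

  χθ≡χθ′ : χ θ ≡ χ θ′
  χθ≡χθ′ = χ*≡+ θ≢0 θ′≢0 (Sq⇒χ (𝕚 , trans 𝕚² (sym θθ′)))

  1+η≢0 : ¬ 1# + η ≡ 0#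
  1+η≢0 = *≢0⇒ˡ {y = η} λ e → 1≢0 (trans (sym η²+η)
    (trans (solve 1 (λ η → η :* η :+ η := (κ 1 :+ η) :* η) refl η) e))

  η≢0 : ¬ η ≡ 0#
  η≢0 = *≢0⇒ʳ {1# + η} λ e → 1≢0 (trans (sym η²+η)
    (trans (solve 1 (λ η → η :* η :+ η := (κ 1 :+ η) :* η) refl η) e))

  1+η≡ : 1# + η ≡ - (β * β * (1# + β))
  1+η≡ = begin
    1# + η
      ≡⟨ solve 2 (λ b c → κ 1 :+ (b :+ c) := (b :* b :+ b :+ κ 1 :+ c :+ c :* c) :- (b :* b :+ c :* c)) refl β β⁻¹ ⟩
    (β * β + β + 1# + β⁻¹ + β⁻¹ * β⁻¹) + - (β * β + β⁻¹ * β⁻¹)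
      ≡⟨ cong₂ (λ t u → t + - (β * β + u)) Φ₅ (sym β³≡) ⟩
    0# + - (β * β + β * β * β)
      ≡⟨ solve 1 (λ b → κ 0 :- (b :* b :+ b :* b :* b) := :- (b :* b :* (κ 1 :+ b))) refl β ⟩
    - (β * β * (1# + β)) ∎
    where open ≡-Reasoning

  1+β≢0 : ¬ 1# + β ≡ 0#
  1+β≢0 e = 1+η≢0 (trans 1+η≡ (trans (cong (λ t → - (β * β * t)) e) (trans (cong -_ (zeroʳ _)) -0#≈0#)))

  θ≡cube : θ ≡ (1# + η) * (1# + η) * (1# + η)
  θ≡cube = sym (begin
    (1# + η) * (1# + η) * (1# + η)
      -- The cofactor η + 2 is the quotient of (1 + η)³ - (3 + 2η) by η² + η - 1.
      ≡⟨ solve 1 (λ η → (κ 1 :+ η) :* (κ 1 :+ η) :* (κ 1 :+ η) := κ 2 :+ (κ 1 :+ κ 2 :* η) :+ (η :* η :+ η :- κ 1) :* (η :+ κ 2)) refl η ⟩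
    θ + (η * η + η + - 1#) * (η + [ 2 ])  ≡⟨ cong (λ t → θ + t * (η + [ 2 ])) (x≡y⇒x-y≡0 η²+η) ⟩
    θ + 0# * (η + [ 2 ])                  ≡⟨ cong (θ +_) (zeroˡ _) ⟩
    θ + 0#                                ≡⟨ +-identityʳ θ ⟩
    θ ∎)
    where open ≡-Reasoning

  χθ≡χ[1+β] : χ θ ≡ χ (1# + β)
  χθ≡χ[1+β] = begin
    χ θ                              ≡⟨ cong χ θ≡cube ⟩
    χ ((1# + η) * (1# + η) * (1# + η)) ≡⟨ χ-sq* 1+η≢0 1+η≢0 ⟩
    χ (1# + η)                       ≡⟨ cong χ 1+η≡ ⟩
    χ (- (β * β * (1# + β)))         ≡⟨ χ-neg (*-≢0 (*-≢0 β≢0 β≢0) 1+β≢0) ⟩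
    χ (β * β * (1# + β))             ≡⟨ χ-sq* β≢0 1+β≢0 ⟩
    χ (1# + β) ∎
    where open ≡-Reasoning

  -- The golden-ratio form of tan²(2π/5) = 5 + 2√5.
  sθη² : η * η * (s * θ) ≡ - ((β + - β⁻¹) * (β + - β⁻¹))
  sθη² = begin
    η * η * (s * θ)
      ≡⟨ solve 1 (λ η → η :* η :* ((κ 1 :+ κ 2 :* η) :* (κ 2 :+ (κ 1 :+ κ 2 :* η))) :=
           κ 3 :+ η :+ (η :* η :+ η :- κ 1) :* (κ 4 :* η :* η :+ κ 4 :* η :+ κ 3)) refl η ⟩
    [ 3 ] + η + (η * η + η + - 1#) * ([ 4 ] * η * η + [ 4 ] * η + [ 3 ])
      ≡⟨ cong (λ t → [ 3 ] + η + t * ([ 4 ] * η * η + [ 4 ] * η + [ 3 ])) (x≡y⇒x-y≡0 η²+η) ⟩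
    [ 3 ] + η + 0# * ([ 4 ] * η * η + [ 4 ] * η + [ 3 ])
      ≡⟨ solve 3 (λ b c t → κ 3 :+ (b :+ c) :+ κ 0 :* t := κ 2 :+ (b :* b :+ b :+ κ 1 :+ c :+ c :* c) :- (b :* b :+ c :* c)) refl β β⁻¹ _ ⟩
    [ 2 ] + (β * β + β + 1# + β⁻¹ + β⁻¹ * β⁻¹) + - (β * β + β⁻¹ * β⁻¹)
      ≡⟨ cong (λ t → [ 2 ] + t + - (β * β + β⁻¹ * β⁻¹)) Φ₅ ⟩
    [ 2 ] + 0# + - (β * β + β⁻¹ * β⁻¹)
      ≡⟨ cong (λ t → t + 0# + - (β * β + β⁻¹ * β⁻¹)) (trans (solve 0 (κ 2 := κ 2 :* κ 1) refl) (cong ([ 2 ] *_) (sym ββ⁻¹))) ⟩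
    [ 2 ] * (β * β⁻¹) + 0# + - (β * β + β⁻¹ * β⁻¹)
      ≡⟨ solve 2 (λ b c → κ 2 :* (b :* c) :+ κ 0 :- (b :* b :+ c :* c) := :- ((b :- c) :* (b :- c))) refl β β⁻¹ ⟩
    - ((β + - β⁻¹) * (β + - β⁻¹)) ∎
    where open ≡-Reasoning

  χs≡χθ : χ s ≡ χ θ
  χs≡χθ = χ*≡+ s≢0 θ≢0 (begin
    χ (s * θ)                             ≡⟨ sym (χ-sq* η≢0 (*-≢0 s≢0 θ≢0)) ⟩
    χ (η * η * (s * θ))                   ≡⟨ cong χ sθη² ⟩
    χ (- ((β + - β⁻¹) * (β + - β⁻¹)))     ≡⟨ Sq⇒χ (𝕚 * (β + - β⁻¹) , square) ⟩
    Sign.+ ∎)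
    where
    open ≡-Reasoning
    square : 𝕚 * (β + - β⁻¹) * (𝕚 * (β + - β⁻¹)) ≡ - ((β + - β⁻¹) * (β + - β⁻¹))
    square = trans (solve 2 (λ i x → i :* x :* (i :* x) := i :* i :* (x :* x)) refl 𝕚 (β + - β⁻¹))
      (trans (cong (_* ((β + - β⁻¹) * (β + - β⁻¹))) 𝕚²) (solve 1 (λ x → (:- κ 1) :* x := :- x) refl _))

  IsGolden : Carrier → Set
  IsGolden t = t ↑ 2 + - ([ 4 ] * t) + - 1# ≡ 0#

  -- Completing the square turns the equation into (t - 2)² = 5 = s².
  golden-root : ∀ {t} → IsGolden t → (t ≡ θ) ⊎ (t ≡ θ′)
  golden-root {t} e = [ (λ p → inj₁ (translate p)) , (λ p → inj₂ (translate p)) ]′ (x²≡y² (begin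
    (t + - [ 2 ]) * (t + - [ 2 ])
      ≡⟨ solve 1 (λ t → (t :- κ 2) :* (t :- κ 2) := (t :* (t :* κ 1) :- κ 4 :* t :- κ 1) :+ κ 5) refl t ⟩
    (t ↑ 2 + - ([ 4 ] * t) + - 1#) + [ 5 ]   ≡⟨ cong (_+ [ 5 ]) e ⟩
    0# + [ 5 ]                               ≡⟨ +-identityˡ _ ⟩
    [ 5 ]                                    ≡⟨ sym s² ⟩
    s * s ∎))
    where
    open ≡-Reasoning
    translate : ∀ {y} → t + - [ 2 ] ≡ y → t ≡ [ 2 ] + y
    translate p = trans (solve 1 (λ t → t := κ 2 :+ (t :- κ 2)) refl t) (cong ([ 2 ] +_) p)

  θ-golden : IsGolden θ
  θ-golden = begin
    θ ↑ 2 + - ([ 4 ] * θ) + - 1#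
      ≡⟨ solve 1 (λ s → (κ 2 :+ s) :* ((κ 2 :+ s) :* κ 1) :- κ 4 :* (κ 2 :+ s) :- κ 1 := s :* s :- κ 5) refl s ⟩
    s * s + - [ 5 ]   ≡⟨ x≡y⇒x-y≡0 s² ⟩
    0# ∎
    where open ≡-Reasoning

  iii⇔ : χ≡-1 F (1# + β) ⇔ (χ s ≡ Sign.-)
  iii⇔ = mk⇔ (λ h → trans (trans χs≡χθ χθ≡χ[1+β]) (Equivalence.to (χ≡-1⇔ 1+β≢0) h))
    (λ e → Equivalence.from (χ≡-1⇔ 1+β≢0) (trans (sym (trans χs≡χθ χθ≡χ[1+β])) e))

  -- The two roots have equal character, so either one may serve as the witness.
  iv⇔ : (∃[ t ] (χ≡-1 F t × IsGolden t)) ⇔ (χ s ≡ Sign.-)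
  iv⇔ = mk⇔
    (λ (t , (t≢0 , ns) , g) → [ (λ { refl → trans χs≡χθ (¬Sq⇒χ ns) })
                              , (λ { refl → trans χs≡χθ (trans χθ≡χθ′ (¬Sq⇒χ ns)) }) ]′ (golden-root g))
    (λ e → θ , Equivalence.from (χ≡-1⇔ θ≢0) (trans (sym χs≡χθ) e) , θ-golden)

  fourth : ∀ k → (α ↑ 4) ↑ k ≡ (α ↑ k * α ↑ k) * (α ↑ k * α ↑ k)
  fourth k = begin
    (α ↑ 4) ↑ k             ≡⟨ sym (↑-* α k 4) ⟩
    α ↑ (k ℕ.* 4)           ≡⟨ cong (α ↑_) (ℕₚ.*-comm k 4) ⟩
    α ↑ (4 ℕ.* k)           ≡⟨ ↑-* α 4 k ⟩
    (α ↑ k) ↑ 4             ≡⟨ solve 1 (λ x → x :* (x :* (x :* (x :* κ 1))) := x :* x :* (x :* x)) refl (α ↑ k) ⟩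
    (α ↑ k * α ↑ k) * (α ↑ k * α ↑ k) ∎
    where open ≡-Reasoning

  -- The group generated by α⁴ consists of the nonzero fourth powers, and y⁴ = 5 = s² forces y² = s
  -- or y² = -s. As -1 is a square, s is a square for either sign.
  v⇔ : (¬ _∈⟨_⟩ F [ 5 ] (α ↑ 4)) ⇔ (χ s ≡ Sign.-)
  v⇔ = mk⇔ (λ ¬5 → ¬Sq⇒χ λ (y , e) → ¬5 (quartic y e)) (λ e (k , f) → χ⇒¬Sq e (root k f))
    where
    open ≡-Reasoning
    quartic : ∀ y → y * y ≡ s → _∈⟨_⟩ F [ 5 ] (α ↑ 4)
    quartic y e with log (*≢0⇒ˡ {y} {y} (subst (λ t → ¬ t ≡ 0#) (sym e) s≢0))
    ... | k , refl = k , trans (fourth k) (trans (cong₂ _*_ e e) s²)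
    root : ∀ k → (α ↑ 4) ↑ k ≡ [ 5 ] → Sq s
    root k f = [ (λ e → α ↑ k , e) , (λ e → 𝕚 * α ↑ k , neg-root e) ]′
      (x²≡y² (trans (sym (fourth k)) (trans f (sym s²))))
      where
      neg-root : α ↑ k * α ↑ k ≡ - s → 𝕚 * α ↑ k * (𝕚 * α ↑ k) ≡ s
      neg-root e = begin
        𝕚 * α ↑ k * (𝕚 * α ↑ k)     ≡⟨ solve 2 (λ i x → i :* x :* (i :* x) := i :* i :* (x :* x)) refl 𝕚 (α ↑ k) ⟩
        𝕚 * 𝕚 * (α ↑ k * α ↑ k)     ≡⟨ cong₂ _*_ 𝕚² e ⟩
        - 1# * - s                  ≡⟨ solve 1 (λ s → (:- κ 1) :* (:- s) := s) refl s ⟩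
        s ∎

-- Finite products

range : ℕ → List ℕ
range = applyDownFrom suc

∈-range⁺ : ∀ {k j} → 1 ≤ j → j ≤ k → j ∈ range k
∈-range⁺ {j = suc j} _ j<k = ∈-applyDownFrom⁺ suc j<k

∈-range⁻ : ∀ {k j} → j ∈ range k → 1 ≤ j × j ≤ k
∈-range⁻ j∈ with ∈-applyDownFrom⁻ suc j∈
... | i , i<k , refl = s≤s z≤n , i<k

range-unique : ∀ k → Unique (range k)
range-unique k = Uniqueₚ.applyDownFrom⁺₁ suc k λ j<i _ e → ℕₚ.<⇒≢ j<i (sym (ℕₚ.suc-injective e))

-- Taken over an arbitrary commutative monoid because Gauss's lemma compares a product of signs with
-- a product of field elements.
module Product {A : Set} {_∙_ : A → A → A} {e : A} (isCM : IsCommutativeMonoid _≡_ _∙_ e) where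
  open IsCommutativeMonoid isCM using (assoc; comm; identityˡ; identityʳ)

  Π : {B : Set} → List B → (B → A) → A
  Π [] f = e
  Π (x ∷ xs) f = f x ∙ Π xs f

  Π-cong : ∀ {B : Set} (xs : List B) {f g} → (∀ {x} → x ∈ xs → f x ≡ g x) → Π xs f ≡ Π xs g
  Π-cong [] h = refl
  Π-cong (x ∷ xs) h = cong₂ _∙_ (h (here refl)) (Π-cong xs (λ x∈ → h (there x∈)))

  interchange : ∀ a b c d → (a ∙ b) ∙ (c ∙ d) ≡ (a ∙ c) ∙ (b ∙ d)
  interchange a b c d = begin
    (a ∙ b) ∙ (c ∙ d)   ≡⟨ assoc a b _ ⟩
    a ∙ (b ∙ (c ∙ d))   ≡⟨ cong (a ∙_) (trans (sym (assoc b c d)) (cong (_∙ d) (comm b c))) ⟩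
    a ∙ ((c ∙ b) ∙ d)   ≡⟨ cong (a ∙_) (assoc c b d) ⟩
    a ∙ (c ∙ (b ∙ d))   ≡⟨ sym (assoc a c _) ⟩
    (a ∙ c) ∙ (b ∙ d) ∎
    where open ≡-Reasoning

  Π-∙ : ∀ {B : Set} (xs : List B) f g → Π xs (λ x → f x ∙ g x) ≡ Π xs f ∙ Π xs g
  Π-∙ [] f g = sym (identityˡ e)
  Π-∙ (x ∷ xs) f g = trans (cong ((f x ∙ g x) ∙_) (Π-∙ xs f g)) (interchange (f x) (g x) _ _)

  Π-e : ∀ {B : Set} (xs : List B) → Π xs (λ _ → e) ≡ e
  Π-e [] = refl
  Π-e (x ∷ xs) = trans (identityˡ _) (Π-e xs)

  Π-swap : ∀ {B C : Set} (xs : List B) (ys : List C) (f : B → C → A) → Π xs (λ x → Π ys (f x)) ≡ Π ys (λ y → Π xs (λ x → f x y))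
  Π-swap [] ys f = sym (Π-e ys)
  Π-swap (x ∷ xs) ys f = trans (cong (Π ys (f x) ∙_) (Π-swap xs ys f)) (sym (Π-∙ ys (f x) _))

  Π-foldr : ∀ {B : Set} (xs : List B) f → Π xs f ≡ foldr _∙_ e (map f xs)
  Π-foldr [] f = refl
  Π-foldr (x ∷ xs) f = cong (f x ∙_) (Π-foldr xs f)

  Π-map : ∀ {B C : Set} (g : B → C) xs f → Π (map g xs) f ≡ Π xs (λ x → f (g x))
  Π-map g [] f = refl
  Π-map g (x ∷ xs) f = cong (f (g x) ∙_) (Π-map g xs f)

  Π-permute : ∀ {B : Set} (σ : B → B) {xs} f → map σ xs ↭ xs → Π xs (λ x → f (σ x)) ≡ Π xs f
  Π-permute σ {xs} f p = begin
    Π xs (λ x → f (σ x))            ≡⟨ sym (Π-map σ xs f) ⟩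
    Π (map σ xs) f                  ≡⟨ Π-foldr (map σ xs) f ⟩
    foldr _∙_ e (map f (map σ xs))  ≡⟨ foldr-commMonoid (setoid A) isCM (↭⇒↭ₛ (map⁺ f p)) ⟩
    foldr _∙_ e (map f xs)          ≡⟨ sym (Π-foldr xs f) ⟩
    Π xs f ∎
    where open ≡-Reasoning

open Product Signₚ.*-isCommutativeMonoid

≡-from-*≡+ : ∀ {s t} → s Sign.* t ≡ Sign.+ → s ≡ t
≡-from-*≡+ {Sign.+} {Sign.+} _ = refl
≡-from-*≡+ {Sign.-} {Sign.-} _ = refl

ε-*-odd : ∀ t h → ε (t ℕ.* suc (h ℕ.+ h)) ≡ ε t
ε-*-odd t h = begin
  ε (t ℕ.* suc (h ℕ.+ h))            ≡⟨ cong ε (expand t h) ⟩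
  ε (t ℕ.+ (t ℕ.* h ℕ.+ t ℕ.* h))        ≡⟨ ε-+ t _ ⟩
  ε t Sign.* ε (t ℕ.* h ℕ.+ t ℕ.* h)   ≡⟨ cong (ε t Sign.*_) (ε-double (t ℕ.* h)) ⟩
  ε t Sign.* Sign.+              ≡⟨ Signₚ.*-identityʳ (ε t) ⟩
  ε t ∎
  where
  open ≡-Reasoning
  expand : ∀ t h → t ℕ.* suc (h ℕ.+ h) ≡ t ℕ.+ (t ℕ.* h ℕ.+ t ℕ.* h)
  expand = solve-∀

∣∣≡⇒≡± : ∀ x y → ∣ x ∣ ≡ ∣ y ∣ → x ≡ y ⊎ x ≡ ℤ.- y
∣∣≡⇒≡± (ℤ.+ m) (ℤ.+ n) refl = inj₁ refl
∣∣≡⇒≡± (ℤ.+ m) -[1+ n ] refl = inj₂ refl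
∣∣≡⇒≡± -[1+ m ] (ℤ.+ n) refl = inj₂ refl
∣∣≡⇒≡± -[1+ m ] -[1+ n ] refl = inj₁ refl

-- The Jacobi symbol and its reciprocity law

-- Gauss's lemma is taken as the definition of the Jacobi symbol, for every odd modulus n = 2h + 1.
module Residues (h : ℕ) where
  n : ℕ
  n = suc (h ℕ.+ h)

  infix 4 _≈_
  _≈_ : ℤ → ℤ → Set
  x ≈ y = ∃[ k ] x ≡ y ℤ.+ k ℤ.* ℤ.+ n

  ≈-trans : ∀ {x y z} → x ≈ y → y ≈ z → x ≈ z
  ≈-trans {z = z} (k , refl) (l , refl) = k ℤ.+ l , lem z k l (ℤ.+ n)
    where
    lem : ∀ z k l n → (z ℤ.+ l ℤ.* n) ℤ.+ k ℤ.* n ≡ z ℤ.+ (k ℤ.+ l) ℤ.* n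
    lem = ℤSolver.solve-∀

  ≈-sym : ∀ {x y} → x ≈ y → y ≈ x
  ≈-sym {y = y} (k , refl) = ℤ.- k , lem y k (ℤ.+ n)
    where
    lem : ∀ y k n → y ≡ (y ℤ.+ k ℤ.* n) ℤ.+ (ℤ.- k) ℤ.* n
    lem = ℤSolver.solve-∀

  ≈-*ˡ : ∀ c {x y} → x ≈ y → c ℤ.* x ≈ c ℤ.* y
  ≈-*ˡ c {y = y} (k , refl) = c ℤ.* k , lem c y k (ℤ.+ n)
    where
    lem : ∀ c y k n → c ℤ.* (y ℤ.+ k ℤ.* n) ≡ c ℤ.* y ℤ.+ (c ℤ.* k) ℤ.* n
    lem = ℤSolver.solve-∀

  ≈⇒∣ : ∀ {x y} → x ≈ y → n ∣ ∣ x ℤ.- y ∣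
  ≈⇒∣ {y = y} (k , refl) = divides ∣ k ∣ (trans (cong ∣_∣ (lem y k (ℤ.+ n))) (ℤₚ.∣i*j∣≡∣i∣*∣j∣ k (ℤ.+ n)))
    where
    lem : ∀ y k n → (y ℤ.+ k ℤ.* n) ℤ.- y ≡ k ℤ.* n
    lem = ℤSolver.solve-∀

  ∣∧<⇒≡0 : ∀ {x} → n ∣ x → x < n → x ≡ 0
  ∣∧<⇒≡0 {zero} _ _ = refl
  ∣∧<⇒≡0 {suc x} d l = ⊥-elim (ℕₚ.<⇒≱ l (∣⇒≤ d))

  ≈-unique : ∀ {x y} → ∣ x ∣ ≤ h → ∣ y ∣ ≤ h → n ∣ ∣ x ℤ.- y ∣ → x ≡ y
  ≈-unique {x} {y} p q d = ℤₚ.i-j≡0⇒i≡j x y (ℤₚ.∣i∣≡0⇒i≡0 (∣∧<⇒≡0 d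
    (s≤s (ℕₚ.≤-trans (ℤₚ.∣i-j∣≤∣i∣+∣j∣ x y) (ℕₚ.+-mono-≤ p q)))))

  -- For a remainder r this is the residue of least absolute value, the one whose sign enters
  -- Gauss's lemma.
  centre : ℕ → ℤ
  centre r with r ≤? h
  ... | yes _ = ℤ.+ r
  ... | no _ = ℤ.- (ℤ.+ (n ∸ r))

  ρ : ℕ → ℤ
  ρ m = centre (m % n)

  ρ-bound : ∀ m → ∣ ρ m ∣ ≤ h
  ρ-bound m with m % n ≤? h
  ... | yes p = p
  ... | no p = ℕₚ.≤-trans (ℕₚ.≤-reflexive (ℤₚ.∣-i∣≡∣i∣ (ℤ.+ (n ∸ m % n)))) (ℕₚ.m≤n+o⇒m∸n≤o n (m % n) (ℕₚ.+-monoˡ-≤ h (ℕₚ.≰⇒> p)))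

  ρ-≈ : ∀ m → ℤ.+ m ≈ ρ m
  ρ-≈ m with m % n ≤? h
  ... | yes p = ℤ.+ (m / n) , trans (cong ℤ.+_ (m≡m%n+[m/n]*n m n)) (cong (λ t → ℤ.+ (m % n) ℤ.+ t) (ℤₚ.pos-* (m / n) n))
  ... | no p = ℤ.+ (suc (m / n)) , trans (cong ℤ.+_ (m≡m%n+[m/n]*n m n)) (trans (cong (λ t → ℤ.+ (m % n) ℤ.+ t) (ℤₚ.pos-* (m / n) n))
      (lem (ℤ.+ (m % n)) (ℤ.+ (n ∸ m % n)) (ℤ.+ (m / n)) (ℤ.+ n) (cong ℤ.+_ (sym (ℕₚ.m+[n∸m]≡n (m%n≤n m n))))))
    where
    lem : ∀ r c t n → n ≡ r ℤ.+ c → r ℤ.+ t ℤ.* n ≡ (ℤ.- c) ℤ.+ (ℤ.+ 1 ℤ.+ t) ℤ.* n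
    lem r c t _ refl = lem′ r c t
      where
      lem′ : ∀ r c t → r ℤ.+ t ℤ.* (r ℤ.+ c) ≡ (ℤ.- c) ℤ.+ (ℤ.+ 1 ℤ.+ t) ℤ.* (r ℤ.+ c)
      lem′ = ℤSolver.solve-∀

  ρ-unique : ∀ m {z} → ∣ z ∣ ≤ h → ℤ.+ m ≈ z → ρ m ≡ z
  ρ-unique m {z} p c = ≈-unique (ρ-bound m) p (≈⇒∣ {ρ m} {z} (≈-trans {z = z} (≈-sym {ℤ.+ m} {ρ m} (ρ-≈ m)) c))

  ρ-cong : ∀ {a b} → a % n ≡ b % n → ρ a ≡ ρ b
  ρ-cong = cong centre

  -- A remainder above h equals n - |ρ| with n odd, so its parity differs from that of |ρ| exactly
  -- when ρ is negative.
  ε-ρ : ∀ m → ε (m % n) ≡ ε ∣ ρ m ∣ Sign.* sign (ρ m)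
  ε-ρ m with m % n ≤? h
  ... | yes p = sym (Signₚ.*-identityʳ _)
  ... | no p with n ∸ m % n in eq
  ...   | zero = ⊥-elim (ℕₚ.<⇒≱ (m%n<n m n) (ℕₚ.m∸n≡0⇒m≤n eq))
  ...   | suc c = trans (≡-from-*≡+ {ε (m % n)} {Sign.opposite (ε (suc c))} odd) (sym (Signₚ.*-comm (ε (suc c)) Sign.-))
    where
    opp : ∀ s t → s Sign.* Sign.opposite t ≡ Sign.opposite (s Sign.* t)
    opp Sign.+ t = refl
    opp Sign.- t = refl
    odd : ε (m % n) Sign.* Sign.opposite (ε (suc c)) ≡ Sign.+
    odd = trans (opp (ε (m % n)) (ε (suc c))) (cong Sign.opposite (trans (sym (ε-+ (m % n) (suc c)))
      (trans (cong ε (trans (cong (m % n ℕ.+_) (sym eq)) (ℕₚ.m+[n∸m]≡n (m%n≤n m n)))) (cong Sign.opposite (ε-double h)))))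

  -- `jacobi h a` is the symbol of a modulo 2h + 1; in particular `jacobi 2` is the symbol modulo 5.
  -- It is always a sign, never 0, so multiplicativity and reciprocity ask for coprimality.
  jacobi : ℕ → Sign
  jacobi a = Π (range h) λ j → sign (ρ (a ℕ.* j))

  jacobi-cong : ∀ {a b} → a % n ≡ b % n → jacobi a ≡ jacobi b
  jacobi-cong {a} {b} e = Π-cong (range h) λ {j} _ → cong sign (ρ-cong {a ℕ.* j} {b ℕ.* j}
    (trans (%-distribˡ-* a j n) (trans (cong (λ t → t ℕ.* (j % n) % n) e) (sym (%-distribˡ-* b j n)))))

  ≈-cancel : ∀ {b} → Coprime b n → ∀ {x y} → ∣ x ∣ ≤ h → ∣ y ∣ ≤ h → ℤ.+ b ℤ.* x ≈ ℤ.+ b ℤ.* y → x ≡ y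
  ≈-cancel {b} cop {x} {y} p q c = ≈-unique p q (coprime-divisor (Coprime.sym cop)
    (subst (n ∣_) (trans (cong ∣_∣ (lem (ℤ.+ b) x y)) (ℤₚ.∣i*j∣≡∣i∣*∣j∣ (ℤ.+ b) (x ℤ.- y))) (≈⇒∣ {ℤ.+ b ℤ.* x} {ℤ.+ b ℤ.* y} c)))
    where
    lem : ∀ b x y → b ℤ.* x ℤ.- b ℤ.* y ≡ b ℤ.* (x ℤ.- y)
    lem = ℤSolver.solve-∀

  module _ {b : ℕ} (cop : Coprime b n) where
    ρ-* : ∀ j → ℤ.+ b ℤ.* ℤ.+ j ≈ ρ (b ℕ.* j)
    ρ-* j = subst (_≈ ρ (b ℕ.* j)) (ℤₚ.pos-* b j) (ρ-≈ (b ℕ.* j))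

    ρ≢0 : ∀ {j} → j ∈ range h → 1 ≤ ∣ ρ (b ℕ.* j) ∣
    ρ≢0 {j} j∈ with ρ (b ℕ.* j) in eq | ρ-* j
    ... | ℤ.+ suc _ | _ = s≤s z≤n
    ... | -[1+ _ ] | _ = s≤s z≤n
    ... | ℤ.+ zero | c = ⊥-elim (ℕₚ.<⇒≢ (proj₁ (∈-range⁻ j∈)) (sym (ℤₚ.+-injective
          (≈-cancel cop {ℤ.+ j} {ℤ.+ 0} (proj₂ (∈-range⁻ j∈)) z≤n (subst (ℤ.+ b ℤ.* ℤ.+ j ≈_) (sym (ℤₚ.*-zeroʳ (ℤ.+ b))) c)))))

    -- Equal absolute residues give bi ≡ ±bj, and cancelling b gives i = ±j as integers since both
    -- are at most h. For natural numbers either sign means i = j.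
    ∣ρ∣-permutes : map (λ j → ∣ ρ (b ℕ.* j) ∣) (range h) ↭ range h
    ∣ρ∣-permutes = inj⇒map-↭ _ (range-unique h) inj (λ {j} j∈ → ∈-range⁺ (ρ≢0 j∈) (ρ-bound (b ℕ.* j)))
      where
      inj : ∀ {i j} → i ∈ range h → j ∈ range h → ∣ ρ (b ℕ.* i) ∣ ≡ ∣ ρ (b ℕ.* j) ∣ → i ≡ j
      inj {i} {j} i∈ j∈ e with ∣∣≡⇒≡± (ρ (b ℕ.* i)) (ρ (b ℕ.* j)) e
      ... | inj₁ p = ℤₚ.+-injective (≈-cancel cop (proj₂ (∈-range⁻ i∈)) (proj₂ (∈-range⁻ j∈))
              (≈-trans {z = ℤ.+ b ℤ.* ℤ.+ j} (ρ-* i) (subst (_≈ ℤ.+ b ℤ.* ℤ.+ j) (sym p) (≈-sym {y = ρ (b ℕ.* j)} (ρ-* j)))))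
      ... | inj₂ p = cong ∣_∣ {ℤ.+ i} {ℤ.+ j} (trans i≡-j (≡abs j i≡-j))
        where
        flip : ∀ b j → ℤ.- (ℤ.+ 1) ℤ.* (b ℤ.* j) ≡ b ℤ.* (ℤ.- j)
        flip = ℤSolver.solve-∀
        i≡-j : ℤ.+ i ≡ ℤ.- ℤ.+ j
        i≡-j = ≈-cancel cop (proj₂ (∈-range⁻ i∈)) (subst (_≤ h) (sym (ℤₚ.∣-i∣≡∣i∣ (ℤ.+ j))) (proj₂ (∈-range⁻ j∈)))
          (≈-trans {z = ℤ.+ b ℤ.* (ℤ.- ℤ.+ j)} (ρ-* i) (subst₂ _≈_ (trans (ℤₚ.-1*i≡-i (ρ (b ℕ.* j))) (sym p)) (flip (ℤ.+ b) (ℤ.+ j))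
            (≈-*ˡ (ℤ.- (ℤ.+ 1)) {ρ (b ℕ.* j)} {ℤ.+ b ℤ.* ℤ.+ j} (≈-sym {y = ρ (b ℕ.* j)} (ρ-* j)))))
        ≡abs : ∀ j {i} → ℤ.+ i ≡ ℤ.- ℤ.+ j → ℤ.- ℤ.+ j ≡ ℤ.+ j
        ≡abs zero _ = refl

  sign-*-◃1 : ∀ x t → 1 ≤ ∣ x ∣ → sign (x ℤ.* (t ◃ 1)) ≡ sign x Sign.* t
  sign-*-◃1 x@(ℤ.+ suc k) Sign.+ _ = cong sign (ℤₚ.*-identityʳ x)
  sign-*-◃1 x@(ℤ.+ suc k) Sign.- _ = cong sign (trans (ℤₚ.*-comm x (ℤ.- ℤ.+ 1)) (ℤₚ.-1*i≡-i x))
  sign-*-◃1 x@(-[1+ k ]) Sign.+ _ = cong sign (ℤₚ.*-identityʳ x)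
  sign-*-◃1 x@(-[1+ k ]) Sign.- _ = cong sign (trans (ℤₚ.*-comm x (ℤ.- ℤ.+ 1)) (ℤₚ.-1*i≡-i x))

  -- The residue of abj is that of a|ρ(bj)| times the sign of ρ(bj). As j runs from 1 to h so does
  -- |ρ(bj)|, hence the product of the first factors is again the symbol of a.
  jacobi-* : ∀ {a b} → Coprime a n → Coprime b n → jacobi (a ℕ.* b) ≡ jacobi a Sign.* jacobi b
  jacobi-* {a} {b} copa copb = begin
    Π (range h) (λ j → sign (ρ (a ℕ.* b ℕ.* j)))
      ≡⟨ Π-cong (range h) split ⟩
    Π (range h) (λ j → sign (ρ (a ℕ.* ∣ ρ (b ℕ.* j) ∣)) Sign.* sign (ρ (b ℕ.* j)))
      ≡⟨ Π-∙ (range h) _ _ ⟩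
    Π (range h) (λ j → sign (ρ (a ℕ.* ∣ ρ (b ℕ.* j) ∣))) Sign.* jacobi b
      ≡⟨ cong (Sign._* jacobi b) (Π-permute (λ j → ∣ ρ (b ℕ.* j) ∣) (λ i → sign (ρ (a ℕ.* i))) (∣ρ∣-permutes copb)) ⟩
    jacobi a Sign.* jacobi b ∎
    where
    open ≡-Reasoning
    split : ∀ {j} → j ∈ range h → sign (ρ (a ℕ.* b ℕ.* j)) ≡ sign (ρ (a ℕ.* ∣ ρ (b ℕ.* j) ∣)) Sign.* sign (ρ (b ℕ.* j))
    split {j} j∈ = trans (cong sign ρ≡) (sign-*-◃1 w (sign r) (ρ≢0 copa (∈-range⁺ (ρ≢0 copb j∈) (ρ-bound (b ℕ.* j)))))
      where
      r = ρ (b ℕ.* j)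
      w = ρ (a ℕ.* ∣ r ∣)
      t = sign r ◃ 1
      reorder : ∀ a t r → t ℤ.* (a ℤ.* r) ≡ a ℤ.* (t ℤ.* r)
      reorder = ℤSolver.solve-∀
      t*∣r∣ : t ℤ.* ℤ.+ ∣ r ∣ ≡ r
      t*∣r∣ = trans (cong (t ℤ.*_) (sym (ℤₚ.+◃n≡+n ∣ r ∣))) (trans (sym (ℤₚ.◃-distrib-* (sign r) Sign.+ 1 ∣ r ∣))
        (trans (cong₂ _◃_ (Signₚ.*-identityʳ (sign r)) (ℕₚ.*-identityˡ ∣ r ∣)) (ℤₚ.◃-inverse r)))
      t*a∣r∣ : t ℤ.* ℤ.+ (a ℕ.* ∣ r ∣) ≡ ℤ.+ a ℤ.* r
      t*a∣r∣ = trans (cong (t ℤ.*_) (ℤₚ.pos-* a ∣ r ∣)) (trans (reorder (ℤ.+ a) t (ℤ.+ ∣ r ∣)) (cong (ℤ.+ a ℤ.*_) t*∣r∣))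
      ar≈ : ℤ.+ a ℤ.* r ≈ w ℤ.* t
      ar≈ = subst₂ _≈_ t*a∣r∣ (ℤₚ.*-comm t w) (≈-*ˡ t {ℤ.+ (a ℕ.* ∣ r ∣)} {w} (ρ-≈ (a ℕ.* ∣ r ∣)))
      abj≈ : ℤ.+ (a ℕ.* b ℕ.* j) ≈ ℤ.+ a ℤ.* r
      abj≈ = subst (_≈ ℤ.+ a ℤ.* r) (trans (sym (ℤₚ.pos-* a (b ℕ.* j))) (cong ℤ.+_ (sym (ℕₚ.*-assoc a b j))))
        (≈-*ˡ (ℤ.+ a) {ℤ.+ (b ℕ.* j)} {r} (ρ-≈ (b ℕ.* j)))
      bound : ∣ w ℤ.* t ∣ ≤ h
      bound = subst (_≤ h) (sym (trans (ℤₚ.∣i*j∣≡∣i∣*∣j∣ w t) (trans (cong (∣ w ∣ ℕ.*_) (ℤₚ.abs-◃ (sign r) 1)) (ℕₚ.*-identityʳ ∣ w ∣)))) (ρ-bound (a ℕ.* ∣ r ∣))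
      ρ≡ : ρ (a ℕ.* b ℕ.* j) ≡ w ℤ.* t
      ρ≡ = ρ-unique (a ℕ.* b ℕ.* j) bound (≈-trans {z = w ℤ.* t} abj≈ ar≈)

  -- Modulo 2, with a and n odd, aj = remainder + n⌊aj/n⌋ reads j = remainder + ⌊aj/n⌋, and `ε-ρ`
  -- splits the remainder into |ρ(aj)| and a sign. In the product over j the values |ρ(aj)| permute
  -- the j, so both sides share the factor `E`, which cancels.
  jacobi-parity : ∀ k → Coprime (suc (k ℕ.+ k)) n → jacobi (suc (k ℕ.+ k)) ≡ Π (range h) (λ j → ε (suc (k ℕ.+ k) ℕ.* j / n))
  jacobi-parity k cop = ≡-from-*≡+ (trans (sym (Signₚ.*-cancelˡ-≡ E Sign.+ _ (begin
    E Sign.* Sign.+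
      ≡⟨ Signₚ.*-identityʳ E ⟩
    Π (range h) ε
      ≡⟨ Π-cong (range h) (λ {j} _ → step j) ⟩
    Π (range h) (λ j → ε ∣ ρ (a ℕ.* j) ∣ Sign.* (sign (ρ (a ℕ.* j)) Sign.* ε (a ℕ.* j / n)))
      ≡⟨ Π-∙ (range h) _ _ ⟩
    Π (range h) (λ j → ε ∣ ρ (a ℕ.* j) ∣) Sign.* Π (range h) (λ j → sign (ρ (a ℕ.* j)) Sign.* ε (a ℕ.* j / n))
      ≡⟨ cong₂ Sign._*_ (Π-permute (λ j → ∣ ρ (a ℕ.* j) ∣) ε (∣ρ∣-permutes cop)) (Π-∙ (range h) _ _) ⟩
    E Sign.* (jacobi a Sign.* Π (range h) (λ j → ε (a ℕ.* j / n))) ∎))) refl)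
    where
    open ≡-Reasoning
    a = suc (k ℕ.+ k)
    E = Π (range h) ε
    step : ∀ j → ε j ≡ ε ∣ ρ (a ℕ.* j) ∣ Sign.* (sign (ρ (a ℕ.* j)) Sign.* ε (a ℕ.* j / n))
    step j = begin
      ε j                                          ≡⟨ sym (ε-*-odd j k) ⟩
      ε (j ℕ.* a)                                    ≡⟨ cong ε (ℕₚ.*-comm j a) ⟩
      ε (a ℕ.* j)                                    ≡⟨ cong ε (m≡m%n+[m/n]*n (a ℕ.* j) n) ⟩
      ε ((a ℕ.* j) % n ℕ.+ a ℕ.* j / n ℕ.* n)              ≡⟨ ε-+ ((a ℕ.* j) % n) _ ⟩
      ε ((a ℕ.* j) % n) Sign.* ε (a ℕ.* j / n ℕ.* n)     ≡⟨ cong₂ Sign._*_ (ε-ρ (a ℕ.* j)) (ε-*-odd (a ℕ.* j / n) h) ⟩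
      ε ∣ ρ (a ℕ.* j) ∣ Sign.* sign (ρ (a ℕ.* j)) Sign.* ε (a ℕ.* j / n)  ≡⟨ Signₚ.*-assoc (ε ∣ ρ (a ℕ.* j) ∣) _ _ ⟩
      ε ∣ ρ (a ℕ.* j) ∣ Sign.* (sign (ρ (a ℕ.* j)) Sign.* ε (a ℕ.* j / n)) ∎

open Residues using (jacobi; jacobi-parity)

-- Eisenstein: ε ⌊m / n⌋ is the parity of the number of i > 0 with n i ≤ m.
below : ∀ {a b} → Dec (a ≤ b) → Sign
below (yes _) = Sign.-
below (no _) = Sign.+

below-all : ∀ n m k → n ℕ.* k ≤ m → Π (range k) (λ i → below (n ℕ.* i ≤? m)) ≡ ε k
below-all n m zero _ = refl
below-all n m (suc k) p with n ℕ.* suc k ≤? m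
... | yes _ = cong Sign.opposite (below-all n m k (ℕₚ.≤-trans (ℕₚ.*-monoʳ-≤ n (ℕₚ.n≤1+n k)) p))
... | no ¬p = ⊥-elim (¬p p)

below-count : ∀ n .{{_ : ℕ.NonZero n}} m k → m / n ≤ k → Π (range k) (λ i → below (n ℕ.* i ≤? m)) ≡ ε (m / n)
below-count n m zero p = cong ε (sym (ℕₚ.n≤0⇒n≡0 p))
below-count n m (suc k) p with n ℕ.* suc k ≤? m
... | yes q = trans (cong Sign.opposite (below-all n m k (ℕₚ.≤-trans (ℕₚ.*-monoʳ-≤ n (ℕₚ.n≤1+n k)) q)))
                    (cong ε (ℕₚ.≤-antisym (subst (_≤ m / n) (trans (cong (_/ n) (ℕₚ.*-comm n (suc k))) (m*n/n≡m (suc k) n)) (/-mono-≤ {o = n} q ℕₚ.≤-refl)) p))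
... | no ¬q = below-count n m k (ℕ.s≤s⁻¹ (ℕₚ.≤∧≢⇒< p λ e → ¬q (subst (_≤ m) (trans (cong (ℕ._* n) e) (ℕₚ.*-comm (suc k) n)) (m/n*n≤m m n))))

quotient-bound : ∀ h k {j} → j ≤ h → suc (k ℕ.+ k) ℕ.* j / suc (h ℕ.+ h) ≤ k
quotient-bound h k {j} j≤h = ℕ.s≤s⁻¹ (m<n*o⇒m/o<n {_} {suc k} {suc (h ℕ.+ h)}
  (ℕₚ.≤-<-trans (ℕₚ.*-monoʳ-≤ (suc (k ℕ.+ k)) j≤h) (subst (suc (k ℕ.+ k) ℕ.* h <_) (sym (lem h k)) (s≤s (ℕₚ.m≤m+n _ _)))))
  where
  lem : ∀ h k → suc k ℕ.* suc (h ℕ.+ h) ≡ suc (suc (k ℕ.+ k) ℕ.* h ℕ.+ (h ℕ.+ k))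
  lem = solve-∀

Π-minus : ∀ k → Π (range k) (λ _ → Sign.-) ≡ ε k
Π-minus zero = refl
Π-minus (suc k) = cong Sign.opposite (Π-minus k)

-- Lattice points (j, i) in the h by k rectangle: each lies strictly on one side of the line n i = a
-- j, because a point on it would make n divide j while j ≤ h < n. The product of the two symbols is
-- therefore (-1)^(hk), and the parity hypothesis (n ≡ 1 modulo 4) makes this +.
reciprocity : ∀ h k → Coprime (suc (k ℕ.+ k)) (suc (h ℕ.+ h)) → ε h ≡ Sign.+ → jacobi h (suc (k ℕ.+ k)) ≡ jacobi k (suc (h ℕ.+ h))
reciprocity h k cop even = ≡-from-*≡+ (begin
  jacobi h a Sign.* jacobi k n
    ≡⟨ cong₂ Sign._*_ (trans (jacobi-parity h k cop) (sym (Π-cong (range h) λ {j} j∈ → below-count n (a ℕ.* j) k (quotient-bound h k (proj₂ (∈-range⁻ j∈))))))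
                       (trans (jacobi-parity k h (Coprime.sym cop)) (trans (sym (Π-cong (range k) λ {i} i∈ → below-count a (n ℕ.* i) h (quotient-bound k h (proj₂ (∈-range⁻ i∈)))))
                         (Π-swap (range k) (range h) (λ i j → below (a ℕ.* j ≤? n ℕ.* i))))) ⟩
  Π (range h) (λ j → Π (range k) (λ i → below (n ℕ.* i ≤? a ℕ.* j))) Sign.* Π (range h) (λ j → Π (range k) (λ i → below (a ℕ.* j ≤? n ℕ.* i)))
    ≡⟨ sym (Π-∙ (range h) _ _) ⟩
  Π (range h) (λ j → Π (range k) (λ i → below (n ℕ.* i ≤? a ℕ.* j)) Sign.* Π (range k) (λ i → below (a ℕ.* j ≤? n ℕ.* i)))
    ≡⟨ Π-cong (range h) (λ {j} j∈ → trans (sym (Π-∙ (range k) _ _)) (trans (Π-cong (range k) (λ {i} _ → one-side {i} j∈)) (Π-minus k))) ⟩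
  Π (range h) (λ _ → ε k)    ≡⟨ sym (Π-cong (range h) λ _ → Π-minus k) ⟩
  Π (range h) (λ _ → Π (range k) (λ _ → Sign.-)) ≡⟨ Π-swap (range h) (range k) (λ _ _ → Sign.-) ⟩
  Π (range k) (λ _ → Π (range h) (λ _ → Sign.-)) ≡⟨ Π-cong (range k) (λ _ → trans (Π-minus h) even) ⟩
  Π (range k) (λ _ → Sign.+) ≡⟨ Π-e (range k) ⟩
  Sign.+ ∎)
  where
  open ≡-Reasoning
  a = suc (k ℕ.+ k)
  n = suc (h ℕ.+ h)
  one-side : ∀ {i j} → j ∈ range h → below (n ℕ.* i ≤? a ℕ.* j) Sign.* below (a ℕ.* j ≤? n ℕ.* i) ≡ Sign.-
  one-side {i} {j} j∈ with n ℕ.* i ≤? a ℕ.* j | a ℕ.* j ≤? n ℕ.* i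
  ... | yes _ | no _ = refl
  ... | no _ | yes _ = refl
  ... | no p | no q = ⊥-elim (p (ℕₚ.<⇒≤ (ℕₚ.≰⇒> q)))
  ... | yes p | yes q = ⊥-elim (ℕₚ.<⇒≱ (s≤s (ℕₚ.≤-trans (proj₂ (∈-range⁻ j∈)) (ℕₚ.m≤m+n h h)))
        (∣⇒≤ {{ℕ.>-nonZero (proj₁ (∈-range⁻ j∈))}} (coprime-divisor (Coprime.sym cop)
          (divides i (trans (ℕₚ.≤-antisym q p) (ℕₚ.*-comm n i))))))

-- Symbols and residues along quadratic forms

coprime-*ˡ : ∀ {a b c} → Coprime a c → Coprime b c → Coprime (a ℕ.* b) c
coprime-*ˡ ca cb {e} (e∣ab , e∣c) = cb (coprime-divisor (λ (f∣e , f∣a) → ca (f∣a , ∣-trans f∣e e∣c)) e∣ab , e∣c)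

coprime-root : ∀ {x w c a} → x ≡ w ℕ.* w ℕ.+ c ℕ.* a → Coprime x a → Coprime w a
coprime-root {w = w} {c} refl cop (e∣w , e∣a) = cop (∣m∣n⇒∣m+n (∣m⇒∣m*n w e∣w) (∣n⇒∣m*n c e∣a) , e∣a)

coprime-5 : ∀ {a} → ¬ 5 ∣ a → Coprime 5 a
coprime-5 5∤a (e∣5 , e∣a) with prime⇒irreducible (from-yes (prime? 5)) e∣5
... | inj₁ e≡1 = e≡1
... | inj₂ refl = ⊥-elim (5∤a e∣a)

coprime-1 : ∀ {a} → Coprime 1 a
coprime-1 (e∣1 , _) = ∣1⇒≡1 e∣1

jacobi-1 : ∀ k → jacobi k 1 ≡ Sign.+
jacobi-1 k = sym (Signₚ.*-cancelˡ-≡ (jacobi k 1) Sign.+ (jacobi k 1) (trans (Signₚ.*-identityʳ (jacobi k 1)) (Residues.jacobi-* k {1} {1} coprime-1 coprime-1)))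

-- Modulo 2k + 1 the product d q is the square of w, and w inherits coprimality, so the symbols of d
-- and q agree.
jacobi-residue : ∀ k d q {w c} → Coprime d (suc (k ℕ.+ k)) → Coprime q (suc (k ℕ.+ k)) →
  d ℕ.* q ≡ w ℕ.* w ℕ.+ c ℕ.* suc (k ℕ.+ k) → jacobi k q ≡ jacobi k d
jacobi-residue k d q {w} {c} cd cq e = sym (≡-from-*≡+ (begin
  jacobi k d Sign.* jacobi k q   ≡⟨ sym (Residues.jacobi-* k cd cq) ⟩
  jacobi k (d ℕ.* q)        ≡⟨ Residues.jacobi-cong k {d ℕ.* q} {w ℕ.* w} (trans (cong (_% suc (k ℕ.+ k)) e) ([m+kn]%n≡m%n (w ℕ.* w) c (suc (k ℕ.+ k)))) ⟩
  jacobi k (w ℕ.* w)        ≡⟨ Residues.jacobi-* k cw cw ⟩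
  jacobi k w Sign.* jacobi k w   ≡⟨ Signₚ.s*s≡+ (jacobi k w) ⟩
  Sign.+ ∎))
  where
  open ≡-Reasoning
  cw : Coprime w (suc (k ℕ.+ k))
  cw = coprime-root {w = w} {c} e (coprime-*ˡ {d} {q} cd cq)

parity : ∀ a → (∃[ k ] a ≡ k ℕ.+ k) ⊎ (∃[ k ] a ≡ suc (k ℕ.+ k))
parity a with ε a in eq
... | Sign.+ = inj₁ (ε≡+⇒double a eq)
... | Sign.- = inj₂ (ε≡-⇒double a eq)

%2≡1⇒odd : ∀ a → a % 2 ≡ 1 → ∃[ k ] a ≡ suc (k ℕ.+ k)
%2≡1⇒odd a e = a / 2 , trans (m≡m%n+[m/n]*n a 2) (trans (cong (ℕ._+ a / 2 ℕ.* 2) e) (cong suc (lem (a / 2))))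
  where
  lem : ∀ t → t ℕ.* 2 ≡ t ℕ.+ t
  lem = solve-∀

quadratic-% : ∀ N .{{_ : ℕ.NonZero N}} c d x y →
  (c ℕ.* (x ℕ.* x) ℕ.+ d ℕ.* (y ℕ.* y)) % N ≡ (c ℕ.* (x % N ℕ.* (x % N)) ℕ.+ d ℕ.* (y % N ℕ.* (y % N))) % N
quadratic-% N c d x y = trans (cong (_% N) (trans (cong₂ (λ x y → c ℕ.* (x ℕ.* x) ℕ.+ d ℕ.* (y ℕ.* y)) (m≡m%n+[m/n]*n x N) (m≡m%n+[m/n]*n y N))
    (lem c d (x % N) (y % N) (x / N) (y / N) N)))
  ([m+kn]%n≡m%n _ (c ℕ.* (2 ℕ.* (x % N) ℕ.* (x / N) ℕ.+ x / N ℕ.* (x / N) ℕ.* N) ℕ.+ d ℕ.* (2 ℕ.* (y % N) ℕ.* (y / N) ℕ.+ y / N ℕ.* (y / N) ℕ.* N)) N)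
  where
  lem : ∀ c d r s t u N → c ℕ.* ((r ℕ.+ t ℕ.* N) ℕ.* (r ℕ.+ t ℕ.* N)) ℕ.+ d ℕ.* ((s ℕ.+ u ℕ.* N) ℕ.* (s ℕ.+ u ℕ.* N))
    ≡ c ℕ.* (r ℕ.* r) ℕ.+ d ℕ.* (s ℕ.* s) ℕ.+ (c ℕ.* (2 ℕ.* r ℕ.* t ℕ.+ t ℕ.* t ℕ.* N) ℕ.+ d ℕ.* (2 ℕ.* s ℕ.* u ℕ.+ u ℕ.* u ℕ.* N)) ℕ.* N
  lem = solve-∀

-- Statements about the residues of x and y forced by that of c x² + d y² are checked by enumeration.
residues : ∀ N .{{_ : ℕ.NonZero N}} c d {P : ℕ → ℕ → ℕ → Set} (P? : ∀ r s v → Dec (P r s v))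
  {_ : True (ℕₚ.allUpTo? (λ r → ℕₚ.allUpTo? (λ s → P? r s ((c ℕ.* (r ℕ.* r) ℕ.+ d ℕ.* (s ℕ.* s)) % N)) N) N)} →
  ∀ {v} x y → v ≡ c ℕ.* (x ℕ.* x) ℕ.+ d ℕ.* (y ℕ.* y) → P (x % N) (y % N) (v % N)
residues N c d {P} P? {checked} x y refl =
  subst (P (x % N) (y % N)) (sym (quadratic-% N c d x y)) (toWitness checked (m%n<n x N) (m%n<n y N))

+∣z∣² : ∀ z → ℤ.+ (∣ z ∣ ℕ.* ∣ z ∣) ≡ z ℤ.* z
+∣z∣² (ℤ.+ n) = ℤₚ.pos-* n n
+∣z∣² -[1+ n ] = refl

RepBy⇒ℕ : ∀ {n p} → RepBy n p → ∃[ x ] ∃[ y ] p ≡ x ℕ.* x ℕ.+ n ℕ.* (y ℕ.* y)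
RepBy⇒ℕ {n} (x , y , e) = ∣ x ∣ , ∣ y ∣ , ℤₚ.+-injective (trans e (sym (cong₂ ℤ._+_ (+∣z∣² x)
  (trans (ℤₚ.pos-* n (∣ y ∣ ℕ.* ∣ y ∣)) (cong (ℤ.+ n ℤ.*_) (+∣z∣² y))))))

ℕ⇒RepBy : ∀ {n p} x y → p ≡ x ℕ.* x ℕ.+ n ℕ.* (y ℕ.* y) → RepBy n p
ℕ⇒RepBy {n} x y e = ℤ.+ x , ℤ.+ y , trans (cong ℤ.+_ e) (cong₂ ℤ._+_ (ℤₚ.pos-* x x)
  (trans (ℤₚ.pos-* n (y ℕ.* y)) (cong (ℤ.+ n ℤ.*_) (ℤₚ.pos-* y y))))

floor-sqrt : ∀ n → ∃[ r ] (r ℕ.* r ≤ n × n < suc r ℕ.* suc r)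
floor-sqrt zero = 0 , z≤n , s≤s z≤n
floor-sqrt (suc n) with floor-sqrt n
... | r , lo , hi with suc n ℕ.<? suc r ℕ.* suc r
...   | yes p = r , ℕₚ.m≤n⇒m≤1+n lo , p
...   | no p = suc r , ℕₚ.≮⇒≥ p , ℕₚ.≤-<-trans hi (ℕₚ.*-mono-< (ℕₚ.n<1+n (suc r)) (ℕₚ.n<1+n (suc r)))

-- Characters of integers in a prime field

module PrimeField {q : ℕ} (F : FiniteField q) (m : ℕ) (q≡ : q ≡ suc (m ℕ.* 20))
            (α : FiniteField.Carrier F) (prim : IsPrimitiveRoot F α) (q-prime : Prime q) where
  open Golden F m q≡ α prim

  module ΠF = Product *-isCommutativeMonoid
  module ΠS = Product Signₚ.*-isCommutativeMonoid

  h : ℕ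
  h = m ℕ.* 10

  q≡2h+1 : q ≡ suc (h ℕ.+ h)
  q≡2h+1 = trans q≡ (cong suc (ℕₚ.*-distribˡ-+ m 10 10))

  []≢0 : ∀ {j} → 0 < j → j < q → ¬ [ j ] ≡ 0#
  []≢0 {j} 0<j j<q j≡0 with coprime-Bézout (prime⇒coprime q-prime {{ℕ.>-nonZero 0<j}} j<q)
  ... | Bézout.+- x y e = 1≢0 (begin
    1#                      ≡⟨ sym (+-identityʳ 1#) ⟩
    1# + 0#                 ≡⟨ cong (1# +_) (sym (trans ([]-* y j) (trans (cong ([ y ] *_) j≡0) (zeroʳ _)))) ⟩
    [ suc (y ℕ.* j) ]       ≡⟨ cong [_] e ⟩
    [ x ℕ.* q ]             ≡⟨ trans ([]-* x q) (trans (cong ([ x ] *_) [q]≡0) (zeroʳ _)) ⟩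
    0# ∎)
    where open ≡-Reasoning
  ... | Bézout.-+ x y e = 1≢0 (begin
    1#                      ≡⟨ sym (+-identityʳ 1#) ⟩
    1# + 0#                 ≡⟨ cong (1# +_) (sym (trans ([]-* x q) (trans (cong ([ x ] *_) [q]≡0) (zeroʳ _)))) ⟩
    [ suc (x ℕ.* q) ]       ≡⟨ cong [_] e ⟩
    [ y ℕ.* j ]             ≡⟨ trans ([]-* y j) (trans (cong ([ y ] *_) j≡0) (zeroʳ _)) ⟩
    0# ∎)
    where open ≡-Reasoning

  ⟦⟧≡ι : ∀ z → ⟦ z ⟧ ≡ ι (sign z) * [ ∣ z ∣ ]
  ⟦⟧≡ι (ℤ.+ n) = sym (*-identityˡ _)
  ⟦⟧≡ι -[1+ n ] = solve 1 (λ x → :- x := (:- κ 1) :* x) refl [ suc n ]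

  ι-* : ∀ s t → ι (s Sign.* t) ≡ ι s * ι t
  ι-* Sign.+ t = sym (*-identityˡ _)
  ι-* Sign.- t = ι-opposite t

  module _ where
    open Residues h hiding (jacobi)

    ⟦n⟧≡0 : [ n ] ≡ 0#
    ⟦n⟧≡0 = trans (cong [_] (sym q≡2h+1)) [q]≡0

    ⟦⟧-≈ : ∀ {x y} → x ≈ y → ⟦ x ⟧ ≡ ⟦ y ⟧
    ⟦⟧-≈ {y = y} (k , refl) = begin
      ⟦ y ℤ.+ k ℤ.* ℤ.+ n ⟧     ≡⟨ ⟦⟧-+ y (k ℤ.* ℤ.+ n) ⟩
      ⟦ y ⟧ + ⟦ k ℤ.* ℤ.+ n ⟧   ≡⟨ cong (⟦ y ⟧ +_) (trans (⟦⟧-* k (ℤ.+ n)) (trans (cong (⟦ k ⟧ *_) ⟦n⟧≡0) (zeroʳ _))) ⟩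
      ⟦ y ⟧ + 0#                ≡⟨ +-identityʳ _ ⟩
      ⟦ y ⟧ ∎
      where open ≡-Reasoning

    -- The product of a, 2a, ..., ha is evaluated twice: directly as a ↑ h times the product of the
    -- j, and through least residues as the Jacobi sign times that same product. Euler's criterion
    -- identifies a ↑ h with χ, as h = (q - 1) / 2.
    gauss-lemma : ∀ {a} → 0 < a → a < q → χ [ a ] ≡ jacobi h a
    gauss-lemma {a} 0<a a<q = ι-injective (trans (sym (euler ([]≢0 0<a a<q))) (*-cancelˡ (Πj≢0 h ℕₚ.≤-refl) (begin
      Πj * [ a ] ↑ h                            ≡⟨ *-comm _ _ ⟩
      [ a ] ↑ h * Πj                            ≡⟨ sym (scale h) ⟩
      ΠF.Π (range h) (λ j → [ a ] * [ j ])      ≡⟨ ΠF.Π-cong (range h) (λ {j} _ → residue j) ⟩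
      ΠF.Π (range h) (λ j → ι (sign (ρ (a ℕ.* j))) * [ ∣ ρ (a ℕ.* j) ∣ ])  ≡⟨ ΠF.Π-∙ (range h) _ _ ⟩
      ΠF.Π (range h) (λ j → ι (sign (ρ (a ℕ.* j)))) * ΠF.Π (range h) (λ j → [ ∣ ρ (a ℕ.* j) ∣ ])
        ≡⟨ cong₂ _*_ (ι-Π (range h) _) (ΠF.Π-permute (λ j → ∣ ρ (a ℕ.* j) ∣) [_] (∣ρ∣-permutes cop)) ⟩
      ι (jacobi h a) * Πj                            ≡⟨ *-comm _ _ ⟩
      Πj * ι (jacobi h a) ∎)))
      where
      open ≡-Reasoning
      cop : Coprime a n
      cop = subst (Coprime a) q≡2h+1 (Coprime.sym (prime⇒coprime q-prime {{ℕ.>-nonZero 0<a}} a<q))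
      Πj : Carrier
      Πj = ΠF.Π (range h) [_]
      Πj≢0 : ∀ k → k ≤ h → ¬ ΠF.Π (range k) [_] ≡ 0#
      Πj≢0 zero _ = 1≢0
      Πj≢0 (suc k) k<h = *-≢0 ([]≢0 z<s (subst (suc k <_) (sym q≡2h+1) (s≤s (ℕₚ.≤-trans k<h (ℕₚ.m≤m+n h h))))) (Πj≢0 k (ℕₚ.<⇒≤ k<h))
      scale : ∀ k → ΠF.Π (range k) (λ j → [ a ] * [ j ]) ≡ [ a ] ↑ k * ΠF.Π (range k) [_]
      scale zero = sym (*-identityˡ _)
      scale (suc k) = trans (cong ([ a ] * [ suc k ] *_) (scale k))
        (solve 4 (λ a j x y → a :* j :* (x :* y) := a :* x :* (j :* y)) refl [ a ] [ suc k ] ([ a ] ↑ k) _)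
      residue : ∀ j → [ a ] * [ j ] ≡ ι (sign (ρ (a ℕ.* j))) * [ ∣ ρ (a ℕ.* j) ∣ ]
      residue j = trans (sym ([]-* a j)) (trans (⟦⟧-≈ {ℤ.+ (a ℕ.* j)} {ρ (a ℕ.* j)} (ρ-≈ (a ℕ.* j))) (⟦⟧≡ι (ρ (a ℕ.* j))))
      ι-Π : ∀ xs (f : ℕ → Sign) → ΠF.Π xs (λ j → ι (f j)) ≡ ι (ΠS.Π xs f)
      ι-Π [] f = refl
      ι-Π (x ∷ xs) f = trans (cong (ι (f x) *_) (ι-Π xs f)) (sym (ι-* (f x) (ΠS.Π xs f)))

  εh : ε h ≡ Sign.+
  εh = trans (cong ε (ℕₚ.*-distribˡ-+ m 5 5)) (ε-double (m ℕ.* 5))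

  coprime-q : ∀ {a} → 0 < a → a < q → Coprime q a
  coprime-q 0<a a<q = prime⇒coprime q-prime {{ℕ.>-nonZero 0<a}} a<q

  -- Reciprocity turns (a / q) into (q / a) without a sign, as q ≡ 1 (mod 4), and d q ≡ w² (mod a)
  -- replaces q by d. Thus a divisor of d q - w² has a character that depends on d alone.
  χ-odd : ∀ d k {w c} → suc (k ℕ.+ k) < q → Coprime d (suc (k ℕ.+ k)) →
    d ℕ.* q ≡ w ℕ.* w ℕ.+ c ℕ.* suc (k ℕ.+ k) → χ [ suc (k ℕ.+ k) ] ≡ jacobi k d
  χ-odd d k {w} {c} a<q cd e = begin
    χ [ suc (k ℕ.+ k) ]     ≡⟨ gauss-lemma z<s a<q ⟩
    jacobi h (suc (k ℕ.+ k))     ≡⟨ reciprocity h k (subst (Coprime (suc (k ℕ.+ k))) q≡2h+1 (Coprime.sym cq)) εh ⟩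
    jacobi k (suc (h ℕ.+ h))     ≡⟨ cong (jacobi k) (sym q≡2h+1) ⟩
    jacobi k q                   ≡⟨ jacobi-residue k d q {w} {c} cd cq e ⟩
    jacobi k d ∎
    where
    open ≡-Reasoning
    cq : Coprime q (suc (k ℕ.+ k))
    cq = coprime-q z<s a<q

  χ-double : ∀ {b} → 0 < b → b < q → χ [ b ℕ.+ b ] ≡ χ [ 2 ] Sign.* χ [ b ]
  χ-double {b} 0<b b<q = trans (cong χ (trans ([]-+ b b) (solve 1 (λ x → x :+ x := κ 2 :* x) refl [ b ]))) (χ-* 2≢0 ([]≢0 0<b b<q))

  halve-< : ∀ {b} → 0 < b → b < b ℕ.+ b
  halve-< {b} 0<b = ℕₚ.m<m+n b 0<b

  half-positive : ∀ b → 0 < b ℕ.+ b → 0 < b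
  half-positive (suc b) _ = z<s

  halving : ∀ d w c b → d ℕ.* q ≡ w ℕ.* w ℕ.+ c ℕ.* (b ℕ.+ b) → d ℕ.* q ≡ w ℕ.* w ℕ.+ (c ℕ.+ c) ℕ.* b
  halving d w c b e = trans e (cong (w ℕ.* w ℕ.+_) (lem c b))
    where
    lem : ∀ c b → c ℕ.* (b ℕ.+ b) ≡ (c ℕ.+ c) ℕ.* b
    lem = solve-∀

  Odd : ℕ → Set
  Odd a = ∃[ k ] a ≡ suc (k ℕ.+ k)

  even≢odd : ∀ {b k} → ¬ b ℕ.+ b ≡ suc (k ℕ.+ k)
  even≢odd {b} {k} o with trans (sym (ε-double b)) (trans (cong ε o) (cong Sign.opposite (ε-double k)))
  ... | ()

  -- Factors of two are split off a until χ-odd applies.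
  χ-divisor : ∀ d w (Admissible : ℕ → Set) (ψ : ℕ → Sign) → (∀ {b} → Admissible (b ℕ.+ b) → Admissible b) →
    (∀ k → Admissible (suc (k ℕ.+ k)) → Coprime d (suc (k ℕ.+ k)) × jacobi k d ≡ ψ (suc (k ℕ.+ k))) →
    ∀ {a c} → Admissible a → 0 < a → a < q → d ℕ.* q ≡ w ℕ.* w ℕ.+ c ℕ.* a →
    Odd a ⊎ (∀ {b} → Admissible b → χ [ 2 ] Sign.* ψ b ≡ ψ (b ℕ.+ b)) → χ [ a ] ≡ ψ a
  χ-divisor d w Admissible ψ half odd-value {a} {c} = go a ℕₚ.≤-refl {c}
    where
    go : ∀ {a} N → a ≤ N → ∀ {c} → Admissible a → 0 < a → a < q → d ℕ.* q ≡ w ℕ.* w ℕ.+ c ℕ.* a →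
      Odd a ⊎ (∀ {b} → Admissible b → χ [ 2 ] Sign.* ψ b ≡ ψ (b ℕ.+ b)) → χ [ a ] ≡ ψ a
    go {a} N a≤N {c} adm 0<a a<q e o with parity a
    ... | inj₂ (k , refl) = let cop , value = odd-value k adm in trans (χ-odd d k {w} {c} a<q cop e) value
    go zero a≤N adm 0<a _ _ _ | inj₁ _ = ⊥-elim (ℕₚ.<⇒≱ 0<a a≤N)
    go (suc N) a≤N adm 0<a a<q e (inj₁ (k , o)) | inj₁ (b , refl) = ⊥-elim (even≢odd {b} {k} o)
    go (suc N) a≤N {c} adm 0<a a<q e (inj₂ double) | inj₁ (b , refl) = trans (χ-double 0<b (ℕₚ.<-trans b< a<q))
      (trans (cong (χ [ 2 ] Sign.*_) (go N (ℕ.s≤s⁻¹ (ℕₚ.≤-trans b< a≤N)) {c ℕ.+ c} (half adm) 0<b (ℕₚ.<-trans b< a<q) (halving d w c b e) (inj₂ double)))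
        (double (half adm)))
      where
      0<b = half-positive b 0<a
      b< = halve-< 0<b

  -- The case d = 1: q is a square modulo a. Each halving of an even a costs a factor χ(2), which
  -- then has to be +.
  χ≡+ : ∀ {a w c} → 0 < a → a < q → q ≡ w ℕ.* w ℕ.+ c ℕ.* a → Odd a ⊎ χ [ 2 ] ≡ Sign.+ → χ [ a ] ≡ Sign.+
  χ≡+ {a} {w} {c} 0<a a<q e o = χ-divisor 1 w (λ _ → ⊤) (λ _ → Sign.+) (λ _ → tt) (λ k _ → coprime-1 , jacobi-1 k)
    {a} {c} tt 0<a a<q (trans (ℕₚ.*-identityˡ q) e) (map₂ (λ χ2 _ → trans (Signₚ.*-identityʳ (χ [ 2 ])) χ2) o)

  -- The case d = 5, where a second use of reciprocity turns (5 / a) into (a / 5). Each halving of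
  -- an even a multiplies the left side by χ(2) and the right side by (2 / 5) = -1, hence the demand
  -- on χ(2).
  χ≡jacobi : ∀ {a w c} → ¬ 5 ∣ a → 0 < a → a < q → 5 ℕ.* q ≡ w ℕ.* w ℕ.+ c ℕ.* a → Odd a ⊎ χ [ 2 ] ≡ Sign.- → χ [ a ] ≡ jacobi 2 a
  χ≡jacobi {a} {w} {c} 5∤a 0<a a<q e o = χ-divisor 5 w (λ a → ¬ 5 ∣ a) (jacobi 2) (λ 5∤ d → 5∤ (∣m∣n⇒∣m+n d d))
    (λ k 5∤ → coprime-5 5∤ , sym (reciprocity 2 k (Coprime.sym (coprime-5 5∤)) refl))
    {a} {c} 5∤a 0<a a<q e (map₂ double o)
    where
    double : χ [ 2 ] ≡ Sign.- → ∀ {b} → ¬ 5 ∣ b → χ [ 2 ] Sign.* jacobi 2 b ≡ jacobi 2 (b ℕ.+ b)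
    double χ2 {b} 5∤b = begin
      χ [ 2 ] Sign.* jacobi 2 b        ≡⟨ cong (Sign._* jacobi 2 b) χ2 ⟩
      jacobi 2 2 Sign.* jacobi 2 b          ≡⟨ sym (Residues.jacobi-* 2 {2} {b} (Coprime.sym (coprime-5 λ d → ℕₚ.<⇒≱ (s≤s (s≤s (s≤s z≤n))) (∣⇒≤ d))) (Coprime.sym (coprime-5 5∤b))) ⟩
      jacobi 2 (2 ℕ.* b)               ≡⟨ cong (λ t → jacobi 2 (b ℕ.+ t)) (ℕₚ.+-identityʳ b) ⟩
      jacobi 2 (b ℕ.+ b) ∎
      where open ≡-Reasoning

-- What a representation of q says about χ(√5)

%8%2 : ∀ x → x % 8 % 2 ≡ x % 2
%8%2 x = m∣n⇒o%n%m≡o%m 2 8 x (divides 4 refl)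

%4%2 : ∀ x → x % 4 % 2 ≡ x % 2
%4%2 x = m∣n⇒o%n%m≡o%m 2 4 x (divides 2 refl)

[2x]² : ∀ x → (x ℕ.+ x) ℕ.* (x ℕ.+ x) ≡ 4 ℕ.* (x ℕ.* x)
[2x]² = solve-∀

%2≡0⇒double : ∀ a → a % 2 ≡ 0 → ∃[ k ] a ≡ k ℕ.+ k
%2≡0⇒double a e = a / 2 , trans (m≡m%n+[m/n]*n a 2) (trans (cong (ℕ._+ a / 2 ℕ.* 2) e) (lem (a / 2)))
  where
  lem : ∀ t → t ℕ.* 2 ≡ t ℕ.+ t
  lem = solve-∀

%2≡1⇒0< : ∀ a → a % 2 ≡ 1 → 0 < a
%2≡1⇒0< (suc a) _ = z<s

jacobi₅≡+ : ∀ x → x % 5 ≡ 1 ⊎ x % 5 ≡ 4 → jacobi 2 x ≡ Sign.+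
jacobi₅≡+ x (inj₁ e) = Residues.jacobi-cong 2 {x} {1} e
jacobi₅≡+ x (inj₂ e) = Residues.jacobi-cong 2 {x} {4} e

jacobi₅≡- : ∀ x → x % 5 ≡ 2 ⊎ x % 5 ≡ 3 → jacobi 2 x ≡ Sign.-
jacobi₅≡- x (inj₁ e) = Residues.jacobi-cong 2 {x} {2} e
jacobi₅≡- x (inj₂ e) = Residues.jacobi-cong 2 {x} {3} e

5∤⁺ : ∀ x → x % 5 ≡ 1 ⊎ x % 5 ≡ 4 → ¬ 5 ∣ x
5∤⁺ x o d with x % 5 | n∣m⇒m%n≡0 x 5 d
5∤⁺ x (inj₁ ()) d | _ | refl
5∤⁺ x (inj₂ ()) d | _ | refl

5∤⁻ : ∀ x → x % 5 ≡ 2 ⊎ x % 5 ≡ 3 → ¬ 5 ∣ x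
5∤⁻ x o d with x % 5 | n∣m⇒m%n≡0 x 5 d
5∤⁻ x (inj₁ ()) d | _ | refl
5∤⁻ x (inj₂ ()) d | _ | refl

5∤⇒0< : ∀ {x} → ¬ 5 ∣ x → 0 < x
5∤⇒0< {zero} h = ⊥-elim (h (divides 0 refl))
5∤⇒0< {suc x} h = z<s

+%-cong : ∀ N .{{_ : ℕ.NonZero N}} c x y → (x % N ℕ.+ c ℕ.* (y % N)) % N ≡ (x ℕ.+ c ℕ.* y) % N
+%-cong N c x y = sym (trans (cong (_% N) (trans (cong₂ (λ x y → x ℕ.+ c ℕ.* y) (m≡m%n+[m/n]*n x N) (m≡m%n+[m/n]*n y N))
    (lem c (x % N) (y % N) (x / N) (y / N) N))) ([m+kn]%n≡m%n _ (x / N ℕ.+ c ℕ.* (y / N)) N))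
  where
  lem : ∀ c r s t u N → (r ℕ.+ t ℕ.* N) ℕ.+ c ℕ.* (s ℕ.+ u ℕ.* N) ≡ r ℕ.+ c ℕ.* s ℕ.+ (t ℕ.+ c ℕ.* u) ℕ.* N
  lem = solve-∀

module Representations {q : ℕ} (F : FiniteField q) (m : ℕ) (q≡ : q ≡ suc (m ℕ.* 20))
            (α : FiniteField.Carrier F) (prim : IsPrimitiveRoot F α) (q-prime : Prime q) where
  open Golden F m q≡ α prim
  open PrimeField F m q≡ α prim q-prime

  -- χ(2) = χ(i) with i = α^(5m), so χ(2) and the residue of 20m + 1 modulo 8 are both read off from
  -- the parity of m.
  q%8 : (q % 8 ≡ 1 × χ [ 2 ] ≡ Sign.+) ⊎ (q % 8 ≡ 5 × χ [ 2 ] ≡ Sign.-)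
  q%8 with parity m
  ... | inj₁ (j , e) = inj₁ (trans (cong (_% 8) (trans q≡ (trans (cong (λ t → suc (t ℕ.* 20)) e) (lem j)))) ([m+kn]%n≡m%n 1 (5 ℕ.* j) 8)
      , trans χ[2]≡χ𝕚 (trans (χ-α (m ℕ.* 5)) (trans (ε-*-odd m 2) (trans (cong ε e) (ε-double j)))))
    where
    lem : ∀ j → suc ((j ℕ.+ j) ℕ.* 20) ≡ 1 ℕ.+ (5 ℕ.* j) ℕ.* 8
    lem = solve-∀
  ... | inj₂ (j , e) = inj₂ (trans (cong (_% 8) (trans q≡ (trans (cong (λ t → suc (t ℕ.* 20)) e) (lem j)))) ([m+kn]%n≡m%n 5 (2 ℕ.+ 5 ℕ.* j) 8)
      , trans χ[2]≡χ𝕚 (trans (χ-α (m ℕ.* 5)) (trans (ε-*-odd m 2) (trans (cong ε e) (cong Sign.opposite (ε-double j))))))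
    where
    lem : ∀ j → suc (suc (j ℕ.+ j) ℕ.* 20) ≡ 5 ℕ.+ (2 ℕ.+ 5 ℕ.* j) ℕ.* 8
    lem = solve-∀

  q%8≡1⇒ : q % 8 ≡ 1 → χ [ 2 ] ≡ Sign.+
  q%8≡1⇒ e with q%8
  ... | inj₁ (_ , χ2) = χ2
  ... | inj₂ (e′ , _) with trans (sym e) e′
  ...   | ()

  q%8≡5⇒ : q % 8 ≡ 5 → χ [ 2 ] ≡ Sign.-
  q%8≡5⇒ e with q%8
  ... | inj₂ (_ , χ2) = χ2
  ... | inj₁ (e′ , _) with trans (sym e) e′
  ...   | ()

  eq%5 : ∀ e → (e ℕ.* q) % 5 ≡ e % 5
  eq%5 e = trans (cong (λ t → (e ℕ.* t) % 5) q≡) (trans (cong (_% 5) (lem e m)) ([m+kn]%n≡m%n e (e ℕ.* (4 ℕ.* m)) 5))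
    where
    lem : ∀ e m → e ℕ.* suc (m ℕ.* 20) ≡ e ℕ.+ e ℕ.* (4 ℕ.* m) ℕ.* 5
    lem = solve-∀

  eq%4 : ∀ e → (e ℕ.* q) % 4 ≡ e % 4
  eq%4 e = trans (cong (λ t → (e ℕ.* t) % 4) q≡) (trans (cong (_% 4) (lem e m)) ([m+kn]%n≡m%n e (e ℕ.* (5 ℕ.* m)) 4))
    where
    lem : ∀ e m → e ℕ.* suc (m ℕ.* 20) ≡ e ℕ.+ e ℕ.* (5 ℕ.* m) ℕ.* 4
    lem = solve-∀

  q%5 : q % 5 ≡ 1
  q%5 = trans (cong (_% 5) (sym (ℕₚ.*-identityˡ q))) (eq%5 1)

  q%4 : q % 4 ≡ 1
  q%4 = trans (cong (_% 4) (sym (ℕₚ.*-identityˡ q))) (eq%4 1)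

  q%8%4 : q % 8 % 4 ≡ 1
  q%8%4 = trans (m∣n⇒o%n%m≡o%m 4 8 q (divides 2 refl)) q%4

  21≤q : 21 ≤ q
  21≤q = subst (21 ≤_) (sym q≡) (s≤s (ℕₚ.*-monoˡ-≤ 20 m>0))

  0<q : 0 < q
  0<q = ℕₚ.≤-trans (s≤s z≤n) 21≤q

  -- x ≥ q would give q² ≤ 5q, against q ≥ 21. This keeps the positive integers of the
  -- representations nonzero in the field.
  small : ∀ {x} → x ℕ.* x ≤ 5 ℕ.* q → x < q
  small {x} le = ℕₚ.≰⇒> λ q≤x → ℕₚ.<⇒≱ (ℕₚ.≤-trans (s≤s (s≤s (s≤s (s≤s (s≤s (s≤s z≤n)))))) 21≤q)
    (ℕₚ.*-cancelʳ-≤ q 5 q {{ℕ.>-nonZero 0<q}} (ℕₚ.≤-trans (ℕₚ.*-mono-≤ q≤x q≤x) le))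

  small′ : ∀ {x} → x ℕ.* x ≤ q → x < q
  small′ le = small (ℕₚ.≤-trans le (ℕₚ.m≤m+n q _))

  nonsquare : ∀ x → ¬ q ≡ x ℕ.* x
  nonsquare x e = ℕₚ.<⇒≢ (ℕₚ.≤-trans (s≤s (s≤s z≤n)) 21≤q)
    (sym ([ (λ { refl → e }) , (λ { refl → ℕₚ.*-cancelˡ-≡ q 1 q {{ℕ.>-nonZero 0<q}} (trans (sym e) (sym (ℕₚ.*-identityʳ q))) }) ]′
      (prime⇒irreducible q-prime (divides x e))))

  form : ∀ c d x y → q ≡ c ℕ.* (x ℕ.* x) ℕ.+ d ℕ.* (y ℕ.* y) → [ c ] * ([ x ] * [ x ]) ≡ - ([ d ] * ([ y ] * [ y ]))
  form c d x y e = x-y≡0⇒x≡y (trans (cong ([ c ] * ([ x ] * [ x ]) +_) (-‿involutive _)) (trans (sym (begin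
    [ q ]                                            ≡⟨ cong [_] e ⟩
    [ c ℕ.* (x ℕ.* x) ℕ.+ d ℕ.* (y ℕ.* y) ]          ≡⟨ []-+ (c ℕ.* (x ℕ.* x)) _ ⟩
    [ c ℕ.* (x ℕ.* x) ] + [ d ℕ.* (y ℕ.* y) ]        ≡⟨ cong₂ _+_ (term c x) (term d y) ⟩
    [ c ] * ([ x ] * [ x ]) + [ d ] * ([ y ] * [ y ]) ∎)) [q]≡0))
    where
    open ≡-Reasoning
    term : ∀ c x → [ c ℕ.* (x ℕ.* x) ] ≡ [ c ] * ([ x ] * [ x ])
    term c x = trans ([]-* c (x ℕ.* x)) (cong ([ c ] *_) ([]-* x x))

  χ-± : ∀ {x y} → ¬ y ≡ 0# → x * x ≡ y * y → χ x ≡ χ y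
  χ-± y≢0 e = [ cong χ , (λ p → trans (cong χ p) (χ-neg y≢0)) ]′ (x²≡y² e)

  1*²+ : ∀ x {z} → q ≡ x ℕ.* x ℕ.+ z → q ≡ 1 ℕ.* (x ℕ.* x) ℕ.+ z
  1*²+ x {z} e = trans e (cong (ℕ._+ z) (sym (ℕₚ.*-identityˡ (x ℕ.* x))))

  -- In the field x² = -20y² = (2isy)², so χ(x) = χ(2i) χ(y) χ(s). Here 2i is a square, χ(y) = +
  -- because q ≡ x² (mod y), and χ(x) = (x / 5) = + because 5q ≡ (10y)² (mod x) and x² ≡ 1 (mod 5).
  x²+20y²⇒ : ∀ x y → q ≡ x ℕ.* x ℕ.+ 20 ℕ.* (y ℕ.* y) → χ s ≡ Sign.+
  x²+20y²⇒ x y e = begin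
    χ s                        ≡⟨ cong (Sign._* χ s) (sym χ[y]) ⟩
    χ [ y ] Sign.* χ s         ≡⟨ sym (χ-* [y]≢0 s≢0) ⟩
    χ ([ y ] * s)              ≡⟨ cong (Sign._* χ ([ y ] * s)) (sym χ2𝕚) ⟩
    χ ([ 2 ] * 𝕚) Sign.* χ ([ y ] * s) ≡⟨ sym (χ-* 2𝕚≢0 ys≢0) ⟩
    χ ([ 2 ] * 𝕚 * ([ y ] * s)) ≡⟨ sym (χ-± (*-≢0 2𝕚≢0 ys≢0) square) ⟩
    χ [ x ]                    ≡⟨ χ≡jacobi {x} {10 ℕ.* y} {5 ℕ.* x} (5∤⁺ x x%5) (%2≡1⇒0< x x%2) x<q 5q (inj₁ (%2≡1⇒odd x x%2)) ⟩
    jacobi 2 x                      ≡⟨ jacobi₅≡+ x x%5 ⟩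
    Sign.+ ∎
    where
    open ≡-Reasoning
    -- x is odd, and an even y forces q ≡ 1 (mod 8), where χ(2) = + makes factors of two harmless.
    mod8 = residues 8 1 20 (λ r s v → (v % 4 ℕ.≟ 1) →-dec ((r % 2 ℕ.≟ 1) ×-dec ((s % 2 ℕ.≟ 1) ⊎-dec (v ℕ.≟ 1)))) x y (1*²+ x e) q%8%4
    x%2 : x % 2 ≡ 1
    x%2 = trans (sym (%8%2 x)) (proj₁ mod8)
    x%5 : x % 5 ≡ 1 ⊎ x % 5 ≡ 4
    x%5 = residues 5 1 20 (λ r s v → (v ℕ.≟ 1) →-dec ((r ℕ.≟ 1) ⊎-dec (r ℕ.≟ 4))) x y (1*²+ x e) q%5
    x<q : x < q
    x<q = small′ (ℕₚ.≤-trans (ℕₚ.m≤m+n _ _) (ℕₚ.≤-reflexive (sym e)))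
    y<q : y < q
    y<q = small′ (ℕₚ.≤-trans (ℕₚ.m≤m+n _ _) (ℕₚ.≤-trans (ℕₚ.m≤n+m (20 ℕ.* (y ℕ.* y)) (x ℕ.* x)) (ℕₚ.≤-reflexive (sym e))))
    y>0 : 0 < y
    y>0 = ℕₚ.≰⇒> λ y≤0 → nonsquare x (trans e (trans (cong (λ t → x ℕ.* x ℕ.+ 20 ℕ.* (t ℕ.* t)) (ℕₚ.n≤0⇒n≡0 y≤0)) (ℕₚ.+-identityʳ _)))
    [y]≢0 = []≢0 y>0 y<q
    2𝕚≢0 = *-≢0 2≢0 𝕚≢0
    ys≢0 = *-≢0 [y]≢0 s≢0
    χ2𝕚 : χ ([ 2 ] * 𝕚) ≡ Sign.+
    χ2𝕚 = trans (χ-* 2≢0 𝕚≢0) (trans (cong (Sign._* χ 𝕚) χ[2]≡χ𝕚) (Signₚ.s*s≡+ (χ 𝕚)))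
    χ[y] : χ [ y ] ≡ Sign.+
    χ[y] = χ≡+ {y} {x} {20 ℕ.* y} y>0 y<q (trans e (cong (x ℕ.* x ℕ.+_) (sym (ℕₚ.*-assoc 20 y y))))
      ([ (λ y%2 → inj₁ (%2≡1⇒odd y (trans (sym (%8%2 y)) y%2))) , (λ v → inj₂ (q%8≡1⇒ v)) ]′ (proj₂ mod8))
    5q : 5 ℕ.* q ≡ (10 ℕ.* y) ℕ.* (10 ℕ.* y) ℕ.+ 5 ℕ.* x ℕ.* x
    5q = trans (cong (5 ℕ.*_) e) (lem x y)
      where
      lem : ∀ x y → 5 ℕ.* (x ℕ.* x ℕ.+ 20 ℕ.* (y ℕ.* y)) ≡ (10 ℕ.* y) ℕ.* (10 ℕ.* y) ℕ.+ 5 ℕ.* x ℕ.* x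
      lem = solve-∀
    square : [ x ] * [ x ] ≡ [ 2 ] * 𝕚 * ([ y ] * s) * ([ 2 ] * 𝕚 * ([ y ] * s))
    square = begin
      [ x ] * [ x ]                    ≡⟨ solve 1 (λ x → x := (κ 1 :+ κ 0) :* x) refl _ ⟩
      [ 1 ] * ([ x ] * [ x ])          ≡⟨ form 1 20 x y (1*²+ x e) ⟩
      - ([ 20 ] * ([ y ] * [ y ]))     ≡⟨ cong (λ t → - (t * ([ y ] * [ y ]))) ([]-* 4 5) ⟩
      - ([ 4 ] * [ 5 ] * ([ y ] * [ y ]))  ≡⟨ solve 2 (λ f y → :- (κ 4 :* f :* (y :* y)) := κ 4 :* (:- κ 1) :* (y :* y) :* f) refl [ 5 ] [ y ] ⟩
      [ 4 ] * - 1# * ([ y ] * [ y ]) * [ 5 ]  ≡⟨ cong₂ (λ t u → [ 4 ] * t * ([ y ] * [ y ]) * u) (sym 𝕚²) (sym s²) ⟩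
      [ 4 ] * (𝕚 * 𝕚) * ([ y ] * [ y ]) * (s * s)  ≡⟨ solve 3 (λ i s y → κ 4 :* (i :* i) :* (y :* y) :* (s :* s) := κ 2 :* i :* (y :* s) :* (κ 2 :* i :* (y :* s))) refl 𝕚 s [ y ] ⟩
      [ 2 ] * 𝕚 * ([ y ] * s) * ([ 2 ] * 𝕚 * ([ y ] * s)) ∎

  -- In the field (2x)² = -5y² = (isy)², and χ(2) = χ(i) cancels, leaving χ(s) = χ(x) χ(y). Here
  -- χ(y) = + and χ(x) = (x / 5) = -, since 4x² ≡ 1 (mod 5) gives x ≡ ±2.
  4x²+5y²⇒ : ∀ x y → q ≡ 4 ℕ.* (x ℕ.* x) ℕ.+ 5 ℕ.* (y ℕ.* y) → χ s ≡ Sign.-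
  4x²+5y²⇒ x y e = Signₚ.*-cancelˡ-≡ (χ [ 2 ]) (χ s) Sign.- (begin
    χ [ 2 ] Sign.* χ s         ≡⟨ cong₂ Sign._*_ χ[2]≡χ𝕚 (cong (Sign._* χ s) (sym χ[y])) ⟩
    χ 𝕚 Sign.* (χ [ y ] Sign.* χ s) ≡⟨ cong (χ 𝕚 Sign.*_) (sym (χ-* [y]≢0 s≢0)) ⟩
    χ 𝕚 Sign.* χ ([ y ] * s)   ≡⟨ sym (χ-* 𝕚≢0 ys≢0) ⟩
    χ (𝕚 * ([ y ] * s))        ≡⟨ sym (χ-± (*-≢0 𝕚≢0 ys≢0) square) ⟩
    χ ([ 2 ] * [ x ])          ≡⟨ χ-* 2≢0 ([]≢0 x>0 x<q) ⟩
    χ [ 2 ] Sign.* χ [ x ]     ≡⟨ cong (χ [ 2 ] Sign.*_) (trans (χ≡jacobi {x} {5 ℕ.* y} {20 ℕ.* x} 5∤x x>0 x<q 5q side) (jacobi₅≡- x x%5)) ⟩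
    χ [ 2 ] Sign.* Sign.- ∎)
    where
    open ≡-Reasoning
    -- y is odd, and an even x forces q ≡ 5 (mod 8), where χ(2) = - agrees with (2 / 5), so halving
    -- x preserves χ(x) = (x / 5).
    mod8 = residues 8 4 5 (λ r s v → (v % 4 ℕ.≟ 1) →-dec ((s % 2 ℕ.≟ 1) ×-dec ((r % 2 ℕ.≟ 1) ⊎-dec (v ℕ.≟ 5)))) x y e q%8%4
    y%2 : y % 2 ≡ 1
    y%2 = trans (sym (%8%2 y)) (proj₁ mod8)
    x%5 : x % 5 ≡ 2 ⊎ x % 5 ≡ 3
    x%5 = residues 5 4 5 (λ r s v → (v ℕ.≟ 1) →-dec ((r ℕ.≟ 2) ⊎-dec (r ℕ.≟ 3))) x y e q%5
    5∤x = 5∤⁻ x x%5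
    x>0 = 5∤⇒0< 5∤x
    side : Odd x ⊎ χ [ 2 ] ≡ Sign.-
    side = [ (λ x%2 → inj₁ (%2≡1⇒odd x (trans (sym (%8%2 x)) x%2))) , (λ v → inj₂ (q%8≡5⇒ v)) ]′ (proj₂ mod8)
    x<q : x < q
    x<q = small′ (ℕₚ.≤-trans (ℕₚ.m≤m+n _ _) (ℕₚ.≤-trans (ℕₚ.m≤m+n (4 ℕ.* (x ℕ.* x)) _) (ℕₚ.≤-reflexive (sym e))))
    y<q : y < q
    y<q = small′ (ℕₚ.≤-trans (ℕₚ.m≤m+n _ _) (ℕₚ.≤-trans (ℕₚ.m≤n+m (5 ℕ.* (y ℕ.* y)) (4 ℕ.* (x ℕ.* x))) (ℕₚ.≤-reflexive (sym e))))
    y>0 = %2≡1⇒0< y y%2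
    [y]≢0 = []≢0 y>0 y<q
    ys≢0 = *-≢0 [y]≢0 s≢0
    χ[y] : χ [ y ] ≡ Sign.+
    χ[y] = χ≡+ {y} {2 ℕ.* x} {5 ℕ.* y} y>0 y<q (trans e (lem x y)) (inj₁ (%2≡1⇒odd y y%2))
      where
      lem : ∀ x y → 4 ℕ.* (x ℕ.* x) ℕ.+ 5 ℕ.* (y ℕ.* y) ≡ 2 ℕ.* x ℕ.* (2 ℕ.* x) ℕ.+ 5 ℕ.* y ℕ.* y
      lem = solve-∀
    5q : 5 ℕ.* q ≡ (5 ℕ.* y) ℕ.* (5 ℕ.* y) ℕ.+ 20 ℕ.* x ℕ.* x
    5q = trans (cong (5 ℕ.*_) e) (lem x y)
      where
      lem : ∀ x y → 5 ℕ.* (4 ℕ.* (x ℕ.* x) ℕ.+ 5 ℕ.* (y ℕ.* y)) ≡ (5 ℕ.* y) ℕ.* (5 ℕ.* y) ℕ.+ 20 ℕ.* x ℕ.* x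
      lem = solve-∀
    square : [ 2 ] * [ x ] * ([ 2 ] * [ x ]) ≡ 𝕚 * ([ y ] * s) * (𝕚 * ([ y ] * s))
    square = begin
      [ 2 ] * [ x ] * ([ 2 ] * [ x ])  ≡⟨ solve 1 (λ x → κ 2 :* x :* (κ 2 :* x) := κ 4 :* (x :* x)) refl _ ⟩
      [ 4 ] * ([ x ] * [ x ])          ≡⟨ form 4 5 x y e ⟩
      - ([ 5 ] * ([ y ] * [ y ]))      ≡⟨ solve 2 (λ f y → :- (f :* (y :* y)) := (:- κ 1) :* (y :* y) :* f) refl [ 5 ] [ y ] ⟩
      - 1# * ([ y ] * [ y ]) * [ 5 ]   ≡⟨ cong₂ (λ t u → t * ([ y ] * [ y ]) * u) (sym 𝕚²) (sym s²) ⟩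
      𝕚 * 𝕚 * ([ y ] * [ y ]) * (s * s) ≡⟨ solve 3 (λ i s y → i :* i :* (y :* y) :* (s :* s) := i :* (y :* s) :* (i :* (y :* s))) refl 𝕚 s [ y ] ⟩
      𝕚 * ([ y ] * s) * (𝕚 * ([ y ] * s)) ∎

  -- For n = a + 4b, `square` makes b n θ a square, and χ(b) = +, so χ(s) = χ(θ) = χ(n) = (n / 5).
  a²+4b²⇒ : ∀ a b → q ≡ a ℕ.* a ℕ.+ 4 ℕ.* (b ℕ.* b) → (b % 5 ≡ 0 × χ s ≡ Sign.+) ⊎ (¬ b % 5 ≡ 0 × χ s ≡ Sign.-)
  a²+4b²⇒ a b e = [ (λ (b5 , o) → inj₁ (b5 , trans χs≡jacobi (jacobi₅≡+ n (n% o)))) , (λ (b5 , o) → inj₂ (b5 , trans χs≡jacobi (jacobi₅≡- n (n% o)))) ]′ mod5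
    where
    open ≡-Reasoning
    -- Up to sign, n and w are the real and imaginary parts of (a + 2bi)(1 - 2i), so n² + w² = 5q
    -- and 5q is a square modulo n.
    n = a ℕ.+ 4 ℕ.* b
    w = ∣ ℤ.+ 2 ℤ.* ℤ.+ a ℤ.- ℤ.+ 2 ℤ.* ℤ.+ b ∣
    mod8 = residues 8 1 4 (λ r s v → (v % 4 ℕ.≟ 1) →-dec ((r % 2 ℕ.≟ 1) ×-dec ((s % 2 ℕ.≟ 1) ⊎-dec (v ℕ.≟ 1)))) a b (1*²+ a e) q%8%4
    -- Modulo 5, a² - b² ≡ 1 leaves only (±1, 0) and (0, ±2) for (a, b), and n ≡ a - b is then ±1 or
    -- ±2 respectively.
    mod5 = residues 5 1 4 (λ r s v → (v ℕ.≟ 1) →-dec (((s ℕ.≟ 0) ×-dec (((r ℕ.+ 4 ℕ.* s) % 5 ℕ.≟ 1) ⊎-dec ((r ℕ.+ 4 ℕ.* s) % 5 ℕ.≟ 4)))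
             ⊎-dec (¬? (s ℕ.≟ 0) ×-dec (((r ℕ.+ 4 ℕ.* s) % 5 ℕ.≟ 2) ⊎-dec ((r ℕ.+ 4 ℕ.* s) % 5 ℕ.≟ 3))))) a b (1*²+ a e) q%5
    n% : ∀ {i j} → (a % 5 ℕ.+ 4 ℕ.* (b % 5)) % 5 ≡ i ⊎ (a % 5 ℕ.+ 4 ℕ.* (b % 5)) % 5 ≡ j → n % 5 ≡ i ⊎ n % 5 ≡ j
    n% = [ (λ p → inj₁ (trans (sym (+%-cong 5 4 a b)) p)) , (λ p → inj₂ (trans (sym (+%-cong 5 4 a b)) p)) ]′
    5∤n : ¬ 5 ∣ n
    5∤n = [ (λ (_ , o) → 5∤⁺ n (n% o)) , (λ (_ , o) → 5∤⁻ n (n% o)) ]′ mod5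
    n>0 = 5∤⇒0< 5∤n
    a-odd : Odd a
    a-odd = %2≡1⇒odd a (trans (sym (%8%2 a)) (proj₁ mod8))
    n-odd : Odd n
    n-odd = proj₁ a-odd ℕ.+ 2 ℕ.* b , trans (cong (ℕ._+ 4 ℕ.* b) (proj₂ a-odd)) (lem (proj₁ a-odd) b)
      where
      lem : ∀ k b → suc (k ℕ.+ k) ℕ.+ 4 ℕ.* b ≡ suc ((k ℕ.+ 2 ℕ.* b) ℕ.+ (k ℕ.+ 2 ℕ.* b))
      lem = solve-∀
    5q : 5 ℕ.* q ≡ w ℕ.* w ℕ.+ n ℕ.* n
    5q = trans (cong (5 ℕ.*_) e) (ℤₚ.+-injective (begin
      ℤ.+ (5 ℕ.* (a ℕ.* a ℕ.+ 4 ℕ.* (b ℕ.* b)))   ≡⟨ trans (ℤₚ.pos-* 5 (a ℕ.* a ℕ.+ 4 ℕ.* (b ℕ.* b))) (cong (ℤ.+ 5 ℤ.*_) (cong₂ ℤ._+_ (ℤₚ.pos-* a a) (trans (ℤₚ.pos-* 4 (b ℕ.* b)) (cong (ℤ.+ 4 ℤ.*_) (ℤₚ.pos-* b b))))) ⟩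
      ℤ.+ 5 ℤ.* (ℤ.+ a ℤ.* ℤ.+ a ℤ.+ ℤ.+ 4 ℤ.* (ℤ.+ b ℤ.* ℤ.+ b))  ≡⟨ lem (ℤ.+ a) (ℤ.+ b) ⟩
      (ℤ.+ 2 ℤ.* ℤ.+ a ℤ.- ℤ.+ 2 ℤ.* ℤ.+ b) ℤ.* (ℤ.+ 2 ℤ.* ℤ.+ a ℤ.- ℤ.+ 2 ℤ.* ℤ.+ b) ℤ.+ (ℤ.+ a ℤ.+ ℤ.+ 4 ℤ.* ℤ.+ b) ℤ.* (ℤ.+ a ℤ.+ ℤ.+ 4 ℤ.* ℤ.+ b)
        ≡⟨ sym (cong₂ ℤ._+_ (+∣z∣² (ℤ.+ 2 ℤ.* ℤ.+ a ℤ.- ℤ.+ 2 ℤ.* ℤ.+ b)) (trans (ℤₚ.pos-* n n) (cong₂ ℤ._*_ n≡ n≡))) ⟩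
      ℤ.+ (w ℕ.* w ℕ.+ n ℕ.* n) ∎))
      where
      n≡ : ℤ.+ n ≡ ℤ.+ a ℤ.+ ℤ.+ 4 ℤ.* ℤ.+ b
      n≡ = cong (λ t → ℤ.+ a ℤ.+ t) (ℤₚ.pos-* 4 b)
      lem : ∀ a b → ℤ.+ 5 ℤ.* (a ℤ.* a ℤ.+ ℤ.+ 4 ℤ.* (b ℤ.* b)) ≡ (ℤ.+ 2 ℤ.* a ℤ.- ℤ.+ 2 ℤ.* b) ℤ.* (ℤ.+ 2 ℤ.* a ℤ.- ℤ.+ 2 ℤ.* b) ℤ.+ (a ℤ.+ ℤ.+ 4 ℤ.* b) ℤ.* (a ℤ.+ ℤ.+ 4 ℤ.* b)
      lem = ℤSolver.solve-∀
    n<q : n < q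
    n<q = small (ℕₚ.≤-trans (ℕₚ.m≤n+m (n ℕ.* n) (w ℕ.* w)) (ℕₚ.≤-reflexive (sym 5q)))
    b>0 : 0 < b
    b>0 = ℕₚ.≰⇒> λ b≤0 → nonsquare a (trans e (trans (cong (λ t → a ℕ.* a ℕ.+ 4 ℕ.* (t ℕ.* t)) (ℕₚ.n≤0⇒n≡0 b≤0)) (ℕₚ.+-identityʳ _)))
    b<q : b < q
    b<q = small′ (ℕₚ.≤-trans (ℕₚ.m≤m+n _ _) (ℕₚ.≤-trans (ℕₚ.m≤n+m (4 ℕ.* (b ℕ.* b)) (a ℕ.* a)) (ℕₚ.≤-reflexive (sym e))))
    χ[b] : χ [ b ] ≡ Sign.+
    χ[b] = χ≡+ {b} {a} {4 ℕ.* b} b>0 b<q (trans e (cong (a ℕ.* a ℕ.+_) (sym (ℕₚ.*-assoc 4 b b))))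
      ([ (λ b%2 → inj₁ (%2≡1⇒odd b (trans (sym (%8%2 b)) b%2))) , (λ v → inj₂ (q%8≡1⇒ v)) ]′ (proj₂ mod8))
    [b]≢0 = []≢0 b>0 b<q
    [n]≢0 = []≢0 n>0 n<q
    4b²≡ : [ 4 ] * ([ b ] * [ b ]) ≡ - ([ a ] * [ a ])
    4b²≡ = trans (form 4 1 b a (trans e (trans (ℕₚ.+-comm (a ℕ.* a) _) (cong (4 ℕ.* (b ℕ.* b) ℕ.+_) (sym (ℕₚ.*-identityˡ _))))))
      (solve 1 (λ a → :- ((κ 1 :+ κ 0) :* (a :* a)) := :- (a :* a)) refl [ a ])
    -- With i = a / 2b this is 2 (2 + i) (2 + s) = (2 + i + s)² cleared of denominators.
    square : ([ n ] + [ 2 ] * [ b ] * s) * ([ n ] + [ 2 ] * [ b ] * s) ≡ [ 2 ] * [ 2 ] * ([ b ] * ([ n ] * θ))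
    square = begin
      ([ n ] + [ 2 ] * [ b ] * s) * ([ n ] + [ 2 ] * [ b ] * s)
        ≡⟨ cong (λ t → (t + [ 2 ] * [ b ] * s) * (t + [ 2 ] * [ b ] * s)) [n]≡ ⟩
      ([ a ] + [ 4 ] * [ b ] + [ 2 ] * [ b ] * s) * ([ a ] + [ 4 ] * [ b ] + [ 2 ] * [ b ] * s)
        ≡⟨ solve 3 (λ a b s → (a :+ κ 4 :* b :+ κ 2 :* b :* s) :* (a :+ κ 4 :* b :+ κ 2 :* b :* s)
             := κ 2 :* κ 2 :* (b :* ((a :+ κ 4 :* b) :* (κ 2 :+ s))) :+ (κ 4 :* (b :* b) :* (s :* s :- κ 5) :+ (κ 4 :* (b :* b) :- (:- (a :* a))))) refl [ a ] [ b ] s ⟩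
      [ 2 ] * [ 2 ] * ([ b ] * (([ a ] + [ 4 ] * [ b ]) * θ)) + ([ 4 ] * ([ b ] * [ b ]) * (s * s + - [ 5 ]) + ([ 4 ] * ([ b ] * [ b ]) + - - ([ a ] * [ a ])))
        ≡⟨ cong₂ (λ t u → [ 2 ] * [ 2 ] * ([ b ] * (([ a ] + [ 4 ] * [ b ]) * θ)) + ([ 4 ] * ([ b ] * [ b ]) * t + u)) (x≡y⇒x-y≡0 s²) (x≡y⇒x-y≡0 4b²≡) ⟩
      [ 2 ] * [ 2 ] * ([ b ] * (([ a ] + [ 4 ] * [ b ]) * θ)) + ([ 4 ] * ([ b ] * [ b ]) * 0# + 0#)
        ≡⟨ solve 2 (λ x y → x :+ (y :* κ 0 :+ κ 0) := x) refl _ _ ⟩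
      [ 2 ] * [ 2 ] * ([ b ] * (([ a ] + [ 4 ] * [ b ]) * θ))
        ≡⟨ cong (λ t → [ 2 ] * [ 2 ] * ([ b ] * (t * θ))) (sym [n]≡) ⟩
      [ 2 ] * [ 2 ] * ([ b ] * ([ n ] * θ)) ∎
      where
      [n]≡ : [ n ] ≡ [ a ] + [ 4 ] * [ b ]
      [n]≡ = trans ([]-+ a (4 ℕ.* b)) (cong ([ a ] +_) ([]-* 4 b))
    χs≡jacobi : χ s ≡ jacobi 2 n
    χs≡jacobi = begin
      χ s                        ≡⟨ χs≡χθ ⟩
      χ θ                        ≡⟨ sym (χ*≡+ [n]≢0 θ≢0 (begin
        χ ([ n ] * θ)                           ≡⟨ cong (Sign._* χ ([ n ] * θ)) (sym χ[b]) ⟩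
        χ [ b ] Sign.* χ ([ n ] * θ)            ≡⟨ sym (χ-* [b]≢0 (*-≢0 [n]≢0 θ≢0)) ⟩
        χ ([ b ] * ([ n ] * θ))                 ≡⟨ sym (χ-sq* 2≢0 (*-≢0 [b]≢0 (*-≢0 [n]≢0 θ≢0))) ⟩
        χ ([ 2 ] * [ 2 ] * ([ b ] * ([ n ] * θ)))  ≡⟨ Sq⇒χ (_ , square) ⟩
        Sign.+ ∎)) ⟩
      χ [ n ]                    ≡⟨ χ≡jacobi {n} {w} {n} 5∤n n>0 n<q 5q (inj₁ n-odd) ⟩
      jacobi 2 n ∎

m*m≡0⇒m≡0 : ∀ a → a ℕ.* a ≡ 0 → a ≡ 0
m*m≡0⇒m≡0 a e = [ (λ z → z) , (λ z → z) ]′ (ℕₚ.m*n≡0⇒m≡0∨n≡0 a e)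

-- Representing primes by x² + y² and x² + 5y²

module Thue {q : ℕ} (F : FiniteField q) (m : ℕ) (q≡ : q ≡ suc (m ℕ.* 20))
            (α : FiniteField.Carrier F) (prim : IsPrimitiveRoot F α) (q-prime : Prime q) where
  open Golden F m q≡ α prim
  open PrimeField F m q≡ α prim q-prime
  open Representations F m q≡ α prim q-prime

  [n]≡0⇒q∣n : ∀ n → [ n ] ≡ 0# → q ∣ n
  [n]≡0⇒q∣n n e = m%n≡0⇒n∣m n q (zero-case (n % q) refl)
    where
    instance
      q≢0 : ℕ.NonZero q
      q≢0 = ℕ.>-nonZero 0<q
    reduce : [ n % q ] ≡ 0#
    reduce = begin
      [ n % q ]                            ≡⟨ sym (+-identityʳ _) ⟩
      [ n % q ] + 0#                       ≡⟨ cong ([ n % q ] +_) (sym (trans ([]-* (n / q) q) (trans (cong ([ n / q ] *_) [q]≡0) (zeroʳ _)))) ⟩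
      [ n % q ] + [ n / q ℕ.* q ]          ≡⟨ sym ([]-+ (n % q) (n / q ℕ.* q)) ⟩
      [ n % q ℕ.+ n / q ℕ.* q ]            ≡⟨ cong [_] (sym (m≡m%n+[m/n]*n n q)) ⟩
      [ n ]                                ≡⟨ e ⟩
      0# ∎
      where open ≡-Reasoning
    zero-case : ∀ r → n % q ≡ r → n % q ≡ 0
    zero-case zero e = e
    zero-case (suc r) e = ⊥-elim ([]≢0 (subst (0 <_) (sym e) z<s) (m%n<n n q) reduce)

  ∣⊖∣² : ∀ x y → [ ∣ x ℤ.⊖ y ∣ ] * [ ∣ x ℤ.⊖ y ∣ ] ≡ ([ x ] + - [ y ]) * ([ x ] + - [ y ])
  ∣⊖∣² x y = trans (square (x ℤ.⊖ y)) (cong₂ _*_ (⟦⊖⟧ x y) (⟦⊖⟧ x y))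
    where
    square : ∀ z → [ ∣ z ∣ ] * [ ∣ z ∣ ] ≡ ⟦ z ⟧ * ⟦ z ⟧
    square (ℤ.+ n) = refl
    square -[1+ n ] = solve 1 (λ x → x :* x := (:- x) :* (:- x)) refl [ suc n ]

  ∣⊖∣≡0 : ∀ x y → ∣ x ℤ.⊖ y ∣ ≡ 0 → x ≡ y
  ∣⊖∣≡0 x y e = ℤₚ.+-injective (ℤₚ.i-j≡0⇒i≡j (ℤ.+ x) (ℤ.+ y) (trans (ℤₚ.m-n≡m⊖n x y) (ℤₚ.∣i∣≡0⇒i≡0 e)))

  -- With r = ⌊√q⌋, the (r + 1)² > q pairs (x, y) with entries at most r force a collision of x + c
  -- y. The absolute differences a and b satisfy a² = c²b² = -d b² in the field, and a², b² < q
  -- bounds the multiplier e by d.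
  thue : ∀ d .{{_ : ℕ.NonZero d}} c → c * c ≡ - [ d ] →
    ∃[ a ] ∃[ b ] ∃[ e ] (0 < e × e ≤ d × e ℕ.* q ≡ 1 ℕ.* (a ℕ.* a) ℕ.+ d ℕ.* (b ℕ.* b))
  thue d c c² with floor-sqrt q
  ... | r , r²≤q , q<w² with pigeonhole q<w² (λ i → [ toℕ (proj₁ (remQuot {suc r} (suc r) i)) ] + c * [ toℕ (proj₂ (remQuot {suc r} (suc r) i)) ])
  ... | i , j , i<j , same = a , b , e , e>0 , e≤d , sym eq
    where
    w = suc r
    x x′ y y′ : ℕ
    x = toℕ (proj₁ (remQuot {w} w i))
    y = toℕ (proj₂ (remQuot {w} w i))
    x′ = toℕ (proj₁ (remQuot {w} w j))
    y′ = toℕ (proj₂ (remQuot {w} w j))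
    a b : ℕ
    a = ∣ x ℤ.⊖ x′ ∣
    b = ∣ y ℤ.⊖ y′ ∣
    N : ℕ
    N = 1 ℕ.* (a ℕ.* a) ℕ.+ d ℕ.* (b ℕ.* b)
    [N]≡0 : [ N ] ≡ 0#
    [N]≡0 = begin
      [ N ]                                     ≡⟨ []-+ (1 ℕ.* (a ℕ.* a)) (d ℕ.* (b ℕ.* b)) ⟩
      [ 1 ℕ.* (a ℕ.* a) ] + [ d ℕ.* (b ℕ.* b) ] ≡⟨ cong₂ _+_ (trans (cong [_] (ℕₚ.*-identityˡ (a ℕ.* a))) (trans ([]-* a a) (∣⊖∣² x x′)))
                                                    (trans ([]-* d (b ℕ.* b)) (cong ([ d ] *_) (trans ([]-* b b) (∣⊖∣² y y′)))) ⟩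
      ([ x ] + - [ x′ ]) * ([ x ] + - [ x′ ]) + [ d ] * (([ y ] + - [ y′ ]) * ([ y ] + - [ y′ ]))
        ≡⟨ cong (λ t → ([ x ] + - [ x′ ]) * ([ x ] + - [ x′ ]) + t * (([ y ] + - [ y′ ]) * ([ y ] + - [ y′ ]))) (trans (sym (-‿involutive [ d ])) (cong -_ (sym c²))) ⟩
      ([ x ] + - [ x′ ]) * ([ x ] + - [ x′ ]) + - (c * c) * (([ y ] + - [ y′ ]) * ([ y ] + - [ y′ ]))
        ≡⟨ solve 5 (λ x x′ y y′ c → (x :- x′) :* (x :- x′) :+ (:- (c :* c)) :* ((y :- y′) :* (y :- y′))
             := ((x :+ c :* y) :- (x′ :+ c :* y′)) :* (x :- x′ :- c :* (y :- y′))) refl [ x ] [ x′ ] [ y ] [ y′ ] c ⟩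
      (([ x ] + c * [ y ]) + - ([ x′ ] + c * [ y′ ])) * ([ x ] + - [ x′ ] + - (c * ([ y ] + - [ y′ ])))
        ≡⟨ cong (_* ([ x ] + - [ x′ ] + - (c * ([ y ] + - [ y′ ])))) (x≡y⇒x-y≡0 same) ⟩
      0# * ([ x ] + - [ x′ ] + - (c * ([ y ] + - [ y′ ])))  ≡⟨ zeroˡ _ ⟩
      0# ∎
      where open ≡-Reasoning
    q∣N : q ∣ N
    q∣N = [n]≡0⇒q∣n N [N]≡0
    e : ℕ
    e = _∣_.quotient q∣N
    eq : N ≡ e ℕ.* q
    eq = _∣_.equality q∣N
    bound : ∀ (k l : Fin w) → ∣ toℕ k ℤ.⊖ toℕ l ∣ ≤ r
    bound k l = ℕₚ.≤-trans (ℤₚ.∣m⊝n∣≤m⊔n (toℕ k) (toℕ l)) (ℕₚ.⊔-lub (ℕ.s≤s⁻¹ (Finₚ.toℕ<n k)) (ℕ.s≤s⁻¹ (Finₚ.toℕ<n l)))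
    square-bound : ∀ {t} → t ≤ r → t ℕ.* t < q
    square-bound {t} t≤r = ℕₚ.≤∧≢⇒< (ℕₚ.≤-trans (ℕₚ.*-mono-≤ t≤r t≤r) r²≤q) (λ t²≡q → nonsquare t (sym t²≡q))
    e≤d : e ≤ d
    e≤d = ℕ.s≤s⁻¹ (ℕₚ.*-cancelʳ-< q e (suc d) (subst (_< suc d ℕ.* q) eq (ℕₚ.+-mono-<-≤
      (subst (_< q) (sym (ℕₚ.*-identityˡ (a ℕ.* a))) (square-bound (bound (proj₁ (remQuot {w} w i)) (proj₁ (remQuot {w} w j)))))
      (ℕₚ.*-monoʳ-≤ d (ℕₚ.<⇒≤ (square-bound (bound (proj₂ (remQuot {w} w i)) (proj₂ (remQuot {w} w j)))))))))
    e>0 : 0 < e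
    e>0 = ℕₚ.≰⇒> λ e≤0 → ℕₚ.<⇒≢ i<j (collide (trans eq (cong (ℕ._* q) (ℕₚ.n≤0⇒n≡0 e≤0))))
      where
      collide : N ≡ 0 → toℕ i ≡ toℕ j
      collide N≡0 = cong toℕ (trans (sym (Finₚ.combine-remQuot {w} w i))
        (trans (cong₂ Fin.combine (Finₚ.toℕ-injective (∣⊖∣≡0 x x′ a≡0)) (Finₚ.toℕ-injective (∣⊖∣≡0 y y′ b≡0))) (Finₚ.combine-remQuot {w} w j)))
        where
        a≡0 : a ≡ 0
        a≡0 = m*m≡0⇒m≡0 a (trans (sym (ℕₚ.*-identityˡ (a ℕ.* a))) (ℕₚ.m+n≡0⇒m≡0 _ N≡0))
        b≡0 : b ≡ 0
        b≡0 = m*m≡0⇒m≡0 b ([ (λ d≡0 → ⊥-elim (ℕ.≢-nonZero⁻¹ d d≡0)) , (λ z → z) ]′ (ℕₚ.m*n≡0⇒m≡0∨n≡0 d (ℕₚ.m+n≡0⇒n≡0 (1 ℕ.* (a ℕ.* a)) N≡0)))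

  even-part : ∀ a → a % 4 % 2 ≡ 0 → ∃[ k ] a ≡ k ℕ.+ k
  even-part a e = %2≡0⇒double a (trans (sym (%4%2 a)) e)

  -- For d = 1 the multiplier is 1, and modulo 4 one of the two entries must be even; that one is
  -- written as 2b.
  a²+4b² : ∃[ a ] ∃[ b ] q ≡ a ℕ.* a ℕ.+ 4 ℕ.* (b ℕ.* b)
  a²+4b² = let a , b , e , e>0 , e≤1 , eq = thue 1 𝕚 (trans 𝕚² (cong -_ (sym (+-identityʳ 1#)))) in
    make-even a b (trans (trans (sym (ℕₚ.*-identityˡ q)) (cong (ℕ._* q) (ℕₚ.≤-antisym e>0 e≤1))) eq)
    where
    make-even : ∀ a b → q ≡ 1 ℕ.* (a ℕ.* a) ℕ.+ 1 ℕ.* (b ℕ.* b) → ∃[ a ] ∃[ b ] q ≡ a ℕ.* a ℕ.+ 4 ℕ.* (b ℕ.* b)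
    make-even a b eq = [ (λ a-even → let k , a≡ = even-part a a-even in b , k , trans q≡a²+b²
            (trans (ℕₚ.+-comm (a ℕ.* a) (b ℕ.* b)) (cong (b ℕ.* b ℕ.+_) (trans (cong (λ t → t ℕ.* t) a≡) ([2x]² k)))))
      , (λ b-even → let k , b≡ = even-part b b-even in a , k , trans q≡a²+b²
            (cong (a ℕ.* a ℕ.+_) (trans (cong (λ t → t ℕ.* t) b≡) ([2x]² k)))) ]′
      (residues 4 1 1 (λ r s v → (v ℕ.≟ 1) →-dec ((r % 2 ℕ.≟ 0) ⊎-dec (s % 2 ℕ.≟ 0))) a b eq q%4)
      where
      q≡a²+b² : q ≡ a ℕ.* a ℕ.+ b ℕ.* b
      q≡a²+b² = trans eq (cong₂ ℕ._+_ (ℕₚ.*-identityˡ (a ℕ.* a)) (ℕₚ.*-identityˡ (b ℕ.* b)))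

  √-5 : Carrier
  √-5 = 𝕚 * s

  √-5² : √-5 * √-5 ≡ - [ 5 ]
  √-5² = trans (solve 2 (λ i s → i :* s :* (i :* s) := i :* i :* (s :* s)) refl 𝕚 s)
    (trans (cong₂ _*_ 𝕚² s²) (solve 1 (λ x → (:- κ 1) :* x := :- x) refl [ 5 ]))

  -- The multipliers 2 and 3 are nonsquares modulo 5, where a² ≡ e q ≡ e. For 4 both entries are
  -- even and can be halved. For 5, a = 5k and division by 5 leaves b² + 5k².
  a²+5b² : ∃[ a ] ∃[ b ] q ≡ 1 ℕ.* (a ℕ.* a) ℕ.+ 5 ℕ.* (b ℕ.* b)
  a²+5b² = let a , b , e , e>0 , e≤5 , eq = thue 5 √-5 √-5² in by-multiplier a b e e>0 e≤5 eq
    where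
    mod5 = residues 5 1 5 (λ r s v → ¬? (v ℕ.≟ 2) ×-dec (¬? (v ℕ.≟ 3) ×-dec ((v ℕ.≟ 0) →-dec (r ℕ.≟ 0))))
    mod4 = residues 4 1 5 (λ r s v → (v ℕ.≟ 0) →-dec ((r % 2 ℕ.≟ 0) ×-dec (s % 2 ℕ.≟ 0)))
    by-multiplier : ∀ a b e → 0 < e → e ≤ 5 → e ℕ.* q ≡ 1 ℕ.* (a ℕ.* a) ℕ.+ 5 ℕ.* (b ℕ.* b) → ∃[ a ] ∃[ b ] q ≡ 1 ℕ.* (a ℕ.* a) ℕ.+ 5 ℕ.* (b ℕ.* b)
    by-multiplier a b 1 _ _ eq = a , b , trans (sym (ℕₚ.*-identityˡ q)) eq
    by-multiplier a b 2 _ _ eq = ⊥-elim (proj₁ (mod5 a b eq) (eq%5 2))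
    by-multiplier a b 3 _ _ eq = ⊥-elim (proj₁ (proj₂ (mod5 a b eq)) (eq%5 3))
    by-multiplier a b 4 _ _ eq =
      let a-even , b-even = mod4 a b eq (eq%4 4)
          k , a≡ = even-part a a-even
          l , b≡ = even-part b b-even in
      k , l , ℕₚ.*-cancelˡ-≡ q (1 ℕ.* (k ℕ.* k) ℕ.+ 5 ℕ.* (l ℕ.* l)) 4 (trans eq (trans (cong₂ (λ a b → 1 ℕ.* (a ℕ.* a) ℕ.+ 5 ℕ.* (b ℕ.* b)) a≡ b≡) (lem k l)))
      where
      lem : ∀ k l → 1 ℕ.* ((k ℕ.+ k) ℕ.* (k ℕ.+ k)) ℕ.+ 5 ℕ.* ((l ℕ.+ l) ℕ.* (l ℕ.+ l)) ≡ 4 ℕ.* (1 ℕ.* (k ℕ.* k) ℕ.+ 5 ℕ.* (l ℕ.* l))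
      lem = solve-∀
    by-multiplier a b 5 _ _ eq = divide a b eq (m%n≡0⇒n∣m a 5 (proj₂ (proj₂ (mod5 a b eq)) (eq%5 5)))
      where
      lem : ∀ k b → 1 ℕ.* (k ℕ.* 5 ℕ.* (k ℕ.* 5)) ℕ.+ 5 ℕ.* (b ℕ.* b) ≡ 5 ℕ.* (1 ℕ.* (b ℕ.* b) ℕ.+ 5 ℕ.* (k ℕ.* k))
      lem = solve-∀
      divide : ∀ a b → 5 ℕ.* q ≡ 1 ℕ.* (a ℕ.* a) ℕ.+ 5 ℕ.* (b ℕ.* b) → 5 ∣ a → ∃[ a ] ∃[ b ] q ≡ 1 ℕ.* (a ℕ.* a) ℕ.+ 5 ℕ.* (b ℕ.* b)
      divide a b eq (divides k a≡) = b , k , ℕₚ.*-cancelˡ-≡ q (1 ℕ.* (b ℕ.* b) ℕ.+ 5 ℕ.* (k ℕ.* k)) 5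
        (trans eq (trans (cong (λ a → 1 ℕ.* (a ℕ.* a) ℕ.+ 5 ℕ.* (b ℕ.* b)) a≡) (lem k b)))
    by-multiplier _ _ (suc (suc (suc (suc (suc (suc _)))))) _ (s≤s (s≤s (s≤s (s≤s (s≤s ()))))) _

  ±-disjoint : ∀ {t} → t ≡ Sign.+ → ¬ t ≡ Sign.-
  ±-disjoint refl ()

  -- Modulo 4 one entry of q = a² + 5b² is even: an even b yields x² + 20y², an even a yields 4x² +
  -- 5y². So one of the two forms always represents q, and each determines χ(s).
  χs≡-⇔¬RepBy20 : (χ s ≡ Sign.-) ⇔ (¬ RepBy 20 q)
  χs≡-⇔¬RepBy20 = mk⇔
    (λ χs rep → let x , y , e = RepBy⇒ℕ {20} rep in ±-disjoint (x²+20y²⇒ x y e) χs)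
    (λ ¬rep → let a , b , e = a²+5b² in decide ¬rep a b e)
    where
    lem : ∀ k → 5 ℕ.* ((k ℕ.+ k) ℕ.* (k ℕ.+ k)) ≡ 20 ℕ.* (k ℕ.* k)
    lem = solve-∀
    decide : ¬ RepBy 20 q → ∀ a b → q ≡ 1 ℕ.* (a ℕ.* a) ℕ.+ 5 ℕ.* (b ℕ.* b) → χ s ≡ Sign.-
    decide ¬rep a b e =
      [ (λ a-even → let k , a≡ = even-part a a-even in 4x²+5y²⇒ k b
          (trans e (cong (ℕ._+ 5 ℕ.* (b ℕ.* b)) (trans (ℕₚ.*-identityˡ (a ℕ.* a)) (trans (cong (λ t → t ℕ.* t) a≡) ([2x]² k))))))
      , (λ b-even → let k , b≡ = even-part b b-even in ⊥-elim (¬rep (ℕ⇒RepBy {20} a k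
          (trans e (cong₂ ℕ._+_ (ℕₚ.*-identityˡ (a ℕ.* a)) (trans (cong (λ t → 5 ℕ.* (t ℕ.* t)) b≡) (lem k))))))) ]′
      (residues 4 1 5 (λ r s v → (v ℕ.≟ 1) →-dec ((r % 2 ℕ.≟ 0) ⊎-dec (s % 2 ℕ.≟ 0))) a b e q%4)

  -- x² + 100y² is a² + 4b² with b = 5y, and `a²+4b²⇒` ties the divisibility of b by 5 to χ(s) for
  -- every representation.
  χs≡-⇔¬RepBy100 : (χ s ≡ Sign.-) ⇔ (¬ RepBy 100 q)
  χs≡-⇔¬RepBy100 = mk⇔
    (λ χs rep → let x , y , e = RepBy⇒ℕ {100} rep in exclude χs x y e)
    (λ ¬rep → let a , b , e = a²+4b² in decide ¬rep a b e)
    where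
    lem : ∀ y → 100 ℕ.* (y ℕ.* y) ≡ 4 ℕ.* (y ℕ.* 5 ℕ.* (y ℕ.* 5))
    lem = solve-∀
    exclude : χ s ≡ Sign.- → ∀ x y → ¬ q ≡ x ℕ.* x ℕ.+ 100 ℕ.* (y ℕ.* y)
    exclude χs x y e =
      [ (λ (_ , χs′) → ±-disjoint χs′ χs) , (λ (¬0 , _) → ¬0 (n∣m⇒m%n≡0 (y ℕ.* 5) 5 (divides y refl))) ]′
      (a²+4b²⇒ x (y ℕ.* 5) (trans e (cong (x ℕ.* x ℕ.+_) (lem y))))
    rep-if : ∀ a b → q ≡ a ℕ.* a ℕ.+ 4 ℕ.* (b ℕ.* b) → 5 ∣ b → RepBy 100 q
    rep-if a _ e (divides k refl) = ℕ⇒RepBy {100} a k (trans e (cong (a ℕ.* a ℕ.+_) (sym (lem k))))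
    decide : ¬ RepBy 100 q → ∀ a b → q ≡ a ℕ.* a ℕ.+ 4 ℕ.* (b ℕ.* b) → χ s ≡ Sign.-
    decide ¬rep a b e = [ (λ (b%5 , _) → ⊥-elim (¬rep (rep-if a b e (m%n≡0⇒n∣m b 5 b%5)))) , proj₂ ]′ (a²+4b²⇒ a b e)

-- SL(2, q) on the projective line

module Möbius {q : ℕ} (F : FiniteField q) (m : ℕ) (q≡ : q ≡ suc (m ℕ.* 20))
            (α : FiniteField.Carrier F) (prim : IsPrimitiveRoot F α) where
  open Root F m q≡ α prim public

  SL = SL2 F
  P¹ = Point F
  open SL2 using (a; b; c; d; det) public

  infixr 30 _·_
  _·_ : SL → P¹ → P¹
  _·_ = act F

  -- Homogeneous coordinates of a fixed representative for each point, so that the action becomes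
  -- linear algebra with `br` as the determinant of two representatives.
  X Y : P¹ → Carrier
  X (just z) = z
  X nothing = 1#
  Y (just z) = 1#
  Y nothing = 0#

  br : P¹ → P¹ → Carrier
  br P Q = X P * Y Q + - (X Q * Y P)

  br≡0⇒≡ : ∀ P Q → br P Q ≡ 0# → P ≡ Q
  br≡0⇒≡ (just z) (just w) e = cong just (x-y≡0⇒x≡y (trans (solve 2 (λ z w → z :- w := z :* κ 1 :- w :* κ 1) refl z w) e))
  br≡0⇒≡ (just z) nothing e = ⊥-elim (-1≢0 (trans (solve 1 (λ z → :- κ 1 := z :* κ 0 :- κ 1 :* κ 1) refl z) e))
  br≡0⇒≡ nothing (just w) e = ⊥-elim (1≢0 (trans (solve 1 (λ w → κ 1 := κ 1 :* κ 1 :- w :* κ 0) refl w) e))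
  br≡0⇒≡ nothing nothing e = refl

  br≢0 : ∀ {P Q} → ¬ P ≡ Q → ¬ br P Q ≡ 0#
  br≢0 P≢Q e = P≢Q (br≡0⇒≡ _ _ e)

  LX LY : SL → P¹ → Carrier
  LX g P = a g * X P + b g * Y P
  LY g P = c g * X P + d g * Y P

  -- g sends the chosen representative of P to μ times that of Q.
  record Scaled (g : SL) (P Q : P¹) : Set where
    constructor scaled
    field
      μ : Carrier
      μ≢0 : ¬ μ ≡ 0#
      X-eq : LX g P ≡ μ * X Q
      Y-eq : LY g P ≡ μ * Y Q

  -- All case distinctions of `act` are settled here: the scalar is the second coordinate of the
  -- image vector when that is nonzero, and its first coordinate when the image is ∞.
  act-scaled : ∀ g P → Scaled g P (g · P)
  act-scaled (mat a b c d det) nothing with c ≟ 0#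
  ... | yes c≡0 = scaled a a≢0 (solve 2 (λ a b → a :* κ 1 :+ b :* κ 0 := a :* κ 1) refl a b)
      (trans (solve 3 (λ a c d → c :* κ 1 :+ d :* κ 0 := c :+ a :* κ 0) refl a c d) (trans (cong (_+ a * 0#) c≡0) (+-identityˡ _)))
    where
    a≢0 : ¬ a ≡ 0#
    a≢0 a≡0 = 1≢0 (trans (sym det) (trans (cong₂ (λ a c → a * d + - (b * c)) a≡0 c≡0)
      (solve 2 (λ b d → κ 0 :* d :- b :* κ 0 := κ 0) refl b d)))
  ... | no c≢0 = scaled c c≢0 (trans (solve 2 (λ a b → a :* κ 1 :+ b :* κ 0 := κ 1 :* a) refl a b)
        (trans (cong (_* a) (sym (inverseʳ c c≢0))) (solve 3 (λ a c i → c :* i :* a := c :* (a :* i)) refl a c (c ⁻¹))))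
      (solve 2 (λ c d → c :* κ 1 :+ d :* κ 0 := c :* κ 1) refl c d)
  act-scaled (mat a b c d det) (just z) with (c * z + d) ≟ 0#
  ... | yes D≡0 = scaled (a * z + b) N≢0 (solve 3 (λ a b z → a :* z :+ b :* κ 1 := (a :* z :+ b) :* κ 1) refl a b z)
      (trans (solve 4 (λ c d z n → c :* z :+ d :* κ 1 := (c :* z :+ d) :+ n :* κ 0) refl c d z (a * z + b))
        (trans (cong (_+ (a * z + b) * 0#) D≡0) (+-identityˡ _)))
    where
    N≢0 : ¬ a * z + b ≡ 0#
    N≢0 N≡0 = 1≢0 (trans (sym det) (trans (solve 5 (λ a b c d z → a :* d :- b :* c := a :* (c :* z :+ d) :- (a :* z :+ b) :* c) refl a b c d z)
      (trans (cong₂ (λ D N → a * D + - (N * c)) D≡0 N≡0) (solve 2 (λ a c → a :* κ 0 :- κ 0 :* c := κ 0) refl a c))))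
  ... | no D≢0 = scaled (c * z + d) D≢0 (trans (solve 3 (λ a b z → a :* z :+ b :* κ 1 := κ 1 :* (a :* z :+ b)) refl a b z)
        (trans (cong (_* (a * z + b)) (sym (inverseʳ _ D≢0))) (solve 3 (λ n D i → D :* i :* n := D :* (n :* i)) refl (a * z + b) (c * z + d) ((c * z + d) ⁻¹))))
      (solve 3 (λ c d z → c :* z :+ d :* κ 1 := (c :* z :+ d) :* κ 1) refl c d z)

  scaled⇒act : ∀ {g P Q} → Scaled g P Q → g · P ≡ Q
  scaled⇒act {g} {P} {Q} (scaled ν ν≢0 νX νY) with act-scaled g P
  ... | scaled μ μ≢0 μX μY = br≡0⇒≡ (g · P) Q ([ (λ e → ⊥-elim (μ≢0 e)) , (λ e → e) ]′ (x*y≡0 (begin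
    μ * br (g · P) Q
      ≡⟨ solve 5 (λ μ X Y X′ Y′ → μ :* (X :* Y′ :- X′ :* Y) := μ :* X :* Y′ :- X′ :* (μ :* Y)) refl μ (X (g · P)) (Y (g · P)) (X Q) (Y Q) ⟩
    μ * X (g · P) * Y Q + - (X Q * (μ * Y (g · P)))
      ≡⟨ cong₂ (λ x y → x * Y Q + - (X Q * y)) (trans (sym μX) νX) (trans (sym μY) νY) ⟩
    ν * X Q * Y Q + - (X Q * (ν * Y Q))
      ≡⟨ solve 3 (λ ν X Y → ν :* X :* Y :- X :* (ν :* Y) := κ 0) refl ν (X Q) (Y Q) ⟩
    0# ∎)))
    where open ≡-Reasoning

  L-br : ∀ g P Q → LX g P * LY g Q + - (LX g Q * LY g P) ≡ br P Q
  L-br g P Q = begin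
    LX g P * LY g Q + - (LX g Q * LY g P)
      ≡⟨ solve 8 (λ a b c d x y x′ y′ → (a :* x :+ b :* y) :* (c :* x′ :+ d :* y′) :- (a :* x′ :+ b :* y′) :* (c :* x :+ d :* y)
           := (a :* d :- b :* c) :* (x :* y′ :- x′ :* y)) refl (a g) (b g) (c g) (d g) (X P) (Y P) (X Q) (Y Q) ⟩
    (a g * d g + - (b g * c g)) * br P Q   ≡⟨ cong (_* br P Q) (det g) ⟩
    1# * br P Q                            ≡⟨ *-identityˡ _ ⟩
    br P Q ∎
    where open ≡-Reasoning

  scaled-br : ∀ {g P Q P′ Q′} (p : Scaled g P P′) (q : Scaled g Q Q′) → Scaled.μ p * Scaled.μ q * br P′ Q′ ≡ br P Q
  scaled-br {g} {P} {Q} {P′} {Q′} (scaled μ _ μX μY) (scaled ν _ νX νY) = begin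
    μ * ν * br P′ Q′
      ≡⟨ solve 6 (λ μ ν X Y X′ Y′ → μ :* ν :* (X :* Y′ :- X′ :* Y) := μ :* X :* (ν :* Y′) :- ν :* X′ :* (μ :* Y)) refl μ ν (X P′) (Y P′) (X Q′) (Y Q′) ⟩
    μ * X P′ * (ν * Y Q′) + - (ν * X Q′ * (μ * Y P′))
      ≡⟨ cong₂ (λ s t → s + - t) (cong₂ _*_ (sym μX) (sym νY)) (cong₂ _*_ (sym νX) (sym μY)) ⟩
    LX g P * LY g Q + - (LX g Q * LY g P)  ≡⟨ L-br g P Q ⟩
    br P Q ∎
    where open ≡-Reasoning

  act-injective : ∀ g {P Q} → g · P ≡ g · Q → P ≡ Q
  act-injective g {P} {Q} e = br≡0⇒≡ P Q (trans (sym (scaled-br (act-scaled g P) (act-scaled g Q)))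
    (trans (cong (Scaled.μ (act-scaled g P) * Scaled.μ (act-scaled g Q) *_) (trans (cong (λ R → br R (g · Q)) e) (-‿inverseʳ _))) (zeroʳ _)))

  -- τ separates the two orbits of SL(2, q) on triples of distinct points.
  τ : P¹ → P¹ → P¹ → Sign
  τ P Q S = χ (br P Q * br Q S * br S P)

  Distinct : P¹ → P¹ → P¹ → Set
  Distinct P Q S = ¬ P ≡ Q × ¬ Q ≡ S × ¬ S ≡ P

  br³≢0 : ∀ {P Q S} → Distinct P Q S → ¬ br P Q * br Q S * br S P ≡ 0#
  br³≢0 (PQ , QS , SP) = *-≢0 (*-≢0 (br≢0 PQ) (br≢0 QS)) (br≢0 SP)

  -- Each point enters two of the three brackets, so the scalars contribute only the square (μνρ)².
  τ-invariant : ∀ {g P Q S P′ Q′ S′} → Scaled g P P′ → Scaled g Q Q′ → Scaled g S S′ → Distinct P′ Q′ S′ → τ P Q S ≡ τ P′ Q′ S′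
  τ-invariant {P = P} {Q} {S} {P′} {Q′} {S′} p q s D = begin
    χ (br P Q * br Q S * br S P)
      ≡⟨ cong χ (cong₂ _*_ (cong₂ _*_ (sym (scaled-br p q)) (sym (scaled-br q s))) (sym (scaled-br s p))) ⟩
    χ (μ * ν * br P′ Q′ * (ν * ρ * br Q′ S′) * (ρ * μ * br S′ P′))
      ≡⟨ cong χ (solve 6 (λ μ ν ρ x y z → μ :* ν :* x :* (ν :* ρ :* y) :* (ρ :* μ :* z) := (μ :* ν :* ρ) :* (μ :* ν :* ρ) :* (x :* y :* z)) refl μ ν ρ (br P′ Q′) (br Q′ S′) (br S′ P′)) ⟩
    χ ((μ * ν * ρ) * (μ * ν * ρ) * (br P′ Q′ * br Q′ S′ * br S′ P′))
      ≡⟨ χ-sq* (*-≢0 (*-≢0 (Scaled.μ≢0 p) (Scaled.μ≢0 q)) (Scaled.μ≢0 s)) (br³≢0 D) ⟩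
    χ (br P′ Q′ * br Q′ S′ * br S′ P′) ∎
    where
    open ≡-Reasoning
    μ = Scaled.μ p
    ν = Scaled.μ q
    ρ = Scaled.μ s

  -- Equality in the field is decidable, so proofs of the determinant condition are unique and the
  -- four entries determine the matrix.
  SL2-≡ : ∀ {g h : SL} → a g ≡ a h → b g ≡ b h → c g ≡ c h → d g ≡ d h → g ≡ h
  SL2-≡ {mat a b c d δ} {mat _ _ _ _ δ′} refl refl refl refl = cong (mat a b c d) (Decidable⇒UIP.≡-irrelevant _≟_ δ δ′)

  _≟ₛ_ : (g h : SL) → Dec (g ≡ h)
  g ≟ₛ h = map′ (λ (p , q , r , s) → SL2-≡ p q r s) (λ { refl → refl , refl , refl , refl })
    ((a g ≟ a h) ×-dec ((b g ≟ b h) ×-dec ((c g ≟ c h) ×-dec (d g ≟ d h))))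

  _≟P_ : (P Q : P¹) → Dec (P ≡ Q)
  _≟P_ = ≡-dec _≟_

  -- Opaque, so that comparing products of matrices never unfolds solver output.
  abstract
    det-∘ : ∀ a b c d a′ b′ c′ d′ → a * d + - (b * c) ≡ 1# → a′ * d′ + - (b′ * c′) ≡ 1# →
      (a * a′ + b * c′) * (c * b′ + d * d′) + - ((a * b′ + b * d′) * (c * a′ + d * c′)) ≡ 1#
    det-∘ a b c d a′ b′ c′ d′ δ δ′ = trans (solve 8 (λ a b c d a′ b′ c′ d′ →
        (a :* a′ :+ b :* c′) :* (c :* b′ :+ d :* d′) :- (a :* b′ :+ b :* d′) :* (c :* a′ :+ d :* c′)
          := (a :* d :- b :* c) :* (a′ :* d′ :- b′ :* c′)) refl a b c d a′ b′ c′ d′)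
      (trans (cong₂ _*_ δ δ′) (*-identityˡ 1#))

    det-1 : 1# * 1# + - (0# * 0#) ≡ 1#
    det-1 = solve 0 (κ 1 :* κ 1 :- κ 0 :* κ 0 := κ 1) refl

    det-inv : ∀ a b c d → a * d + - (b * c) ≡ 1# → d * a + - (- b * - c) ≡ 1#
    det-inv a b c d δ = trans (solve 4 (λ a b c d → d :* a :- (:- b) :* (:- c) := a :* d :- b :* c) refl a b c d) δ

    det-neg : ∀ a b c d → a * d + - (b * c) ≡ 1# → - a * - d + - (- b * - c) ≡ 1#
    det-neg a b c d δ = trans (solve 4 (λ a b c d → (:- a) :* (:- d) :- (:- b) :* (:- c) := a :* d :- b :* c) refl a b c d) δ

  infixr 30 _∘_
  _∘_ : SL → SL → SL
  mat a b c d δ ∘ mat a′ b′ c′ d′ δ′ = mat (a * a′ + b * c′) (a * b′ + b * d′) (c * a′ + d * c′) (c * b′ + d * d′)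
    (det-∘ a b c d a′ b′ c′ d′ δ δ′)

  1ₛ : SL
  1ₛ = mat 1# 0# 0# 1# det-1

  inv : SL → SL
  inv (mat a b c d δ) = mat d (- b) (- c) a (det-inv a b c d δ)

  neg : SL → SL
  neg (mat a b c d δ) = mat (- a) (- b) (- c) (- d) (det-neg a b c d δ)

  ∘-assoc : ∀ f g h → (f ∘ g) ∘ h ≡ f ∘ (g ∘ h)
  ∘-assoc (mat a b c d _) (mat a′ b′ c′ d′ _) (mat a″ b″ c″ d″ _) =
    SL2-≡ (entry a b a″ c″) (entry a b b″ d″) (entry c d a″ c″) (entry c d b″ d″)
    where
    entry : ∀ x y z w → (x * a′ + y * c′) * z + (x * b′ + y * d′) * w ≡ x * (a′ * z + b′ * w) + y * (c′ * z + d′ * w)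
    entry = solve 8 (λ a′ b′ c′ d′ x y z w → (x :* a′ :+ y :* c′) :* z :+ (x :* b′ :+ y :* d′) :* w
      := x :* (a′ :* z :+ b′ :* w) :+ y :* (c′ :* z :+ d′ :* w)) refl a′ b′ c′ d′

  ∘-identityˡ : ∀ g → 1ₛ ∘ g ≡ g
  ∘-identityˡ (mat a b c d _) = SL2-≡ (top a c) (top b d) (bottom a c) (bottom b d)
    where
    top : ∀ x y → 1# * x + 0# * y ≡ x
    top = solve 2 (λ x y → κ 1 :* x :+ κ 0 :* y := x) refl
    bottom : ∀ x y → 0# * x + 1# * y ≡ y
    bottom = solve 2 (λ x y → κ 0 :* x :+ κ 1 :* y := y) refl

  ∘-identityʳ : ∀ g → g ∘ 1ₛ ≡ g
  ∘-identityʳ (mat a b c d _) = SL2-≡ (left a b) (right a b) (left c d) (right c d)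
    where
    left : ∀ x y → x * 1# + y * 0# ≡ x
    left = solve 2 (λ x y → x :* κ 1 :+ y :* κ 0 := x) refl
    right : ∀ x y → x * 0# + y * 1# ≡ y
    right = solve 2 (λ x y → x :* κ 0 :+ y :* κ 1 := y) refl

  inv-∘ : ∀ g → inv g ∘ g ≡ 1ₛ
  inv-∘ (mat a b c d δ) = SL2-≡
    (trans (solve 4 (λ a b c d → d :* a :+ (:- b) :* c := a :* d :- b :* c) refl a b c d) δ)
    (solve 2 (λ b d → d :* b :+ (:- b) :* d := κ 0) refl b d)
    (solve 2 (λ a c → (:- c) :* a :+ a :* c := κ 0) refl a c)
    (trans (solve 4 (λ a b c d → (:- c) :* b :+ a :* d := a :* d :- b :* c) refl a b c d) δ)

  ∘-inv : ∀ g → g ∘ inv g ≡ 1ₛ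
  ∘-inv (mat a b c d δ) = SL2-≡
    (trans (solve 4 (λ a b c d → a :* d :+ b :* (:- c) := a :* d :- b :* c) refl a b c d) δ)
    (solve 2 (λ a b → a :* (:- b) :+ b :* a := κ 0) refl a b)
    (solve 2 (λ c d → c :* d :+ d :* (:- c) := κ 0) refl c d)
    (trans (solve 4 (λ a b c d → c :* (:- b) :+ d :* a := a :* d :- b :* c) refl a b c d) δ)

  scaled-∘ : ∀ {g h P Q S} → Scaled h P Q → Scaled g Q S → Scaled (g ∘ h) P S
  scaled-∘ {mat a b c d _} {mat a′ b′ c′ d′ _} {P} {Q} (scaled μ μ≢0 μX μY) (scaled ν ν≢0 νX νY) =
    scaled (μ * ν) (*-≢0 μ≢0 ν≢0) (combine a b νX) (combine c d νY)
    where
    open ≡-Reasoning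
    combine : ∀ x y {z} → x * X Q + y * Y Q ≡ ν * z → (x * a′ + y * c′) * X P + (x * b′ + y * d′) * Y P ≡ μ * ν * z
    combine x y {z} e = begin
      (x * a′ + y * c′) * X P + (x * b′ + y * d′) * Y P
        ≡⟨ solve 8 (λ a′ b′ c′ d′ x y z w → (x :* a′ :+ y :* c′) :* z :+ (x :* b′ :+ y :* d′) :* w
             := x :* (a′ :* z :+ b′ :* w) :+ y :* (c′ :* z :+ d′ :* w)) refl a′ b′ c′ d′ x y (X P) (Y P) ⟩
      x * (a′ * X P + b′ * Y P) + y * (c′ * X P + d′ * Y P)  ≡⟨ cong₂ (λ s t → x * s + y * t) μX μY ⟩
      x * (μ * X Q) + y * (μ * Y Q)                 ≡⟨ solve 5 (λ x y μ s t → x :* (μ :* s) :+ y :* (μ :* t) := μ :* (x :* s :+ y :* t)) refl x y μ (X Q) (Y Q) ⟩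
      μ * (x * X Q + y * Y Q)                       ≡⟨ cong (μ *_) e ⟩
      μ * (ν * z)                                   ≡⟨ sym (*-assoc μ ν z) ⟩
      μ * ν * z ∎

  act-∘ : ∀ g h P → (g ∘ h) · P ≡ g · (h · P)
  act-∘ g h P = scaled⇒act (scaled-∘ (act-scaled h P) (act-scaled g (h · P)))

  act-1 : ∀ P → 1ₛ · P ≡ P
  act-1 P = scaled⇒act {1ₛ} {P} (scaled 1# 1≢0
    (solve 2 (λ x y → κ 1 :* x :+ κ 0 :* y := κ 1 :* x) refl (X P) (Y P))
    (solve 2 (λ x y → κ 0 :* x :+ κ 1 :* y := κ 1 :* y) refl (X P) (Y P)))

  L-neg : ∀ {g P Q} → Scaled g P Q → Scaled (neg g) P Q
  L-neg {mat a b c d _} {P} (scaled μ μ≢0 μX μY) = scaled (- μ) (neg-≢0 μ≢0) (flip a b μX) (flip c d μY)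
    where
    flip : ∀ x y {z} → x * X P + y * Y P ≡ μ * z → - x * X P + - y * Y P ≡ - μ * z
    flip x y {z} e = trans (solve 4 (λ x y s t → (:- x) :* s :+ (:- y) :* t := :- (x :* s :+ y :* t)) refl x y (X P) (Y P))
      (trans (cong -_ e) (solve 2 (λ μ z → :- (μ :* z) := (:- μ) :* z) refl μ z))

  neg-≢ : ∀ g → ¬ g ≡ neg g
  neg-≢ (mat a b c d δ) e = 1≢0 (trans (sym δ) (trans (cong₂ (λ a c → a * d + - (b * c)) (self-neg (cong SL2.a e)) (self-neg (cong SL2.c e)))
      (solve 2 (λ b d → κ 0 :* d :- b :* κ 0 := κ 0) refl b d)))
    where
    self-neg : ∀ {x} → x ≡ - x → x ≡ 0#
    self-neg {x} e = [ (λ e → ⊥-elim (2≢0 e)) , (λ e → e) ]′ (x*y≡0 (trans (solve 1 (λ x → κ 2 :* x := x :- (:- x)) refl x) (x≡y⇒x-y≡0 e)))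

  -- Cramer's rule: the bracket of P and Q times a difference of coefficients is a combination of
  -- the two differences of values, which vanish.
  linear-determined : ∀ {P Q} → ¬ P ≡ Q → ∀ {x y x′ y′} → x * X P + y * Y P ≡ x′ * X P + y′ * Y P →
    x * X Q + y * Y Q ≡ x′ * X Q + y′ * Y Q → (x ≡ x′) × (y ≡ y′)
  linear-determined {P} {Q} P≢Q {x} {y} {x′} {y′} eP eQ =
    x-y≡0⇒x≡y (cancel (begin
      br P Q * (x + - x′)
        ≡⟨ solve 8 (λ x y x′ y′ s t u v → (s :* v :- u :* t) :* (x :- x′) := v :* ((x :* s :+ y :* t) :- (x′ :* s :+ y′ :* t)) :- t :* ((x :* u :+ y :* v) :- (x′ :* u :+ y′ :* v))) refl x y x′ y′ (X P) (Y P) (X Q) (Y Q) ⟩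
      Y Q * ((x * X P + y * Y P) + - (x′ * X P + y′ * Y P)) + - (Y P * ((x * X Q + y * Y Q) + - (x′ * X Q + y′ * Y Q)))
        ≡⟨ vanish (Y Q) (Y P) ⟩
      0# ∎)) ,
    x-y≡0⇒x≡y (cancel (begin
      br P Q * (y + - y′)
        ≡⟨ solve 8 (λ x y x′ y′ s t u v → (s :* v :- u :* t) :* (y :- y′) := (:- u) :* ((x :* s :+ y :* t) :- (x′ :* s :+ y′ :* t)) :- (:- s) :* ((x :* u :+ y :* v) :- (x′ :* u :+ y′ :* v))) refl x y x′ y′ (X P) (Y P) (X Q) (Y Q) ⟩
      - X Q * ((x * X P + y * Y P) + - (x′ * X P + y′ * Y P)) + - (- X P * ((x * X Q + y * Y Q) + - (x′ * X Q + y′ * Y Q)))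
        ≡⟨ vanish (- X Q) (- X P) ⟩
      0# ∎))
    where
    open ≡-Reasoning
    cancel : ∀ {z} → br P Q * z ≡ 0# → z ≡ 0#
    cancel e = [ (λ e → ⊥-elim (br≢0 P≢Q e)) , (λ e → e) ]′ (x*y≡0 e)
    vanish : ∀ s t → s * ((x * X P + y * Y P) + - (x′ * X P + y′ * Y P)) + - (t * ((x * X Q + y * Y Q) + - (x′ * X Q + y′ * Y Q))) ≡ 0#
    vanish s t = trans (cong₂ (λ u v → s * u + - (t * v)) (x≡y⇒x-y≡0 eP) (x≡y⇒x-y≡0 eQ)) (solve 2 (λ s t → s :* κ 0 :- t :* κ 0 := κ 0) refl s t)

  same-scale⇒≡ : ∀ {g h P Q P′ Q′} → ¬ P ≡ Q → (p : Scaled g P P′) (p′ : Scaled h P P′) (q : Scaled g Q Q′) (q′ : Scaled h Q Q′) →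
    Scaled.μ p ≡ Scaled.μ p′ → Scaled.μ q ≡ Scaled.μ q′ → g ≡ h
  same-scale⇒≡ P≢Q (scaled μ _ pX pY) (scaled μ′ _ pX′ pY′) (scaled ν _ qX qY) (scaled ν′ _ qX′ qY′) refl refl =
    let a≡ , b≡ = linear-determined P≢Q (trans pX (sym pX′)) (trans qX (sym qX′))
        c≡ , d≡ = linear-determined P≢Q (trans pY (sym pY′)) (trans qY (sym qY′))
    in SL2-≡ a≡ b≡ c≡ d≡

  -- μν, νρ and ρμ are determined by the brackets, hence (μ, ν, ρ) is determined up to a common sign.
  unique-up-to-sign : ∀ {g h P Q S P′ Q′ S′} → Distinct P Q S → Distinct P′ Q′ S′ →
    Scaled g P P′ → Scaled g Q Q′ → Scaled g S S′ → Scaled h P P′ → Scaled h Q Q′ → Scaled h S S′ → g ≡ h ⊎ g ≡ neg h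
  unique-up-to-sign {g} {h} {P} {Q} {S} {P′} {Q′} {S′} (P≢Q , _) (P′≢Q′ , Q′≢S′ , S′≢P′) p q s p′ q′ s′ =
    [ (λ e → inj₁ (same-scale⇒≡ P≢Q p p′ q q′ e (*-cancelˡ (Scaled.μ≢0 p) (trans μν (cong (_* ν′) (sym e))))))
    , (λ e → inj₂ (same-scale⇒≡ P≢Q p (L-neg p′) q (L-neg q′) e
        (*-cancelˡ (Scaled.μ≢0 p) (trans μν (trans (solve 2 (λ x y → x :* y := (:- x) :* (:- y)) refl μ′ ν′) (cong (_* - ν′) (sym e))))))) ]′ (x²≡y² squares)
    where
    open ≡-Reasoning
    μ = Scaled.μ p
    ν = Scaled.μ q
    ρ = Scaled.μ s
    μ′ = Scaled.μ p′
    ν′ = Scaled.μ q′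
    ρ′ = Scaled.μ s′
    determined : ∀ {A B A′ B′} → ¬ A′ ≡ B′ → (x : Scaled g A A′) (y : Scaled g B B′) (x′ : Scaled h A A′) (y′ : Scaled h B B′) →
      Scaled.μ x * Scaled.μ y ≡ Scaled.μ x′ * Scaled.μ y′
    determined {A} {B} {A′} {B′} A≢B x y x′ y′ = *-cancelˡ (br≢0 A≢B) (trans (*-comm _ _)
      (trans (scaled-br x y) (trans (sym (scaled-br x′ y′)) (*-comm _ _))))
    μν : μ * ν ≡ μ′ * ν′
    μν = determined P′≢Q′ p q p′ q′
    squares : μ * μ ≡ μ′ * μ′
    squares = *-cancelˡ (*-≢0 (Scaled.μ≢0 q) (Scaled.μ≢0 s)) (begin
      ν * ρ * (μ * μ)          ≡⟨ solve 3 (λ μ ν ρ → ν :* ρ :* (μ :* μ) := μ :* ν :* (ρ :* μ)) refl μ ν ρ ⟩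
      μ * ν * (ρ * μ)          ≡⟨ cong₂ _*_ μν (determined S′≢P′ s p s′ p′) ⟩
      μ′ * ν′ * (ρ′ * μ′)      ≡⟨ solve 3 (λ μ ν ρ → μ :* ν :* (ρ :* μ) := ν :* ρ :* (μ :* μ)) refl μ′ ν′ ρ′ ⟩
      ν′ * ρ′ * (μ′ * μ′)      ≡⟨ cong (_* (μ′ * μ′)) (sym (determined Q′≢S′ q s q′ s′)) ⟩
      ν * ρ * (μ′ * μ′) ∎)

  -- The three-term linear relation among vectors of the plane; `f` is one of the two coordinates,
  -- so that a single statement serves both rows of a matrix.
  plücker : ∀ (f : P¹ → Carrier) → (∀ P → f P ≡ X P) ⊎ (∀ P → f P ≡ Y P) → ∀ P Q S → br Q S * f P + br S P * f Q + br P Q * f S ≡ 0#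
  plücker f (inj₁ e) P Q S = trans (cong₂ _+_ (cong₂ _+_ (cong (br Q S *_) (e P)) (cong (br S P *_) (e Q))) (cong (br P Q *_) (e S)))
    (solve 6 (λ a b c d e f → (c :* f :- e :* d) :* a :+ (e :* b :- a :* f) :* c :+ (a :* d :- c :* b) :* e := κ 0) refl (X P) (Y P) (X Q) (Y Q) (X S) (Y S))
  plücker f (inj₂ e) P Q S = trans (cong₂ _+_ (cong₂ _+_ (cong (br Q S *_) (e P)) (cong (br S P *_) (e Q))) (cong (br P Q *_) (e S)))
    (solve 6 (λ a b c d e f → (c :* f :- e :* d) :* b :+ (e :* b :- a :* f) :* d :+ (a :* d :- c :* b) :* f := κ 0) refl (X P) (Y P) (X Q) (Y Q) (X S) (Y S))

  -- Cramer's rule gives the matrix taking the representatives of P and Q to μP′ and νQ′, with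
  -- determinant μνp′ / p = 1. That S goes to ρS′ then follows from the three-term relation.
  transitive : ∀ {P Q S P′ Q′ S′} → Distinct P Q S → Distinct P′ Q′ S′ → τ P Q S ≡ τ P′ Q′ S′ →
    ∃[ g ] (Scaled g P P′ × Scaled g Q Q′ × Scaled g S S′)
  transitive {P} {Q} {S} {P′} {Q′} {S′} D@(P≢Q , Q≢S , S≢P) D′@(P′≢Q′ , Q′≢S′ , S′≢P′) τ≡ =
    g , scaled μ μ≢0 (atP X) (atP Y) , scaled ν ν≢0 (atQ X) (atQ Y) , scaled ρ ρ≢0 (atS X (inj₁ λ _ → refl)) (atS Y (inj₂ λ _ → refl))
    where
    open ≡-Reasoning
    p r t p′ r′ t′ : Carrier
    p = br P Q
    r = br Q S
    t = br S P
    p′ = br P′ Q′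
    r′ = br Q′ S′
    t′ = br S′ P′
    ip ir it iE : Carrier
    ip = p ⁻¹
    ir = r ⁻¹
    it = t ⁻¹
    iE = (p′ * r′ * t′) ⁻¹
    p·ip : p * ip ≡ 1#
    p·ip = inverseʳ p (br≢0 P≢Q)
    r·ir : r * ir ≡ 1#
    r·ir = inverseʳ r (br≢0 Q≢S)
    t·it : t * it ≡ 1#
    t·it = inverseʳ t (br≢0 S≢P)
    E·iE : p′ * r′ * t′ * iE ≡ 1#
    E·iE = inverseʳ (p′ * r′ * t′) (br³≢0 D′)
    W-sq : Sq (p * r * t * (p′ * r′ * t′))
    W-sq = χ⇒Sq (trans (χ-* (br³≢0 D) (br³≢0 D′)) (trans (cong (Sign._* τ P′ Q′ S′) τ≡) (Signₚ.s*s≡+ (τ P′ Q′ S′))))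
    -- Preserving brackets requires μν = p / p′ and its two analogues, solved by μ = M r′ / r, ν = M
    -- t′ / t, ρ = M p′ / p with M² = prt / (p′r′t′). Equality of the types makes prt · p′r′t′ a
    -- square W², whence M = W / (p′r′t′).
    W M : Carrier
    W = proj₁ W-sq
    M = W * iE
    M² : M * M * (p′ * r′ * t′) ≡ p * r * t
    M² = begin
      W * iE * (W * iE) * (p′ * r′ * t′)       ≡⟨ solve 3 (λ W i E → W :* i :* (W :* i) :* E := W :* W :* i :* (E :* i)) refl W iE (p′ * r′ * t′) ⟩
      W * W * iE * (p′ * r′ * t′ * iE)         ≡⟨ cong₂ (λ w e → w * iE * e) (proj₂ W-sq) E·iE ⟩
      p * r * t * (p′ * r′ * t′) * iE * 1#     ≡⟨ solve 3 (λ x E i → x :* E :* i :* κ 1 := x :* (E :* i)) refl (p * r * t) (p′ * r′ * t′) iE ⟩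
      p * r * t * (p′ * r′ * t′ * iE)          ≡⟨ cong (p * r * t *_) E·iE ⟩
      p * r * t * 1#                           ≡⟨ *-identityʳ _ ⟩
      p * r * t ∎
    M≢0 : ¬ M ≡ 0#
    M≢0 e = br³≢0 D (trans (sym M²) (trans (cong (λ M → M * M * (p′ * r′ * t′)) e) (solve 1 (λ x → κ 0 :* κ 0 :* x := κ 0) refl _)))
    inv≢0 : ∀ {x y} → x * y ≡ 1# → ¬ y ≡ 0#
    inv≢0 {x} e refl = 1≢0 (trans (sym e) (zeroʳ x))
    μ ν ρ : Carrier
    μ = M * r′ * ir
    ν = M * t′ * it
    ρ = M * p′ * ip
    μ≢0 : ¬ μ ≡ 0#
    μ≢0 = *-≢0 (*-≢0 M≢0 (br≢0 Q′≢S′)) (inv≢0 r·ir)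
    ν≢0 : ¬ ν ≡ 0#
    ν≢0 = *-≢0 (*-≢0 M≢0 (br≢0 S′≢P′)) (inv≢0 t·it)
    ρ≢0 : ¬ ρ ≡ 0#
    ρ≢0 = *-≢0 (*-≢0 M≢0 (br≢0 P′≢Q′)) (inv≢0 p·ip)
    row₁ row₂ : (P¹ → Carrier) → Carrier
    row₁ f = ip * (μ * f P′ * Y Q + - (ν * f Q′ * Y P))
    row₂ f = ip * (ν * f Q′ * X P + - (μ * f P′ * X Q))
    g : SL
    g = mat (row₁ X) (row₂ X) (row₁ Y) (row₂ Y) (begin
      row₁ X * row₂ Y + - (row₂ X * row₁ Y)
        ≡⟨ solve 11 (λ ip μ ν xP yP xQ yQ xP′ yP′ xQ′ yQ′ →
             ip :* (μ :* xP′ :* yQ :- ν :* xQ′ :* yP) :* (ip :* (ν :* yQ′ :* xP :- μ :* yP′ :* xQ))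
               :- ip :* (ν :* xQ′ :* xP :- μ :* xP′ :* xQ) :* (ip :* (μ :* yP′ :* yQ :- ν :* yQ′ :* yP))
             := ip :* ip :* (xP :* yQ :- xQ :* yP) :* (μ :* ν :* (xP′ :* yQ′ :- xQ′ :* yP′))) refl
             ip μ ν (X P) (Y P) (X Q) (Y Q) (X P′) (Y P′) (X Q′) (Y Q′) ⟩
      ip * ip * p * (μ * ν * p′)               ≡⟨ cong (ip * ip * p *_) μνp′ ⟩
      ip * ip * p * p                          ≡⟨ solve 2 (λ i p → i :* i :* p :* p := p :* i :* (p :* i)) refl ip p ⟩
      p * ip * (p * ip)                        ≡⟨ cong₂ _*_ p·ip p·ip ⟩
      1# * 1#                                  ≡⟨ *-identityˡ 1# ⟩
      1# ∎)
      where
      μνp′ : μ * ν * p′ ≡ p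
      μνp′ = begin
        M * r′ * ir * (M * t′ * it) * p′       ≡⟨ solve 6 (λ M r t p ir it → M :* r :* ir :* (M :* t :* it) :* p := M :* M :* (p :* r :* t) :* (ir :* it)) refl M r′ t′ p′ ir it ⟩
        M * M * (p′ * r′ * t′) * (ir * it)     ≡⟨ cong (_* (ir * it)) M² ⟩
        p * r * t * (ir * it)                  ≡⟨ solve 5 (λ p r t ir it → p :* r :* t :* (ir :* it) := p :* (r :* ir) :* (t :* it)) refl p r t ir it ⟩
        p * (r * ir) * (t * it)                ≡⟨ cong₂ (λ x y → p * x * y) r·ir t·it ⟩
        p * 1# * 1#                            ≡⟨ solve 1 (λ p → p :* κ 1 :* κ 1 := p) refl p ⟩
        p ∎
    atP : ∀ f → row₁ f * X P + row₂ f * Y P ≡ μ * f P′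
    atP f = begin
      row₁ f * X P + row₂ f * Y P
        ≡⟨ solve 9 (λ ip μ ν xP yP xQ yQ u v → ip :* (μ :* u :* yQ :- ν :* v :* yP) :* xP :+ ip :* (ν :* v :* xP :- μ :* u :* xQ) :* yP
             := (xP :* yQ :- xQ :* yP) :* ip :* (μ :* u)) refl ip μ ν (X P) (Y P) (X Q) (Y Q) (f P′) (f Q′) ⟩
      p * ip * (μ * f P′)                      ≡⟨ cong (_* (μ * f P′)) p·ip ⟩
      1# * (μ * f P′)                          ≡⟨ *-identityˡ _ ⟩
      μ * f P′ ∎
    atQ : ∀ f → row₁ f * X Q + row₂ f * Y Q ≡ ν * f Q′
    atQ f = begin
      row₁ f * X Q + row₂ f * Y Q
        ≡⟨ solve 9 (λ ip μ ν xP yP xQ yQ u v → ip :* (μ :* u :* yQ :- ν :* v :* yP) :* xQ :+ ip :* (ν :* v :* xP :- μ :* u :* xQ) :* yQ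
             := (xP :* yQ :- xQ :* yP) :* ip :* (ν :* v)) refl ip μ ν (X P) (Y P) (X Q) (Y Q) (f P′) (f Q′) ⟩
      p * ip * (ν * f Q′)                      ≡⟨ cong (_* (ν * f Q′)) p·ip ⟩
      1# * (ν * f Q′)                          ≡⟨ *-identityˡ _ ⟩
      ν * f Q′ ∎
    atS : ∀ f → (∀ P → f P ≡ X P) ⊎ (∀ P → f P ≡ Y P) → row₁ f * X S + row₂ f * Y S ≡ ρ * f S′
    atS f coord = begin
      row₁ f * X S + row₂ f * Y S
        ≡⟨ solve 11 (λ ip μ ν xP yP xQ yQ xS yS u v → ip :* (μ :* u :* yQ :- ν :* v :* yP) :* xS :+ ip :* (ν :* v :* xP :- μ :* u :* xQ) :* yS
             := :- (ip :* (μ :* (xQ :* yS :- xS :* yQ) :* u :+ ν :* (xS :* yP :- xP :* yS) :* v))) refl ip μ ν (X P) (Y P) (X Q) (Y Q) (X S) (Y S) (f P′) (f Q′) ⟩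
      - (ip * (M * r′ * ir * r * f P′ + M * t′ * it * t * f Q′))
        ≡⟨ solve 10 (λ ip M r t ir it r₀ t₀ u v → :- (ip :* (M :* r :* ir :* r₀ :* u :+ M :* t :* it :* t₀ :* v)) := :- (ip :* M :* (r :* u :* (r₀ :* ir) :+ t :* v :* (t₀ :* it)))) refl ip M r′ t′ ir it r t (f P′) (f Q′) ⟩
      - (ip * M * (r′ * f P′ * (r * ir) + t′ * f Q′ * (t * it)))
        ≡⟨ cong₂ (λ x y → - (ip * M * (r′ * f P′ * x + t′ * f Q′ * y))) r·ir t·it ⟩
      - (ip * M * (r′ * f P′ * 1# + t′ * f Q′ * 1#))
        ≡⟨ solve 8 (λ ip M r u t v p w → :- (ip :* M :* (r :* u :* κ 1 :+ t :* v :* κ 1)) := M :* p :* ip :* w :- ip :* M :* (r :* u :+ t :* v :+ p :* w)) refl ip M r′ (f P′) t′ (f Q′) p′ (f S′) ⟩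
      ρ * f S′ + - (ip * M * (r′ * f P′ + t′ * f Q′ + p′ * f S′))
        ≡⟨ cong (λ z → ρ * f S′ + - (ip * M * z)) (plücker f coord P′ Q′ S′) ⟩
      ρ * f S′ + - (ip * M * 0#)
        ≡⟨ solve 2 (λ x y → x :- y :* κ 0 := x) refl (ρ * f S′) (ip * M) ⟩
      ρ * f S′ ∎

-- Double counting of group elements over blocks and triples

length-≡ : ∀ {A : Set} {xs ys : List A} → Unique xs → Unique ys → (∀ {x} → x ∈ xs → x ∈ ys) → (∀ {x} → x ∈ ys → x ∈ xs) → length xs ≡ length ys
length-≡ u v sub sup = ℕₚ.≤-antisym (unique-⊆⇒length≤ u sub) (unique-⊆⇒length≤ v sup)

length-concat-const : ∀ {A : Set} {s} {xss : List (List A)} → All (λ xs → length xs ≡ s) xss → length (concat xss) ≡ length xss ℕ.* s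
length-concat-const [] = refl
length-concat-const {xss = xs ∷ xss} (e ∷ es) = trans (length-++ xs) (cong₂ ℕ._+_ e (length-concat-const es))

length-concat-filter : ∀ {A B : Set} {P : A → Set} (P? : ∀ x → Dec (P x)) (f : A → List B) s xs →
  (∀ {x} → x ∈ xs → P x → length (f x) ≡ s) → (∀ {x} → x ∈ xs → ¬ P x → length (f x) ≡ 0) →
  length (concat (map f xs)) ≡ length (filter P? xs) ℕ.* s
length-concat-filter P? f s [] _ _ = refl
length-concat-filter P? f s (x ∷ xs) pos neg with P? x
... | yes p = trans (length-++ (f x)) (cong₂ ℕ._+_ (pos (here refl) p) (length-concat-filter P? f s xs (λ x∈ → pos (there x∈)) (λ x∈ → neg (there x∈))))
... | no ¬p = trans (length-++ (f x)) (cong₂ ℕ._+_ (neg (here refl) ¬p) (length-concat-filter P? f s xs (λ x∈ → pos (there x∈)) (λ x∈ → neg (there x∈))))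

deduplicate-AllPairs : ∀ {A : Set} {R : A → A → Set} (R? : ∀ x y → Dec (R x y)) xs → AllPairs (λ x y → ¬ R x y) (deduplicate R? xs)
deduplicate-AllPairs R? [] = []
deduplicate-AllPairs R? (x ∷ xs) = Allₚ.all-filter _ (deduplicate R? xs) ∷ AllPairsₚ.filter⁺ _ (deduplicate-AllPairs R? xs)

allPairs-with-∈ : ∀ {A : Set} {R S : A → A → Set} {xs} → (∀ {x y} → x ∈ xs → y ∈ xs → R x y → S x y) → AllPairs R xs → AllPairs S xs
allPairs-with-∈ f [] = []
allPairs-with-∈ f (r ∷ rs) = All.tabulate (λ y∈ → f (here refl) (there y∈) (All.lookup r y∈)) ∷ allPairs-with-∈ (λ x∈ y∈ → f (there x∈) (there y∈)) rs

Triple : Set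
Triple = ℕ × ℕ × ℕ

triples : ℕ → List Triple
triples k = cartesianProduct (upTo k) (cartesianProduct (upTo k) (upTo k))

-- With φ n = χ(1 - γⁿ) this says τ(γⁱ, γʲ, γˡ) = s.
HasSign : (ℕ → Sign) → Sign → Triple → Set
HasSign φ s (i , j , l) = (¬ i ≡ j × ¬ j ≡ l × ¬ l ≡ i) × φ ∣ i - j ∣ Sign.* φ ∣ j - l ∣ Sign.* φ ∣ l - i ∣ ≡ s

hasSign? : ∀ φ s t → Dec (HasSign φ s t)
hasSign? φ s (i , j , l) = (¬? (i ℕ.≟ j) ×-dec (¬? (j ℕ.≟ l) ×-dec ¬? (l ℕ.≟ i))) ×-dec (φ ∣ i - j ∣ Sign.* φ ∣ j - l ∣ Sign.* φ ∣ l - i ∣ Signₚ.≟ s)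

#triples : ℕ → (ℕ → Sign) → Sign → ℕ
#triples k φ s = length (filter (hasSign? φ s) (triples k))

module Orbit {q : ℕ} (F : FiniteField q) (m : ℕ) (q≡ : q ≡ suc (m ℕ.* 20))
            (α : FiniteField.Carrier F) (prim : IsPrimitiveRoot F α) where
  open Möbius F m q≡ α prim

  matrices : Carrier × Carrier × Carrier × Carrier → List SL
  matrices (a , b , c , d) with (a * d + - (b * c)) ≟ 1#
  ... | yes δ = mat a b c d δ ∷ []
  ... | no _ = []

  group : List SL
  group = deduplicate _≟ₛ_ (concat (map matrices (cartesianProduct elements (cartesianProduct elements (cartesianProduct elements elements)))))

  group-unique : Unique group
  group-unique = UniqueDecₚ.deduplicate-! _≟ₛ_ _

  group-complete : ∀ g → g ∈ group
  group-complete g@(mat a b c d δ) = ∈-deduplicate⁺ _≟ₛ_ (∈-concat⁺′ listed (∈-map⁺ matrices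
      (∈-cartesianProduct⁺ (complete a) (∈-cartesianProduct⁺ (complete b) (∈-cartesianProduct⁺ (complete c) (complete d))))))
    where
    listed : g ∈ matrices (a , b , c , d)
    listed with (a * d + - (b * c)) ≟ 1#
    ... | yes δ′ = here (SL2-≡ refl refl refl refl)
    ... | no ¬δ = ⊥-elim (¬δ δ)

  module Block (γ : Carrier) (k : ℕ) where
    pt : ℕ → P¹
    pt i = just (γ ↑ i)

    In : SL → P¹ → Set
    In = InBlock F γ k

    Same : SL → SL → Set
    Same = SameBlock F γ k

    in? : ∀ g P → Dec (In g P)
    in? g P = ℕₚ.anyUpTo? (λ i → (g · pt i) ≟P P) k

    same? : ∀ g h → Dec (Same g h)
    same? g h = map′ to from ((ℕₚ.allUpTo? (λ i → in? h (g · pt i)) k) ×-dec (ℕₚ.allUpTo? (λ i → in? g (h · pt i)) k))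
      where
      to : (∀ {i} → i < k → In h (g · pt i)) × (∀ {i} → i < k → In g (h · pt i)) → Same g h
      to (p , q) P = mk⇔ (λ { (i , i<k , refl) → p i<k }) (λ { (i , i<k , refl) → q i<k })
      from : Same g h → (∀ {i} → i < k → In h (g · pt i)) × (∀ {i} → i < k → In g (h · pt i))
      from s = (λ {i} i<k → Equivalence.to (s (g · pt i)) (i , i<k , refl)) , (λ {i} i<k → Equivalence.from (s (h · pt i)) (i , i<k , refl))

    same-refl : ∀ g → Same g g
    same-refl g P = mk⇔ (λ p → p) (λ p → p)

    same-sym : ∀ g h → Same g h → Same h g
    same-sym g h s P = mk⇔ (Equivalence.from (s P)) (Equivalence.to (s P))

    same-trans : ∀ f g h → Same f g → Same g h → Same f h
    same-trans f g h s t P = mk⇔ (λ p → Equivalence.to (t P) (Equivalence.to (s P) p)) (λ p → Equivalence.from (s P) (Equivalence.from (t P) p))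

    in-∘ : ∀ f g P → In g P → In (f ∘ g) (f · P)
    in-∘ f g P (i , i<k , e) = i , i<k , trans (act-∘ f g (pt i)) (cong (f ·_) e)

    ·-inv : ∀ f P → f · inv f · P ≡ P
    ·-inv f P = trans (sym (act-∘ f (inv f) P)) (trans (cong (_· P) (∘-inv f)) (act-1 P))

    inv-∘-∘ : ∀ f g → inv f ∘ (f ∘ g) ≡ g
    inv-∘-∘ f g = trans (sym (∘-assoc (inv f) f g)) (trans (cong (_∘ g) (inv-∘ f)) (∘-identityˡ g))

    ∘-inv-∘ : ∀ f g → f ∘ (inv f ∘ g) ≡ g
    ∘-inv-∘ f g = trans (sym (∘-assoc f (inv f) g)) (trans (cong (_∘ g) (∘-inv f)) (∘-identityˡ g))

    same-∘ : ∀ f g h → Same g h → Same (f ∘ g) (f ∘ h)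
    same-∘ f g h s P = mk⇔ (transport g h (λ Q → Equivalence.to (s Q))) (transport h g (λ Q → Equivalence.from (s Q)))
      where
      transport : ∀ g h → (∀ Q → In g Q → In h Q) → In (f ∘ g) P → In (f ∘ h) P
      transport g h t p = subst (In (f ∘ h)) (·-inv f P) (in-∘ f h (inv f · P) (t (inv f · P)
        (subst (λ g → In g (inv f · P)) (inv-∘-∘ f g) (in-∘ (inv f) (f ∘ g) P p))))

    -- The setwise stabilizer of B in SL(2, q), so it includes -I.
    stabilizer : List SL
    stabilizer = filter (same? 1ₛ) group

    #stabilizer : ℕ
    #stabilizer = length stabilizer

    #stabilizer>0 : 0 < #stabilizer
    #stabilizer>0 with stabilizer | ∈-filter⁺ (same? 1ₛ) (group-complete 1ₛ) (same-refl 1ₛ)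
    ... | _ ∷ _ | _ = z<s

    coset : SL → List SL
    coset g = map (g ∘_) stabilizer

    ∘-cancelˡ : ∀ f {g h} → f ∘ g ≡ f ∘ h → g ≡ h
    ∘-cancelˡ f {g} {h} e = trans (sym (inv-∘-∘ f g)) (trans (cong (inv f ∘_) e) (inv-∘-∘ f h))

    coset-unique : ∀ g → Unique (coset g)
    coset-unique g = Uniqueₚ.map⁺ (∘-cancelˡ g) (Uniqueₚ.filter⁺ (same? 1ₛ) group-unique)

    -- hB = gB means that g⁻¹h stabilizes B, so the cosets of the stabilizer are the classes of
    -- `Same`.
    ∈-coset⁺ : ∀ g h → Same g h → h ∈ coset g
    ∈-coset⁺ g h s = subst (_∈ coset g) (∘-inv-∘ g h) (∈-map⁺ (g ∘_) (∈-filter⁺ (same? 1ₛ) (group-complete (inv g ∘ h))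
      (subst (λ f → Same f (inv g ∘ h)) (inv-∘ g) (same-∘ (inv g) g h s))))

    ∈-coset⁻ : ∀ g h → h ∈ coset g → Same g h
    ∈-coset⁻ g h h∈ with ∈-map⁻ (g ∘_) h∈
    ... | σ , σ∈ , h≡ = subst₂ Same (∘-identityʳ g) (sym h≡) (same-∘ g 1ₛ σ (proj₂ (∈-filter⁻ (same? 1ₛ) {xs = group} σ∈)))

    module Through (P Q S : P¹) where
      Contains : SL → Set
      Contains = ContainsTriple F γ k P Q S

      contains? : ∀ g → Dec (Contains g)
      contains? g = in? g P ×-dec (in? g Q ×-dec in? g S)

      movers : List SL
      movers = filter contains? group

      movers-unique : Unique movers
      movers-unique = Uniqueₚ.filter⁺ contains? group-unique

      same-contains : ∀ g h → Same g h → Contains g → Contains h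
      same-contains g h s (p , q , r) = Equivalence.to (s P) p , Equivalence.to (s Q) q , Equivalence.to (s S) r

      -- Containing the triple depends on the block alone, so the movers split into whole cosets,
      -- one for each block listed.
      #movers : ∀ {lam} → NumBlocksThrough F γ k P Q S lam → length movers ≡ lam ℕ.* #stabilizer
      #movers (gs , refl , contain , distinct , exhaust) = trans (length-≡ movers-unique cosets-unique covered contained)
        (trans (length-concat-const {s = #stabilizer} {map coset gs} (Allₚ.map⁺ (All.tabulate {xs = gs} (λ {g} _ → length-map (g ∘_) stabilizer))))
          (cong (ℕ._* #stabilizer) (length-map coset gs)))
        where
        covered : ∀ {h} → h ∈ movers → h ∈ concat (map coset gs)
        covered {h} h∈ = let g , g∈ , s = find (exhaust h (proj₂ (∈-filter⁻ contains? {xs = group} h∈))) in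
          ∈-concat⁺′ (∈-coset⁺ g h (same-sym h g s)) (∈-map⁺ coset g∈)
        contained : ∀ {h} → h ∈ concat (map coset gs) → h ∈ movers
        contained {h} h∈ =
          let xs , h∈xs , xs∈ = ∈-concat⁻′ (map coset gs) h∈
              g , g∈ , xs≡ = ∈-map⁻ coset xs∈ in
          ∈-filter⁺ contains? (group-complete h) (same-contains g h (∈-coset⁻ g h (subst (h ∈_) xs≡ h∈xs)) (All.lookup contain g∈))
        cosets-unique : Unique (concat (map coset gs))
        cosets-unique = Uniqueₚ.concat⁺ (Allₚ.map⁺ (All.tabulate (λ {g} _ → coset-unique g)))
          (AllPairsₚ.map⁺ (AllPairs.map (λ {g} {h} ¬s {x} (x∈g , x∈h) → ¬s (same-trans g x h (∈-coset⁻ g x x∈g) (same-sym h x (∈-coset⁻ h x x∈h)))) distinct))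

      blocks : List SL
      blocks = deduplicate same? movers

      -- Every triple has some block count; what remains for a design is that this count is constant
      -- and positive.
      numBlocks : NumBlocksThrough F γ k P Q S (length blocks)
      numBlocks = blocks , refl , Allₚ.deduplicate⁺ same? (Allₚ.all-filter contains? group) , deduplicate-AllPairs same? movers ,
        λ g c → Anyₚ.deduplicate⁺ same? {P = Same g} (λ {x} {y} y≈x g≈x → same-trans g x y g≈x (same-sym y x y≈x))
          (lose (∈-filter⁺ contains? (group-complete g) c) (same-refl g))

  module Typed (γ : Carrier) (k : ℕ) (φ : ℕ → Sign)
    (γ-injective : ∀ {i j} → i < k → j < k → γ ↑ i ≡ γ ↑ j → i ≡ j)
    (τ-φ : ∀ {i j l} → i < k → j < k → l < k → ¬ i ≡ j → ¬ j ≡ l → ¬ l ≡ i →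
      τ (just (γ ↑ i)) (just (γ ↑ j)) (just (γ ↑ l)) ≡ φ ∣ i - j ∣ Sign.* φ ∣ j - l ∣ Sign.* φ ∣ l - i ∣) where
    open Block γ k

    pt-injective : ∀ {i j} → i < k → j < k → pt i ≡ pt j → i ≡ j
    pt-injective i<k j<k e = γ-injective i<k j<k (just-injective e)

    triples-unique : Unique (triples k)
    triples-unique = Uniqueₚ.cartesianProduct⁺ (Uniqueₚ.upTo⁺ k) (Uniqueₚ.cartesianProduct⁺ (Uniqueₚ.upTo⁺ k) (Uniqueₚ.upTo⁺ k))

    ∈-triples⁻ : ∀ {i j l} → (i , j , l) ∈ triples k → i < k × j < k × l < k
    ∈-triples⁻ t∈ =
      let i∈ , jl∈ = ∈-cartesianProduct⁻ (upTo k) (cartesianProduct (upTo k) (upTo k)) t∈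
          j∈ , l∈ = ∈-cartesianProduct⁻ (upTo k) (upTo k) jl∈ in
      ∈-upTo⁻ i∈ , ∈-upTo⁻ j∈ , ∈-upTo⁻ l∈

    module _ (P Q S : P¹) (distinct : Distinct P Q S) where
      open Through P Q S

      Moves : SL → Triple → Set
      Moves g (i , j , l) = g · pt i ≡ P × g · pt j ≡ Q × g · pt l ≡ S

      moves? : ∀ t g → Dec (Moves g t)
      moves? (i , j , l) g = ((g · pt i) ≟P P) ×-dec (((g · pt j) ≟P Q) ×-dec ((g · pt l) ≟P S))

      fibre : Triple → List SL
      fibre t = filter (moves? t) group

      ∈-fibre⁻ : ∀ {t g} → g ∈ fibre t → Moves g t
      ∈-fibre⁻ {t} g∈ = proj₂ (∈-filter⁻ (moves? t) {xs = group} g∈)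

      scaled-to : ∀ {g R} i → g · pt i ≡ R → Scaled g (pt i) R
      scaled-to {g} i e = subst (Scaled g (pt i)) e (act-scaled g (pt i))

      moves⇒hasSign : ∀ {g i j l} → i < k → j < k → l < k → Moves g (i , j , l) → HasSign φ (τ P Q S) (i , j , l)
      moves⇒hasSign {g} {i} {j} {l} i<k j<k l<k (p , q , s) = (i≢j , j≢l , l≢i) ,
        trans (sym (τ-φ i<k j<k l<k i≢j j≢l l≢i)) (τ-invariant {g} (scaled-to i p) (scaled-to j q) (scaled-to l s) distinct)
        where
        i≢j : ¬ i ≡ j
        i≢j refl = proj₁ distinct (trans (sym p) q)
        j≢l : ¬ j ≡ l
        j≢l refl = proj₁ (proj₂ distinct) (trans (sym q) s)
        l≢i : ¬ l ≡ i
        l≢i refl = proj₂ (proj₂ distinct) (trans (sym s) p)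

      -- Transitivity supplies one g, and uniqueness up to sign leaves only g and -g, which differ
      -- because 2 ≠ 0.
      fibre-size : ∀ {t} → t ∈ triples k → HasSign φ (τ P Q S) t → length (fibre t) ≡ 2
      fibre-size {t@(i , j , l)} t∈ ((i≢j , j≢l , l≢i) , sgn) with ∈-triples⁻ t∈
      ... | i<k , j<k , l<k = two (transitive D distinct (trans (τ-φ i<k j<k l<k i≢j j≢l l≢i) sgn))
        where
        D : Distinct (pt i) (pt j) (pt l)
        D = (λ e → i≢j (pt-injective i<k j<k e)) , (λ e → j≢l (pt-injective j<k l<k e)) , (λ e → l≢i (pt-injective l<k i<k e))
        two : ∃[ g ] (Scaled g (pt i) P × Scaled g (pt j) Q × Scaled g (pt l) S) → length (fibre t) ≡ 2
        two (g , p , q , s) = length-≡ {ys = g ∷ neg g ∷ []} (Uniqueₚ.filter⁺ (moves? t) group-unique) ((neg-≢ g ∷ []) ∷ [] ∷ [])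
          (λ {h} h∈ → let p′ , q′ , s′ = ∈-fibre⁻ {t} {h} h∈ in
            [ here , (λ e → there (here e)) ]′ (unique-up-to-sign D distinct (scaled-to i p′) (scaled-to j q′) (scaled-to l s′) p q s))
          (λ { (here refl) → ∈-filter⁺ (moves? t) (group-complete g) (scaled⇒act p , scaled⇒act q , scaled⇒act s)
             ; (there (here refl)) → ∈-filter⁺ (moves? t) (group-complete (neg g)) (scaled⇒act (L-neg p) , scaled⇒act (L-neg q) , scaled⇒act (L-neg s)) })

      fibre-empty : ∀ {t} → t ∈ triples k → ¬ HasSign φ (τ P Q S) t → length (fibre t) ≡ 0
      fibre-empty {t@(i , j , l)} t∈ ¬sgn = length-≡ {ys = []} (Uniqueₚ.filter⁺ (moves? t) group-unique) []
        (λ {h} h∈ → let i<k , j<k , l<k = ∈-triples⁻ t∈ in ⊥-elim (¬sgn (moves⇒hasSign {h} i<k j<k l<k (∈-fibre⁻ {t} {h} h∈)))) (λ ())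

      fibres-unique : Unique (concat (map fibre (triples k)))
      fibres-unique = Uniqueₚ.concat⁺ (Allₚ.map⁺ (All.tabulate (λ {t} _ → Uniqueₚ.filter⁺ (moves? t) group-unique)))
        (AllPairsₚ.map⁺ (allPairs-with-∈ disjoint triples-unique))
        where
        disjoint : ∀ {t u} → t ∈ triples k → u ∈ triples k → ¬ t ≡ u → ∀ {g} → ¬ (g ∈ fibre t × g ∈ fibre u)
        disjoint {t@(i , j , l)} {u@(i′ , j′ , l′)} t∈ u∈ t≢u {g} (g∈t , g∈u) =
          let i<k , j<k , l<k = ∈-triples⁻ t∈
              i<k′ , j<k′ , l<k′ = ∈-triples⁻ u∈
              p , q , s = ∈-fibre⁻ {t} {g} g∈t
              p′ , q′ , s′ = ∈-fibre⁻ {u} {g} g∈u in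
          t≢u (cong₂ _,_ (pt-injective i<k i<k′ (act-injective g (trans p (sym p′))))
            (cong₂ _,_ (pt-injective j<k j<k′ (act-injective g (trans q (sym q′)))) (pt-injective l<k l<k′ (act-injective g (trans s (sym s′))))))

      -- A mover determines the indices of the preimages of P, Q and S, so the movers are
      -- partitioned by ordered index triples. Each triple of the type of (P, Q, S) has two movers,
      -- every other triple none.
      #movers-by-sign : length movers ≡ #triples k φ (τ P Q S) ℕ.* 2
      #movers-by-sign = trans (length-≡ movers-unique fibres-unique covered contained)
        (length-concat-filter (hasSign? φ (τ P Q S)) fibre 2 (triples k) fibre-size fibre-empty)
        where
        covered : ∀ {g} → g ∈ movers → g ∈ concat (map fibre (triples k))
        covered {g} g∈ =
          let (i , i<k , p) , (j , j<k , q) , (l , l<k , s) = proj₂ (∈-filter⁻ contains? {xs = group} g∈) in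
          ∈-concat⁺′ (∈-filter⁺ (moves? (i , j , l)) (group-complete g) (p , q , s))
            (∈-map⁺ fibre (∈-cartesianProduct⁺ (∈-upTo⁺ i<k) (∈-cartesianProduct⁺ (∈-upTo⁺ j<k) (∈-upTo⁺ l<k))))
        contained : ∀ {g} → g ∈ concat (map fibre (triples k)) → g ∈ movers
        contained {g} g∈ with ∈-concat⁻′ (map fibre (triples k)) g∈
        ... | xs , g∈xs , xs∈ with ∈-map⁻ fibre xs∈
        ...   | (i , j , l) , t∈ , refl =
          let i<k , j<k , l<k = ∈-triples⁻ t∈
              p , q , s = ∈-fibre⁻ {i , j , l} {g} g∈xs in
          ∈-filter⁺ contains? (group-complete g) ((i , i<k , p) , (j , j<k , q) , (l , l<k , s))

    blocks-through : ∀ {lam} P Q S → Distinct P Q S → NumBlocksThrough F γ k P Q S lam → lam ℕ.* #stabilizer ≡ #triples k φ (τ P Q S) ℕ.* 2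
    blocks-through P Q S D nb = trans (sym (Through.#movers P Q S nb)) (#movers-by-sign P Q S D)

    ∞ 0P : P¹
    ∞ = nothing
    0P = just 0#

    basic-distinct : ∀ {x} → ¬ x ≡ 0# → Distinct ∞ 0P (just x)
    basic-distinct x≢0 = (λ ()) , (λ e → x≢0 (sym (just-injective e))) , (λ ())

    -- Provides a triple of each type: (∞, 0, 1) and (∞, 0, α).
    τ-basic : ∀ x → τ ∞ 0P (just x) ≡ χ x
    τ-basic x = cong χ (solve 1 (λ x → (κ 1 :* κ 1 :- κ 0 :* κ 0) :* (κ 0 :* κ 1 :- x :* κ 1) :* (x :* κ 0 :- κ 1 :* κ 1) := x) refl x)

    basic-witness : ∀ s → ∃[ x ] (¬ x ≡ 0# × χ x ≡ s)
    basic-witness Sign.+ = 1# , 1≢0 , χ-α 0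
    basic-witness Sign.- = α ↑ 1 , ↑-≢0 1 α≢0 , χ-α 1

    -- λ times the order of the stabilizer is the same at every triple; reading it off at one triple
    -- of each type equates the two counts.
    design⇒balanced : OrbitIs3Design F γ k → #triples k φ Sign.+ ≡ #triples k φ Sign.-
    design⇒balanced (lam , _ , nb) = ℕₚ.*-cancelʳ-≡ _ _ 2 (trans (sym (count Sign.+)) (count Sign.-))
      where
      count : ∀ s → lam ℕ.* #stabilizer ≡ #triples k φ s ℕ.* 2
      count s with basic-witness s
      ... | x , x≢0 , χx = let d₁ , d₂ , d₃ = basic-distinct x≢0 in
        trans (blocks-through ∞ 0P (just x) (basic-distinct x≢0) (nb ∞ 0P (just x) d₁ (λ e → d₃ (sym e)) d₂))
          (cong (λ s → #triples k φ s ℕ.* 2) (trans (τ-basic x) χx))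

    -- Block count times stabilizer order no longer depends on the type, so every block count equals
    -- `λ₀`, the one at (∞, 0, 1).
    balanced⇒design : #triples k φ Sign.+ ≡ #triples k φ Sign.- → 0 < #triples k φ Sign.+ → OrbitIs3Design F γ k
    balanced⇒design balanced positive = λ₀ , λ₀>0 , λ P Q S P≢Q P≢S Q≢S →
        subst (NumBlocksThrough F γ k P Q S) (ℕₚ.*-cancelʳ-≡ _ λ₀ #stabilizer {{ℕ.>-nonZero #stabilizer>0}}
          (trans (count P Q S (P≢Q , Q≢S , λ e → P≢S (sym e))) (sym (count ∞ 0P (just 1#) (basic-distinct 1≢0)))))
          (Through.numBlocks P Q S)
      where
      blocks-count : P¹ → P¹ → P¹ → ℕ
      blocks-count P Q S = length (Through.blocks P Q S)
      λ₀ : ℕ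
      λ₀ = blocks-count ∞ 0P (just 1#)
      any-sign : ∀ s → #triples k φ s ≡ #triples k φ Sign.+
      any-sign Sign.+ = refl
      any-sign Sign.- = sym balanced
      count : ∀ P Q S → Distinct P Q S → blocks-count P Q S ℕ.* #stabilizer ≡ #triples k φ Sign.+ ℕ.* 2
      count P Q S D = trans (blocks-through P Q S D (Through.numBlocks P Q S)) (cong (ℕ._* 2) (any-sign (τ P Q S)))
      λ₀>0 : 0 < λ₀
      λ₀>0 = ℕₚ.≰⇒> λ λ₀≤0 → ℕₚ.<⇒≢ (ℕₚ.*-mono-< positive (s≤s (z≤n {1})))
        (trans (cong (ℕ._* #stabilizer) (sym (ℕₚ.n≤0⇒n≡0 λ₀≤0))) (count ∞ 0P (just 1#) (basic-distinct 1≢0)))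

-- The values χ(1 - γⁿ) for γ of order 5 and 10, in terms of e = χ(1 + β), u = χ(1 - β) and v = χ(2).
φ₅ : (e u : Sign) → ℕ → Sign
φ₅ e u 1 = u
φ₅ e u 2 = u Sign.* e
φ₅ e u 3 = u Sign.* e
φ₅ e u 4 = u
φ₅ e u _ = Sign.+

φ₁₀ : (e u v : Sign) → ℕ → Sign
φ₁₀ e u v 1 = e
φ₁₀ e u v 2 = u
φ₁₀ e u v 3 = e
φ₁₀ e u v 4 = u Sign.* e
φ₁₀ e u v 5 = v
φ₁₀ e u v 6 = u Sign.* e
φ₁₀ e u v 7 = e
φ₁₀ e u v 8 = u
φ₁₀ e u v 9 = e
φ₁₀ e u v _ = Sign.+

-- Three fifth roots of unity have either one or two pairs at index distance 2 or 3, giving the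
-- products ue and u. Each shape accounts for 30 of the 60 ordered triples, and for e = -1 the two
-- products are opposite.
balanced₅ : ∀ u → #triples 5 (φ₅ Sign.- u) Sign.+ ≡ 30 × #triples 5 (φ₅ Sign.- u) Sign.- ≡ 30
balanced₅ Sign.+ = refl , refl
balanced₅ Sign.- = refl , refl

-- For e = 1 every factor is u, so all 60 triples have the sign u³ = u.
unbalanced₅ : ∀ u → ¬ #triples 5 (φ₅ Sign.+ u) Sign.+ ≡ #triples 5 (φ₅ Sign.+ u) Sign.-
unbalanced₅ Sign.+ ()
unbalanced₅ Sign.- ()

-- Half of the 10 · 9 · 8 = 720 ordered triples, checked by evaluation for each value of χ(1 - β)
-- and χ(2).
balanced₁₀ : ∀ u v → #triples 10 (φ₁₀ Sign.- u v) Sign.+ ≡ 360 × #triples 10 (φ₁₀ Sign.- u v) Sign.- ≡ 360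
balanced₁₀ Sign.+ Sign.+ = refl , refl
balanced₁₀ Sign.+ Sign.- = refl , refl
balanced₁₀ Sign.- Sign.+ = refl , refl
balanced₁₀ Sign.- Sign.- = refl , refl

unbalanced₁₀ : ∀ u v → ¬ #triples 10 (φ₁₀ Sign.+ u v) Sign.+ ≡ #triples 10 (φ₁₀ Sign.+ u v) Sign.-
unbalanced₁₀ Sign.+ Sign.+ ()
unbalanced₁₀ Sign.+ Sign.- ()
unbalanced₁₀ Sign.- Sign.+ ()
unbalanced₁₀ Sign.- Sign.- ()

-- The cyclic blocks of order 5 and 10

module Equivalences {q : ℕ} (F : FiniteField q) (m : ℕ) (q≡ : q ≡ suc (m ℕ.* 20))
            (α : FiniteField.Carrier F) (prim : IsPrimitiveRoot F α) where
  open Golden F m q≡ α prim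
  open Orbit F m q≡ α prim using (module Typed)

  χ-≢+ : ∀ {t} → ¬ t ≡ Sign.+ → t ≡ Sign.-
  χ-≢+ {Sign.+} h = ⊥-elim (h refl)
  χ-≢+ {Sign.-} h = refl

  -- The exponent of γ is an even multiple of m, written c + c to exhibit γ as the square of δ.
  -- Powers of γ then drop out of χ, and brackets depend only on differences of exponents.
  module Cyclic (c k : ℕ) (ck≡20 : (c ℕ.+ c) ℕ.* k ≡ 20) (0<c : 0 < c) where
    γ δ : Carrier
    γ = α ↑ (m ℕ.* (c ℕ.+ c))
    δ = α ↑ (m ℕ.* c)

    γ≢0 : ¬ γ ≡ 0#
    γ≢0 = ↑-≢0 (m ℕ.* (c ℕ.+ c)) α≢0

    γ-square : ∀ n → γ ↑ n ≡ δ ↑ n * δ ↑ n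
    γ-square n = trans (cong (_↑ n) (trans (cong (α ↑_) (ℕₚ.*-distribˡ-+ m c c)) (↑-+ α (m ℕ.* c) (m ℕ.* c)))) (*-↑ δ δ n)

    γ↑n : ∀ n → γ ↑ n ≡ α ↑ (m ℕ.* ((c ℕ.+ c) ℕ.* n))
    γ↑n n = trans (sym (↑-* α n (m ℕ.* (c ℕ.+ c)))) (cong (α ↑_) (trans (ℕₚ.*-comm n _) (ℕₚ.*-assoc m (c ℕ.+ c) n)))

    0<2c : 0 < c ℕ.+ c
    0<2c = ℕₚ.≤-trans 0<c (ℕₚ.m≤m+n c c)

    γ↑≢1 : ∀ {n} → 0 < n → n < k → ¬ γ ↑ n ≡ 1#
    γ↑≢1 {n} 0<n n<k e = α↑-≢1 ((c ℕ.+ c) ℕ.* n) {{ℕ.>-nonZero (ℕₚ.*-mono-≤ 0<2c 0<n)}}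
      (subst ((c ℕ.+ c) ℕ.* n <_) ck≡20 (ℕₚ.*-monoʳ-< (c ℕ.+ c) {{ℕ.>-nonZero 0<2c}} n<k)) (trans (sym (γ↑n n)) e)

    1-γ↑≢0 : ∀ {n} → 0 < n → n < k → ¬ 1# + - (γ ↑ n) ≡ 0#
    1-γ↑≢0 0<n n<k e = γ↑≢1 0<n n<k (sym (x-y≡0⇒x≡y e))

    γ↑k≡1 : γ ↑ k ≡ 1#
    γ↑k≡1 = trans (γ↑n k) (trans (cong (λ t → α ↑ (m ℕ.* t)) ck≡20) α↑20m≡1)

    γ-split : ∀ {i j} → i ≤ j → γ ↑ j ≡ γ ↑ i * γ ↑ (j ∸ i)
    γ-split {i} {j} i≤j = trans (cong (γ ↑_) (sym (ℕₚ.m+[n∸m]≡n i≤j))) (↑-+ γ i (j ∸ i))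

    gap : ∀ {i j} → i < j → j < k → 0 < j ∸ i × j ∸ i < k
    gap {i} {j} i<j j<k = ℕₚ.m<n⇒0<n∸m i<j , ℕₚ.≤-<-trans (ℕₚ.m∸n≤m j i) j<k

    γ↑≢γ↑ : ∀ {i j} → i < j → j < k → ¬ γ ↑ i ≡ γ ↑ j
    γ↑≢γ↑ {i} i<j j<k e = let 0<g , g<k = gap i<j j<k in
      γ↑≢1 0<g g<k (sym (*-cancelˡ (↑-≢0 i γ≢0) (trans (*-identityʳ _) (trans e (γ-split (ℕₚ.<⇒≤ i<j))))))

    γ-injective : ∀ {i j} → i < k → j < k → γ ↑ i ≡ γ ↑ j → i ≡ j
    γ-injective {i} {j} i<k j<k e with ℕₚ.<-cmp i j
    ... | tri≈ _ i≡j _ = i≡j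
    ... | tri< i<j _ _ = ⊥-elim (γ↑≢γ↑ i<j j<k e)
    ... | tri> _ _ j<i = ⊥-elim (γ↑≢γ↑ j<i i<k (sym e))

    f : ℕ → Sign
    f n = χ (1# + - (γ ↑ n))

    -- The factors `1#` make this definitionally the bracket `br` of two finite points.
    bracket : ℕ → ℕ → Carrier
    bracket i j = γ ↑ i * 1# + - (γ ↑ j * 1#)

    bracket≢0 : ∀ {i j} → i < k → j < k → ¬ i ≡ j → ¬ bracket i j ≡ 0#
    bracket≢0 {i} {j} i<k j<k i≢j e = i≢j (γ-injective i<k j<k (x-y≡0⇒x≡y
      (trans (solve 2 (λ x y → x :- y := x :* κ 1 :- y :* κ 1) refl (γ ↑ i) (γ ↑ j)) e)))

    χ-bracket-< : ∀ {i j} → i < j → j < k → χ (bracket i j) ≡ f ∣ i - j ∣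
    χ-bracket-< {i} {j} i<j j<k = begin
      χ (γ ↑ i * 1# + - (γ ↑ j * 1#))                ≡⟨ cong (λ t → χ (γ ↑ i * 1# + - (t * 1#))) (γ-split (ℕₚ.<⇒≤ i<j)) ⟩
      χ (γ ↑ i * 1# + - (γ ↑ i * γ ↑ (j ∸ i) * 1#))  ≡⟨ cong χ (solve 2 (λ x y → x :* κ 1 :- x :* y :* κ 1 := x :* (κ 1 :- y)) refl (γ ↑ i) (γ ↑ (j ∸ i))) ⟩
      χ (γ ↑ i * (1# + - (γ ↑ (j ∸ i))))             ≡⟨ cong (λ t → χ (t * (1# + - (γ ↑ (j ∸ i))))) (γ-square i) ⟩
      χ (δ ↑ i * δ ↑ i * (1# + - (γ ↑ (j ∸ i))))     ≡⟨ χ-sq* (↑-≢0 i (↑-≢0 (m ℕ.* c) α≢0)) (1-γ↑≢0 (proj₁ (gap i<j j<k)) (proj₂ (gap i<j j<k))) ⟩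
      f (j ∸ i)                                      ≡⟨ cong f (sym (ℕₚ.m≤n⇒∣m-n∣≡n∸m (ℕₚ.<⇒≤ i<j))) ⟩
      f ∣ i - j ∣ ∎
      where open ≡-Reasoning

    χ-bracket : ∀ {i j} → i < k → j < k → ¬ i ≡ j → χ (bracket i j) ≡ f ∣ i - j ∣
    χ-bracket {i} {j} i<k j<k i≢j with ℕₚ.<-cmp i j
    ... | tri≈ _ i≡j _ = ⊥-elim (i≢j i≡j)
    ... | tri< i<j _ _ = χ-bracket-< i<j j<k
    ... | tri> _ _ j<i = trans (cong χ (solve 2 (λ x y → x :- y := :- (y :- x)) refl (γ ↑ i * 1#) (γ ↑ j * 1#)))
      (trans (χ-neg (bracket≢0 j<k i<k (λ e → i≢j (sym e)))) (trans (χ-bracket-< j<i i<k) (cong f (ℕₚ.∣-∣-comm j i))))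

    module Table (φ : ℕ → Sign) (f≡φ : ∀ {n} → 0 < n → n < k → f n ≡ φ n) where
      χ-bracket-φ : ∀ {i j} → i < k → j < k → ¬ i ≡ j → χ (bracket i j) ≡ φ ∣ i - j ∣
      χ-bracket-φ {i} {j} i<k j<k i≢j = trans (χ-bracket i<k j<k i≢j) (f≡φ (ℕₚ.n≢0⇒n>0 λ e → i≢j (ℕₚ.∣m-n∣≡0⇒m≡n e))
        (ℕₚ.≤-<-trans (ℕₚ.∣m-n∣≤m⊔n i j) (ℕₚ.⊔-lub i<k j<k)))

      open Typed γ k φ γ-injective (λ {i} {j} {l} i<k j<k l<k i≢j j≢l l≢i →
        trans (χ-* (*-≢0 (bracket≢0 i<k j<k i≢j) (bracket≢0 j<k l<k j≢l)) (bracket≢0 l<k i<k l≢i))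
          (cong₂ Sign._*_ (trans (χ-* (bracket≢0 i<k j<k i≢j) (bracket≢0 j<k l<k j≢l))
            (cong₂ Sign._*_ (χ-bracket-φ i<k j<k i≢j) (χ-bracket-φ j<k l<k j≢l))) (χ-bracket-φ l<k i<k l≢i))) public
        using (design⇒balanced; balanced⇒design)

    -- γ ↑ (i + j) = 1 gives 1 - γ ↑ j = -γ ↑ j (1 - γ ↑ i), and χ drops both the sign and the
    -- square γ ↑ j.
    f-symmetric : ∀ i j → i ℕ.+ j ≡ k → 0 < i → i < k → f j ≡ f i
    f-symmetric i j i+j 0<i i<k = begin
      χ (1# + - (γ ↑ j))
        ≡⟨ cong χ (trans (solve 2 (λ x y → κ 1 :- y := :- (y :* (κ 1 :- x)) :+ (κ 1 :- x :* y)) refl (γ ↑ i) (γ ↑ j))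
             (trans (cong (- (γ ↑ j * (1# + - (γ ↑ i))) +_) (x≡y⇒x-y≡0 (sym (trans (sym (↑-+ γ i j)) (trans (cong (γ ↑_) i+j) γ↑k≡1))))) (+-identityʳ _))) ⟩
      χ (- (γ ↑ j * (1# + - (γ ↑ i))))       ≡⟨ χ-neg (*-≢0 (↑-≢0 j γ≢0) (1-γ↑≢0 0<i i<k)) ⟩
      χ (γ ↑ j * (1# + - (γ ↑ i)))           ≡⟨ cong (λ t → χ (t * (1# + - (γ ↑ i)))) (γ-square j) ⟩
      χ (δ ↑ j * δ ↑ j * (1# + - (γ ↑ i)))   ≡⟨ χ-sq* (↑-≢0 j (↑-≢0 (m ℕ.* c) α≢0)) (1-γ↑≢0 0<i i<k) ⟩
      f i ∎
      where open ≡-Reasoning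

  e u v : Sign
  e = χ (1# + β)
  u = χ (1# + - β)
  v = χ [ 2 ]

  e≡χs : e ≡ χ s
  e≡χs = sym (trans χs≡χθ χθ≡χ[1+β])

  1-β≢0 : ¬ 1# + - β ≡ 0#
  1-β≢0 e = α↑-≢1 4 (ℕₚ.m≤m+n 5 15) (sym (x-y≡0⇒x≡y e))

  χ[1-β²] : χ (1# + - (β * β)) ≡ u Sign.* e
  χ[1-β²] = trans (cong χ (solve 1 (λ b → κ 1 :- b :* b := (κ 1 :- b) :* (κ 1 :+ b)) refl β)) (χ-* 1-β≢0 1+β≢0)

  design₅ : OrbitIs3Design F β 5 ⇔ (χ s ≡ Sign.-)
  design₅ = mk⇔
    (λ d → trans (sym e≡χs) (χ-≢+ λ e≡+ → unbalanced₅ u (subst (λ e → #triples 5 (φ₅ e u) Sign.+ ≡ #triples 5 (φ₅ e u) Sign.-) e≡+ (design⇒balanced d))))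
    (λ χs → balanced⇒design (trans (N₊ χs) (sym (N₋ χs))) (subst (0 <_) (sym (N₊ χs)) z<s))
    where
    open Cyclic 2 5 refl z<s
    f1 : f 1 ≡ u
    f1 = cong (λ t → χ (1# + - t)) (*-identityʳ β)
    f2 : f 2 ≡ u Sign.* e
    f2 = trans (cong (λ t → χ (1# + - (β * t))) (*-identityʳ β)) χ[1-β²]
    table : ∀ {n} → 0 < n → n < 5 → f n ≡ φ₅ e u n
    table {1} _ _ = f1
    table {2} _ _ = f2
    table {3} _ _ = trans (f-symmetric 2 3 refl z<s (ℕₚ.m≤m+n 3 2)) f2
    table {4} _ _ = trans (f-symmetric 1 4 refl z<s (ℕₚ.m≤m+n 2 3)) f1
    table {suc (suc (suc (suc (suc _))))} _ (s≤s (s≤s (s≤s (s≤s (s≤s ())))))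
    open Table (φ₅ e u) table
    N₊ : χ s ≡ Sign.- → #triples 5 (φ₅ e u) Sign.+ ≡ 30
    N₊ χs = subst (λ e → #triples 5 (φ₅ e u) Sign.+ ≡ 30) (sym (trans e≡χs χs)) (proj₁ (balanced₅ u))
    N₋ : χ s ≡ Sign.- → #triples 5 (φ₅ e u) Sign.- ≡ 30
    N₋ χs = subst (λ e → #triples 5 (φ₅ e u) Sign.- ≡ 30) (sym (trans e≡χs χs)) (proj₂ (balanced₅ u))

  design₁₀ : OrbitIs3Design F (α ↑ (m ℕ.* 2)) 10 ⇔ (χ s ≡ Sign.-)
  design₁₀ = mk⇔
    (λ d → trans (sym e≡χs) (χ-≢+ λ e≡+ → unbalanced₁₀ u v (subst (λ e → #triples 10 (φ₁₀ e u v) Sign.+ ≡ #triples 10 (φ₁₀ e u v) Sign.-) e≡+ (design⇒balanced d))))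
    (λ χs → balanced⇒design (trans (N₊ χs) (sym (N₋ χs))) (subst (0 <_) (sym (N₊ χs)) z<s))
    where
    open Cyclic 1 10 refl z<s
    γ²≡β : γ ↑ 2 ≡ β
    γ²≡β = γ↑n 2
    γ⁴≡β² : γ ↑ 4 ≡ β * β
    γ⁴≡β² = trans (↑-+ γ 2 2) (cong₂ _*_ γ²≡β γ²≡β)
    γ⁵≡-1 : γ ↑ 5 ≡ - 1#
    γ⁵≡-1 = trans (γ↑n 5) α↑10m≡-1
    -- γ⁵ = -1, so (1 - γⁿ)(1 - γⁿ⁺⁵) = 1 - γ²ⁿ.
    f-double : ∀ n → 0 < n → n ℕ.+ 5 < 10 → f n Sign.* f (n ℕ.+ 5) ≡ f (n ℕ.+ n)
    f-double n 0<n n+5<10 = trans (sym (χ-* (1-γ↑≢0 0<n (ℕₚ.≤-<-trans (ℕₚ.m≤m+n n 5) n+5<10)) (1-γ↑≢0 (ℕₚ.≤-trans 0<n (ℕₚ.m≤m+n n 5)) n+5<10)))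
      (cong χ (begin
        (1# + - (γ ↑ n)) * (1# + - (γ ↑ (n ℕ.+ 5)))   ≡⟨ cong (λ t → (1# + - (γ ↑ n)) * (1# + - t)) (trans (↑-+ γ n 5) (cong (γ ↑ n *_) γ⁵≡-1)) ⟩
        (1# + - (γ ↑ n)) * (1# + - (γ ↑ n * - 1#))    ≡⟨ solve 1 (λ x → (κ 1 :- x) :* (κ 1 :- x :* (:- κ 1)) := κ 1 :- x :* x) refl (γ ↑ n) ⟩
        1# + - (γ ↑ n * γ ↑ n)                        ≡⟨ cong (λ t → 1# + - t) (sym (↑-+ γ n n)) ⟩
        1# + - (γ ↑ (n ℕ.+ n)) ∎))
      where open ≡-Reasoning
    solve-sign : ∀ a b c d → a Sign.* b ≡ c → b ≡ c Sign.* d → a ≡ d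
    solve-sign a b c d p q = Signₚ.*-cancelʳ-≡ b a d (trans p (trans (sym (Signₚ.*-identityʳ c))
      (trans (cong (c Sign.*_) (sym (Signₚ.s*s≡+ d))) (trans (sym (Signₚ.*-assoc c d d)) (trans (cong (Sign._* d) (sym q)) (Signₚ.*-comm b d))))))
    f2 : f 2 ≡ u
    f2 = cong (λ t → χ (1# + - t)) γ²≡β
    f4 : f 4 ≡ u Sign.* e
    f4 = trans (cong (λ t → χ (1# + - t)) γ⁴≡β²) χ[1-β²]
    f5 : f 5 ≡ v
    f5 = cong χ (trans (cong (λ t → 1# + - t) γ⁵≡-1) (solve 0 (κ 1 :- (:- κ 1) := κ 2) refl))
    f6 : f 6 ≡ u Sign.* e
    f6 = trans (f-symmetric 4 6 refl z<s (ℕₚ.m≤m+n 5 5)) f4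
    f8 : f 8 ≡ u
    f8 = trans (f-symmetric 2 8 refl z<s (ℕₚ.m≤m+n 3 7)) f2
    -- γ itself is not a power of β, but (1 - γ)(1 - γ⁶) = 1 - γ² relates it to exponents 2 and 6,
    -- which are already known. The value at 3 comes from 8 and 6 in the same way.
    f1 : f 1 ≡ e
    f1 = solve-sign (f 1) (f 6) u e (trans (f-double 1 z<s (ℕₚ.m≤m+n 7 3)) f2) f6
    f3 : f 3 ≡ e
    f3 = solve-sign (f 3) (f 8) (u Sign.* e) e (trans (f-double 3 z<s (ℕₚ.m≤m+n 9 1)) f6)
      (trans f8 (sym (trans (Signₚ.*-assoc u e e) (trans (cong (u Sign.*_) (Signₚ.s*s≡+ e)) (Signₚ.*-identityʳ u)))))
    table : ∀ {n} → 0 < n → n < 10 → f n ≡ φ₁₀ e u v n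
    table {1} _ _ = f1
    table {2} _ _ = f2
    table {3} _ _ = f3
    table {4} _ _ = f4
    table {5} _ _ = f5
    table {6} _ _ = f6
    table {7} _ _ = trans (f-symmetric 3 7 refl z<s (ℕₚ.m≤m+n 4 6)) f3
    table {8} _ _ = f8
    table {9} _ _ = trans (f-symmetric 1 9 refl z<s (ℕₚ.m≤m+n 2 8)) f1
    table {suc (suc (suc (suc (suc (suc (suc (suc (suc (suc _)))))))))} _ (s≤s (s≤s (s≤s (s≤s (s≤s (s≤s (s≤s (s≤s (s≤s (s≤s ()))))))))))
    open Table (φ₁₀ e u v) table
    N₊ : χ s ≡ Sign.- → #triples 10 (φ₁₀ e u v) Sign.+ ≡ 360
    N₊ χs = subst (λ e → #triples 10 (φ₁₀ e u v) Sign.+ ≡ 360) (sym (trans e≡χs χs)) (proj₁ (balanced₁₀ u v))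
    N₋ : χ s ≡ Sign.- → #triples 10 (φ₁₀ e u v) Sign.- ≡ 360
    N₋ χs = subst (λ e → #triples 10 (φ₁₀ e u v) Sign.- ≡ 360) (sym (trans e≡χs χs)) (proj₂ (balanced₁₀ u v))

-- Assembly of the equivalences

-- Converts the exponents (q - 1) / k of the statement into multiples of m, the form in which all
-- roots of unity are handled.
exponent : ∀ {q} m c k .{{_ : ℕ.NonZero k}} → q ≡ suc (m ℕ.* 20) → c ℕ.* k ≡ 20 → (q ∸ 1) / k ≡ m ℕ.* c
exponent m c k refl ck≡20 = trans (cong (_/ k) (trans (cong (m ℕ.*_) (sym ck≡20)) (sym (ℕₚ.*-assoc m c k)))) (m*n/n≡m (m ℕ.* c) k)

theorem4p1 : (q : ℕ) (F : FiniteField q) → q % 20 ≡ 1 →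
    (α : FiniteField.Carrier F) → IsPrimitiveRoot F α →
    let open FiniteField F
        β = _^_ F α ((q ∸ 1) / 5)
        i = Gives3Design F α 5
        ii = Gives3Design F α 10
        iii = χ≡-1 F (1# + β)
        iv = ∃[ θ ] (χ≡-1 F θ × (_^_ F θ 2 + - (fromℕ F 4 * θ) + - 1# ≡ 0#))
        v = ¬ (_∈⟨_⟩ F (fromℕ F 5) (_^_ F α 4))
    in (i ⇔ ii) × (ii ⇔ iii) × (iii ⇔ iv) × (iv ⇔ v)
       × (Prime q → (v ⇔ (¬ RepBy 20 q)) × ((¬ RepBy 20 q) ⇔ (¬ RepBy 100 q)))
theorem4p1 q F q%20≡1 α prim =
  ⇔.trans i⇔ (⇔.sym ii⇔) , ⇔.trans ii⇔ (⇔.sym iii⇔′) , ⇔.trans iii⇔′ (⇔.sym iv⇔) , ⇔.trans iv⇔ (⇔.sym v⇔) ,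
  λ q-prime → let open Thue F m q≡ α prim q-prime in
    ⇔.trans v⇔ χs≡-⇔¬RepBy20 , ⇔.trans (⇔.sym χs≡-⇔¬RepBy20) χs≡-⇔¬RepBy100
  where
  m : ℕ
  m = q / 20
  q≡ : q ≡ suc (m ℕ.* 20)
  q≡ = trans (m≡m%n+[m/n]*n q 20) (cong (ℕ._+ m ℕ.* 20) q%20≡1)
  open Golden F m q≡ α prim
  open Equivalences F m q≡ α prim using (design₅; design₁₀)
  i⇔ : Gives3Design F α 5 ⇔ (χ s ≡ Sign.-)
  i⇔ = subst (λ E → OrbitIs3Design F (α ↑ E) 5 ⇔ (χ s ≡ Sign.-)) (sym (exponent m 4 5 q≡ refl)) design₅
  ii⇔ : Gives3Design F α 10 ⇔ (χ s ≡ Sign.-)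
  ii⇔ = subst (λ E → OrbitIs3Design F (α ↑ E) 10 ⇔ (χ s ≡ Sign.-)) (sym (exponent m 2 10 q≡ refl)) design₁₀
  iii⇔′ : χ≡-1 F (1# + α ↑ ((q ∸ 1) / 5)) ⇔ (χ s ≡ Sign.-)
  iii⇔′ = subst (λ E → χ≡-1 F (1# + α ↑ E) ⇔ (χ s ≡ Sign.-)) (sym (exponent m 4 5 q≡ refl)) iii⇔
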